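{- Suppose $V(B,\mathbf b)\ne\emptyset$ and $H_1^{(B,\mathbf b)},\ldots,H_m^{(B,\mathbf b)}$ are codimension-one (affine) subspaces of $V(B,\mathbf b)$. For any integers $q>q_0$ and $1\le a\le\rho_C$, if $\gcd(q,\rho_C)=\gcd(a,\rho_C)$ and $[\mathbf c_J]_q\in\mathrm{Col}_q(C_J)$ for all $J\subseteq[m]$ with $\bar r(J)=r(J)$, then $$0<w_j\big(\mathcal{A}^{(B,\mathbf b)}\big)=\gamma_j(1)\le\gamma_j(a)=\beta_j(q)\quad\text{for all } r\le j\le s.$$ Moreover, when $\mathbf a=\mathbf 0$ and $\mathbf b=\mathbf 0$, for any integers $q\ge1$ and $1\le a\le\rho_C$, if $\gcd(q,\rho_C)=\gcd(a,\rho_C)$, then $$0<w_j\big(\mathcal{A}^{(B,\mathbf 0)}\big)=\gamma_j(1)\le\gamma_j(a)=\beta_j(q)\quad\text{for all } r\le j\le s.$$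
   Context: Let $A$ be an $m\times n$ integer matrix with rows $\boldsymbol\alpha_1^T,\dots,\boldsymbol\alpha_m^T$, $B$ an $l\times n$ integer matrix ($l=0$ is allowed: no equations), $\mathbf a=(a_1,\dots,a_m)^T\in\mathbb{Z}^m$, $\mathbf b\in\mathbb{Z}^l$, and $[m]=\{1,\dots,m\}$. (Italic $a$ is an integer, bold $\mathbf a,\mathbf b$ are vectors.) For a positive integer $q$, $\mathbb{Z}_q=\mathbb{Z}/q\mathbb{Z}$, $[\cdot]_q$ is the entrywise reduction modulo $q$, and $\mathrm{Col}_q(N)$ is the $\mathbb{Z}_q$-module generated by the columns of $[N]_q$. Let $V(B,\mathbf b)=\{\mathbf x\in\mathbb{R}^n: B\mathbf x=\mathbf b\}$ and $H_i^{(B,\mathbf b)}=\{\mathbf x\in V(B,\mathbf b):\boldsymbol\alpha_i^T\mathbf x=a_i\}$; the truncated arrangement is $\mathcal{A}^{(B,\mathbf b)}=\{H_1^{(B,\mathbf b)},\dots,H_m^{(B,\mathbf b)}\}$, with characteristic polynomial $$\chi\big(\mathcal{A}^{(B,\mathbf b)},t\big)=\sum_{J\subseteq[m],\ \bigcap_{j\in J}H_j^{(B,\mathbf b)}\ne\emptyset}(-1)^{\#J}t^{\dim(\bigcap_{j\in J}H_j^{(B,\mathbf b)})}$$ (the intersection for $J=\emptyset$ being $V(B,\mathbf b)$). Let $r=\operatorname{rank}(B)$ and $s=\operatorname{rank}\begin{bmatrix}B\\ A\end{bmatrix}$. The numbers $w_j\big(\mathcal{A}^{(B,\mathbf b)}\big)$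 are defined by $\chi\big(\mathcal{A}^{(B,\mathbf b)},t\big)=\sum_{j=r}^s(-1)^{j-r}w_j\big(\mathcal{A}^{(B,\mathbf b)}\big)t^{n-j}$. For $J\subseteq[m]$, let $A_J$ and $\mathbf a_J$ consist of the rows of $A$ and entries of $\mathbf a$ indexed by $J$; $C_J=\begin{bmatrix}B\\ A_J\end{bmatrix}$, $\mathbf c_J=\begin{bmatrix}\mathbf b\\ \mathbf a_J\end{bmatrix}$, $\bar C_J=[C_J\ \mathbf c_J]$; $r(J)=\operatorname{rank}C_J$, $\bar r(J)=\operatorname{rank}\bar C_J$ (ranks over $\mathbb{Q}$). The invariant factors of an integer matrix are the nonzero diagonal entries (taken positive, each dividing the next) of its Smith normal form; let $d_{J,1}\mid\cdots\mid d_{J,r(J)}$ be those of $C_J$ and $\bar d_{J,1}\mid\cdots\mid\bar d_{J,\bar r(J)}$ those of $\bar C_J$. Put $\rho_C=\operatorname{lcm}\{d_{J,r(J)}: J\subseteq[m],\ \bar r(J)=r(J)\}$ and $q_0=\max\{\bar d_{J,\bar r(J)}: J\subseteq[m],\ \bar r(J)=r(J)+1\}$, with $q_0=0$ if no such $J$ exists; $d_{J,0}=1$. For $J$ with $\bar r(J)=r(J)$ and a positive integer $q$, let $\tilde d_J(q)=\prod_{j=1}^{r(J)}\gcd(d_{J,j},q)$ if $\gcd(q,d_{J,j})=\gcd(q,\bar d_{J,j})$ for all $j=1,\dots,r(J)$, and $\tilde d_J(q)=0$ otherwise. For $r\le j\le s$ and a positive integer $q$ set $$\beta_j(q)=(-1)^{j-r}\sum_{J\subseteq[m],\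 \bar r(J)=r(J)=j}(-1)^{\#J}\tilde d_J(q),$$ and for $1\le a\le\rho_C$ let $\gamma_j(a)$ be given by the same formula with $q$ replaced by $a$. These are the unsigned coefficients of the characteristic quasi-polynomial $\chi^{\mathrm{quasi}}\big(\mathcal{A}^{(B,\mathbf b)},q\big)=\sum_{j=r}^s(-1)^{j-r}\beta_j(q)q^{n-j}$ and of its $a$-constituent $f_a\big(\mathcal{A}^{(B,\mathbf b)},t\big)=\sum_{j=r}^s(-1)^{j-r}\gamma_j(a)t^{n-j}$. -}

module Defs where

import Algebra.Properties.CommutativeSemigroup as CommutativeSemigroupProperties
import Algebra.Properties.Group as GroupProperties
import Algebra.Properties.Semiring.Sum as SemiringSum
open import Algebra.Bundles using (CommutativeRing)
open import Data.Bool.Base using (true; false; if_then_else_)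
open import Data.Fin.Base using (Fin; zero; suc; toℕ; _↑ˡ_; _↑ʳ_; splitAt)
open import Data.Fin.Permutation.Components using (transpose; transpose-inverse)
import Data.Fin.Properties as Finₚ
open import Data.Fin.Subset using (Subset; inside; outside; ∣_∣; _∈_)
open import Data.Integer.Base using (ℤ; +_; -[1+_]; 0ℤ; 1ℤ; -1ℤ)
import Data.Integer.Base as ℤ
import Data.Integer.DivMod as ℤ/
open import Data.Integer.Divisibility.Signed using (_∣_; divides; _∣?_; ∣m∣n⇒∣m+n; ∣n⇒∣m*n; ∣m⇒∣m*n; ∣⇒∣ᵤ)
import Data.Integer.Divisibility.Signed as Signed
import Data.Integer.Properties as ℤₚ
open import Data.Integer.Tactic.RingSolver using (solve-∀)
open import Data.List.Base using (List; []; _∷_; filter; foldr; map; upTo)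
import Data.List.Base as List
import Data.List.Relation.Unary.All as All
open import Data.Nat.Base using (ℕ; zero; suc)
import Data.Nat.Base as ℕ
open import Data.Nat.Divisibility using (_∣0) renaming (_∣_ to _∣ℕ_)
open import Data.Nat.GCD using (gcd)
open import Data.Nat.Induction using (<-wellFounded)
open import Data.Nat.LCM using (lcm)
import Data.Nat.ListAction as ℕList
import Data.Nat.Properties as ℕₚ
open import Data.Product.Base using (∃; _×_; _,_; proj₁; proj₂)
open import Data.Rational.Base using (ℚ; 0ℚ; 1ℚ; ½)
import Data.Rational.Base as ℚ
open import Data.Rational.Literals using (fromℤ)
import Data.Rational.Properties as ℚₚ
open import Data.Rational.Solver using (module +-*-Solver)
import Data.Rational.Unnormalised.Base as ℚᵘ
import Data.Rational.Unnormalised.Properties as ℚᵘₚ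
open import Data.Sum.Base using (_⊎_; inj₁; inj₂; [_,_])
import Data.Sum.Base as Sum
open import Data.Vec.Base using (here; there) renaming (_∷_ to _∷ᵥ_; [] to []ᵥ)
open import Data.Vec.Functional using (Vector; _++_)
open import Data.Vec.Functional.Properties using (lookup-++ˡ; lookup-++ʳ)
open import Function.Base using (_∘_; id)
open import Function.Bundles using (_⇔_; mk⇔; Equivalence)
open import Induction.WellFounded using (Acc; acc)
open import Level using (0ℓ)
open import Relation.Nullary using (¬_; Dec; yes; no; does; contradiction)
open import Relation.Nullary.Decidable using (_×-dec_)
import Relation.Binary.Reasoning.Setoid as SetoidReasoning
open import Relation.Binary.PropositionalEquality using (_≡_; _≢_; cong; cong₂; subst₂; module ≡-Reasoning) renaming (refl to refl≡; sym to sym≡; trans to trans≡; subst to subst≡)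

-- A real number is a Cauchy sequence of rationals; two of them are equal when
-- their difference tends to 0.  The Cauchy condition carries its modulus.

IsCauchy : (ℕ → ℚ) → Set
IsCauchy s = ∀ ε → 0ℚ ℚ.< ε →
  ∃ λ N → ∀ i j → N ℕ.≤ i → N ℕ.≤ j → ℚ.∣ s i ℚ.- s j ∣ ℚ.< ε

record ℝ : Set where
  field
    seq    : ℕ → ℚ
    cauchy : IsCauchy seq
open ℝ public

infix 4 _≈ℝ_

record _≈ℝ_ (x y : ℝ) : Set where
  constructor mk≈
  field
    close : ∀ ε → 0ℚ ℚ.< ε → ∃ λ N → ∀ i → N ℕ.≤ i → ℚ.∣ seq x i ℚ.- seq y i ∣ ℚ.< ε
open _≈ℝ_ public

private
  module Small where
    open +-*-Solver using (solve; _:=_; _:+_; _:*_; :-_; _:-_)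

    Family : Set
    Family = ℕ → ℕ → ℚ

    Small : Family → Set
    Small z = ∀ ε → 0ℚ ℚ.< ε → ∃ λ N → ∀ i j → N ℕ.≤ i → N ℕ.≤ j → ℚ.∣ z i j ∣ ℚ.< ε

    Bounded : Family → Set
    Bounded z = ∃ λ K → 0ℚ ℚ.< K ×
      ∃ λ N → ∀ i j → N ℕ.≤ i → N ℕ.≤ j → ℚ.∣ z i j ∣ ℚ.< K

    private
      l≤ : ∀ {a b i} → a ℕ.⊔ b ℕ.≤ i → a ℕ.≤ i
      l≤ {a} {b} p = ℕₚ.≤-trans (ℕₚ.m≤m⊔n a b) p
      r≤ : ∀ {a b i} → a ℕ.⊔ b ℕ.≤ i → b ℕ.≤ i
      r≤ {a} {b} p = ℕₚ.≤-trans (ℕₚ.m≤n⊔m a b) p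

      half>0 : ∀ {ε} → 0ℚ ℚ.< ε → 0ℚ ℚ.< ½ ℚ.* ε
      half>0 {ε} p = ℚₚ.positive⁻¹ (½ ℚ.* ε) {{ℚₚ.pos*pos⇒pos ½ ε {{ℚ.positive p}}}}

      halves : ∀ ε → ½ ℚ.* ε ℚ.+ ½ ℚ.* ε ≡ ε
      halves ε = trans≡ (sym≡ (ℚₚ.*-distribʳ-+ ε ½ ½)) (ℚₚ.*-identityˡ ε)

    small-cong : ∀ {y z : Family} → (∀ i j → y i j ≡ z i j) → Small y → Small z
    small-cong eq S ε ε>0 with S ε ε>0
    ... | N , h = N , λ i j p q → subst≡ (λ t → ℚ.∣ t ∣ ℚ.< ε) (eq i j) (h i j p q)

    small-neg : ∀ {z : Family} → Small z → Small (λ i j → ℚ.- z i j)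
    small-neg {z} S ε ε>0 with S ε ε>0
    ... | N , h = N , λ i j p q →
      subst≡ (ℚ._< ε) (sym≡ (ℚₚ.∣-p∣≡∣p∣ (z i j))) (h i j p q)

    small-0 : ∀ {z : Family} → (∀ i j → z i j ≡ 0ℚ) → Small z
    small-0 eq ε ε>0 = 0 , λ i j _ _ → subst≡ (λ t → ℚ.∣ t ∣ ℚ.< ε) (sym≡ (eq i j)) ε>0

    small-+ : ∀ {y z : Family} → Small y → Small z → Small (λ i j → y i j ℚ.+ z i j)
    small-+ {y} {z} S T ε ε>0 with S (½ ℚ.* ε) (half>0 ε>0) | T (½ ℚ.* ε) (half>0 ε>0)
    ... | N , h | N′ , h′ = N ℕ.⊔ N′ , λ i j p q →
      ℚₚ.≤-<-trans (ℚₚ.∣p+q∣≤∣p∣+∣q∣ (y i j) (z i j))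
        (subst≡ (ℚ.∣ y i j ∣ ℚ.+ ℚ.∣ z i j ∣ ℚ.<_) (halves ε)
          (ℚₚ.+-mono-< (h i j (l≤ p) (l≤ q)) (h′ i j (r≤ {N} p) (r≤ {N} q))))

    small-* : ∀ {x z : Family} → Bounded x → Small z → Small (λ i j → x i j ℚ.* z i j)
    small-* {x} {z} (K , K>0 , N , h) S ε ε>0 = N ℕ.⊔ N′ , bound
      where
      instance
        posK = ℚ.positive K>0
        posε = ℚ.positive ε>0
        nzK  = ℚₚ.pos⇒nonZero K
        posK⁻¹ = ℚₚ.1/pos⇒pos K
      δ : ℚ
      δ = ℚ.1/ K ℚ.* ε
      δ>0 : 0ℚ ℚ.< δ
      δ>0 = ℚₚ.positive⁻¹ δ {{ℚₚ.pos*pos⇒pos (ℚ.1/ K) ε}}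
      N′ = proj₁ (S δ δ>0)
      h′ = proj₂ (S δ δ>0)
      Kδ : K ℚ.* δ ≡ ε
      Kδ = trans≡ (sym≡ (ℚₚ.*-assoc K (ℚ.1/ K) ε))
             (trans≡ (cong (ℚ._* ε) (ℚₚ.*-inverseʳ K)) (ℚₚ.*-identityˡ ε))
      bound : ∀ i j → N ℕ.⊔ N′ ℕ.≤ i → N ℕ.⊔ N′ ℕ.≤ j → ℚ.∣ x i j ℚ.* z i j ∣ ℚ.< ε
      bound i j p q = subst₂ ℚ._<_ (sym≡ (ℚₚ.∣p*q∣≡∣p∣*∣q∣ (x i j) (z i j))) Kδ
        (ℚₚ.≤-<-trans
          (ℚₚ.*-monoʳ-≤-nonNeg ℚ.∣ z i j ∣ {{ℚₚ.∣-∣-nonNeg (z i j)}}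
            (ℚₚ.<⇒≤ (h i j (l≤ p) (l≤ q))))
          (ℚₚ.*-monoʳ-<-pos K (h′ i j (r≤ {N} p) (r≤ {N} q))))

    cauchy⇒bounded : ∀ {s} → IsCauchy s → ∃ λ K → 0ℚ ℚ.< K × ∃ λ N → ∀ i → N ℕ.≤ i → ℚ.∣ s i ∣ ℚ.< K
    cauchy⇒bounded {s} C with C 1ℚ (ℚₚ.positive⁻¹ 1ℚ)
    ... | N , h = K , ℚₚ.<-≤-trans 0<1 1≤K , N , λ i p →
      subst≡ (λ t → ℚ.∣ t ∣ ℚ.< K) (eq i)
        (ℚₚ.≤-<-trans (ℚₚ.∣p+q∣≤∣p∣+∣q∣ (s i ℚ.- s N) (s N))
          (ℚₚ.+-monoˡ-< ℚ.∣ s N ∣ (h i N p ℕₚ.≤-refl)))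
      where
      K = 1ℚ ℚ.+ ℚ.∣ s N ∣
      0<1 : 0ℚ ℚ.< 1ℚ
      0<1 = ℚₚ.positive⁻¹ 1ℚ
      1≤K : 1ℚ ℚ.≤ K
      1≤K = subst≡ (ℚ._≤ K) (ℚₚ.+-identityʳ 1ℚ) (ℚₚ.+-monoʳ-≤ 1ℚ (ℚₚ.0≤∣p∣ (s N)))
      eq : ∀ i → s i ℚ.- s N ℚ.+ s N ≡ s i
      eq i = solve 2 (λ a b → a :- b :+ b := a) refl≡ (s i) (s N)

    boundedˡ : ∀ x → Bounded (λ i j → seq x i)
    boundedˡ x = let K , K>0 , N , h = cauchy⇒bounded (cauchy x) in K , K>0 , N , λ i j p q → h i p

    boundedʳ : ∀ x → Bounded (λ i j → seq x j)
    boundedʳ x = let K , K>0 , N , h = cauchy⇒bounded (cauchy x) in K , K>0 , N , λ i j p q → h j q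

    toSmall : ∀ {x y} → x ≈ℝ y → Small (λ i _ → seq x i ℚ.- seq y i)
    toSmall x≈y ε ε>0 with close x≈y ε ε>0
    ... | N , h = N , λ i j p q → h i p

    fromSmall : ∀ {x y} → Small (λ i _ → seq x i ℚ.- seq y i) → x ≈ℝ y
    fromSmall S = mk≈ λ ε ε>0 → proj₁ (S ε ε>0) , λ i p → proj₂ (S ε ε>0) i i p p

    swap- : ∀ a b → ℚ.- (a ℚ.- b) ≡ b ℚ.- a
    swap- = solve 2 (λ a b → :- (a :- b) := b :- a) refl≡

    tele : ∀ a b c → (a ℚ.- b) ℚ.+ (b ℚ.- c) ≡ a ℚ.- c
    tele = solve 3 (λ a b c → (a :- b) :+ (b :- c) := a :- c) refl≡

    +-diff : ∀ a b c d → (a ℚ.- c) ℚ.+ (b ℚ.- d) ≡ (a ℚ.+ b) ℚ.- (c ℚ.+ d)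
    +-diff = solve 4 (λ a b c d → (a :- c) :+ (b :- d) := (a :+ b) :- (c :+ d)) refl≡

    neg-diff : ∀ a b → ℚ.- (a ℚ.- b) ≡ (ℚ.- a) ℚ.- (ℚ.- b)
    neg-diff = solve 2 (λ a b → :- (a :- b) := (:- a) :- (:- b)) refl≡

    *-diff : ∀ a b c d → a ℚ.* (b ℚ.- d) ℚ.+ d ℚ.* (a ℚ.- c) ≡ a ℚ.* b ℚ.- c ℚ.* d
    *-diff = solve 4 (λ a b c d → a :* (b :- d) :+ d :* (a :- c) := a :* b :- c :* d) refl≡

  open Small

infixl 6 _+ℝ_
infixl 7 _*ℝ_
infix  8 -ℝ_

private
  abstract
    +-cauchy : ∀ x y → IsCauchy (λ i → seq x i ℚ.+ seq y i)
    +-cauchy x y = small-cong (λ i j → +-diff (seq x i) (seq y i) (seq x j) (seq y j))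
      (small-+ (cauchy x) (cauchy y))

    *-cauchy : ∀ x y → IsCauchy (λ i → seq x i ℚ.* seq y i)
    *-cauchy x y = small-cong (λ i j → *-diff (seq x i) (seq y i) (seq x j) (seq y j))
      (small-+ (small-* (boundedˡ x) (cauchy y)) (small-* (boundedʳ y) (cauchy x)))

    neg-cauchy : ∀ x → IsCauchy (λ i → ℚ.- seq x i)
    neg-cauchy x = small-cong (λ i j → neg-diff (seq x i) (seq x j)) (small-neg (cauchy x))

    const-cauchy : ∀ p → IsCauchy (λ _ → p)
    const-cauchy p = small-0 (λ _ _ → ℚₚ.+-inverseʳ p)

_+ℝ_ : ℝ → ℝ → ℝ
x +ℝ y = record { seq = λ i → seq x i ℚ.+ seq y i ; cauchy = +-cauchy x y }

_*ℝ_ : ℝ → ℝ → ℝ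
x *ℝ y = record { seq = λ i → seq x i ℚ.* seq y i ; cauchy = *-cauchy x y }

-ℝ_ : ℝ → ℝ
-ℝ x = record { seq = λ i → ℚ.- seq x i ; cauchy = neg-cauchy x }

fromℚ : ℚ → ℝ
fromℚ p = record { seq = λ _ → p ; cauchy = const-cauchy p }

≗⇒≈ : ∀ {x y} → (∀ i → seq x i ≡ seq y i) → x ≈ℝ y
≗⇒≈ {x} {y} eq = fromSmall
  (small-0 (λ i _ → trans≡ (cong (ℚ._- seq y i) (eq i)) (ℚₚ.+-inverseʳ (seq y i))))

≈ℝ-sym : ∀ {x y} → x ≈ℝ y → y ≈ℝ x
≈ℝ-sym {x} {y} p = fromSmall (small-cong (λ i _ → swap- (seq x i) (seq y i)) (small-neg (toSmall p)))

≈ℝ-trans : ∀ {x y z} → x ≈ℝ y → y ≈ℝ z → x ≈ℝ z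
≈ℝ-trans {x} {y} {z} p q = fromSmall
  (small-cong (λ i _ → tele (seq x i) (seq y i) (seq z i)) (small-+ (toSmall p) (toSmall q)))

+ℝ-cong : ∀ {x y u v} → x ≈ℝ y → u ≈ℝ v → x +ℝ u ≈ℝ y +ℝ v
+ℝ-cong {x} {y} {u} {v} p q = fromSmall
  (small-cong (λ i _ → +-diff (seq x i) (seq u i) (seq y i) (seq v i)) (small-+ (toSmall p) (toSmall q)))

*ℝ-cong : ∀ {x y u v} → x ≈ℝ y → u ≈ℝ v → x *ℝ u ≈ℝ y *ℝ v
*ℝ-cong {x} {y} {u} {v} p q = fromSmall
  (small-cong (λ i _ → *-diff (seq x i) (seq u i) (seq y i) (seq v i))
    (small-+ (small-* (boundedˡ x) (toSmall q)) (small-* (boundedˡ v) (toSmall p))))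

-ℝ-cong : ∀ {x y} → x ≈ℝ y → -ℝ x ≈ℝ -ℝ y
-ℝ-cong {x} {y} p = fromSmall (small-cong (λ i _ → neg-diff (seq x i) (seq y i)) (small-neg (toSmall p)))

ℝ-ring : CommutativeRing 0ℓ 0ℓ
ℝ-ring = record
  { Carrier = ℝ ; _≈_ = _≈ℝ_ ; _+_ = _+ℝ_ ; _*_ = _*ℝ_ ; -_ = -ℝ_
  ; 0# = fromℚ 0ℚ ; 1# = fromℚ 1ℚ
  ; isCommutativeRing = record
    { isRing = record
      { +-isAbelianGroup = record
        { isGroup = record
          { isMonoid = record
            { isSemigroup = record
              { isMagma = record
                { isEquivalence = record { refl = ≗⇒≈ λ _ → refl≡ ; sym = ≈ℝ-sym ; trans = ≈ℝ-trans }
                ; ∙-cong = +ℝ-cong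
                }
              ; assoc = λ x y z → ≗⇒≈ λ i → ℚₚ.+-assoc (seq x i) (seq y i) (seq z i)
              }
            ; identity = (λ x → ≗⇒≈ λ i → ℚₚ.+-identityˡ (seq x i))
                       , (λ x → ≗⇒≈ λ i → ℚₚ.+-identityʳ (seq x i))
            }
          ; inverse = (λ x → ≗⇒≈ λ i → ℚₚ.+-inverseˡ (seq x i))
                    , (λ x → ≗⇒≈ λ i → ℚₚ.+-inverseʳ (seq x i))
          ; ⁻¹-cong = -ℝ-cong
          }
        ; comm = λ x y → ≗⇒≈ λ i → ℚₚ.+-comm (seq x i) (seq y i)
        }
      ; *-cong = *ℝ-cong
      ; *-assoc = λ x y z → ≗⇒≈ λ i → ℚₚ.*-assoc (seq x i) (seq y i) (seq z i)
      ; *-identity = (λ x → ≗⇒≈ λ i → ℚₚ.*-identityˡ (seq x i))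
                   , (λ x → ≗⇒≈ λ i → ℚₚ.*-identityʳ (seq x i))
      ; distrib = (λ x y z → ≗⇒≈ λ i → ℚₚ.*-distribˡ-+ (seq x i) (seq y i) (seq z i))
                , (λ x y z → ≗⇒≈ λ i → ℚₚ.*-distribʳ-+ (seq x i) (seq y i) (seq z i))
      }
    ; *-comm = λ x y → ≗⇒≈ λ i → ℚₚ.*-comm (seq x i) (seq y i)
    }
  }

fromℚ-injective : ∀ {p} → fromℚ p ≈ℝ fromℚ 0ℚ → p ≡ 0ℚ
fromℚ-injective {p} eq with p ℚₚ.≟ 0ℚ
... | yes p≡0 = p≡0
... | no  p≢0 with close eq ℚ.∣ p ∣ (ℚₚ.≰⇒> λ ∣p∣≤0 → p≢0 (ℚₚ.∣p∣≡0⇒p≡0 p (ℚₚ.≤-antisym ∣p∣≤0 (ℚₚ.0≤∣p∣ p))))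
...   | N , h = contradiction (subst≡ (λ t → ℚ.∣ t ∣ ℚ.< ℚ.∣ p ∣) (ℚₚ.+-identityʳ p) (h N ℕₚ.≤-refl)) (ℚₚ.<-irrefl refl≡)

Matrix : ℕ → ℕ → Set
Matrix m n = Vector (Vector ℤ n) m

-- The m × n matrix with diagonal entries d 0 , d 1 , … (as many as fit).
diagonal : ∀ {m n} → (ℕ → ℕ) → Matrix m n
diagonal d i j = if toℕ i ℕ.≡ᵇ toℕ j then + d (toℕ i) else 0ℤ

identity : ∀ {n} → Matrix n n
identity = diagonal (λ _ → 1)

-- Vectors over a ring R, acted on by integer matrices through the canonical
-- map ι : ℤ → R.
module LinearAlgebra (R : CommutativeRing 0ℓ 0ℓ) (ι : ℤ → CommutativeRing.Carrier R) where

  open CommutativeRing R using (Carrier; _≈_; _+_; _*_; 0#)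
  open SemiringSum (CommutativeRing.semiring R) using (sum)

  infixr 7 _·_

  _·_ : ∀ {m n} → Matrix m n → Vector Carrier n → Vector Carrier m
  (M · x) i = sum λ j → ι (M i j) * x j

  combination : ∀ {k n} → Vector Carrier k → Vector (Vector Carrier n) k → Vector Carrier n
  combination c v i = sum λ k → c k * v k i

  LinearlyIndependent : ∀ {k n} → Vector (Vector Carrier n) k → Set
  LinearlyIndependent v = ∀ c → (∀ i → combination c v i ≈ 0#) → ∀ k → c k ≈ 0#

  IsBasis : ∀ {k n} → (Vector Carrier n → Set) → Vector (Vector Carrier n) k → Set
  IsBasis W v = LinearlyIndependent v ×
    (∀ x → W x ⇔ ∃ λ c → ∀ i → x i ≈ combination c v i)

  -- S is a nonempty affine subspace of dimension d: it contains a point p, and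
  -- its translate by - p is a linear subspace with a basis of d vectors.
  HasDimension : ∀ {n} → (Vector Carrier n → Set) → ℕ → Set
  HasDimension S d = ∃ λ p → S p ×
    (∃ λ (v : Vector _ d) → IsBasis (λ x → S (λ i → p i + x i)) v)

  ColumnSpace : ∀ {m n} → Matrix m n → Vector Carrier m → Set
  ColumnSpace M y = ∃ λ x → ∀ i → y i ≈ (M · x) i

  Solution : ∀ {m n} → Matrix m n → Vector ℤ m → Vector Carrier n → Set
  Solution M c x = ∀ i → (M · x) i ≈ ι (c i)

open LinearAlgebra ℤₚ.+-*-commutativeRing id public using () renaming (_·_ to _·ℤ_)
open SemiringSum (CommutativeRing.semiring ℤₚ.+-*-commutativeRing) public using () renaming (sum to ℤΣ)

infixl 7 _⊗_

_⊗_ : ∀ {l m n} → Matrix l m → Matrix m n → Matrix l n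
(M ⊗ N) i j = (M ·ℤ λ k → N k j) i

record Invertible {n} (P : Matrix n n) : Set where
  field
    inverse  : Matrix n n
    inverseˡ : ∀ i j → (inverse ⊗ P) i j ≡ identity i j
    inverseʳ : ∀ i j → (P ⊗ inverse) i j ≡ identity i j

-- A Smith normal form U M V = diagonal d.  The nonzero diagonal entries are
-- d 0 ∣ d 1 ∣ … ∣ d (rk - 1), indexed from 0 and extended by zero.
record SmithForm {m n} (M : Matrix m n) : Set where
  field
    U     : Matrix m m
    V     : Matrix n n
    U-inv : Invertible U
    V-inv : Invertible V
    d     : ℕ → ℕ
    d-∣   : ∀ k → d k ∣ℕ d (suc k)
    rk    : ℕ
    rk≤m  : rk ℕ.≤ m
    rk≤n  : rk ℕ.≤ n
    d≢0   : ∀ k → k ℕ.< rk → d k ≢ 0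
    d≡0   : ∀ k → rk ℕ.≤ k → d k ≡ 0
    UMV   : ∀ i j → (U ⊗ M ⊗ V) i j ≡ diagonal d i j

record Embedding (R : CommutativeRing 0ℓ 0ℓ) (ι : ℤ → CommutativeRing.Carrier R) : Set where
 open CommutativeRing R
 field
   ι-+ : ∀ a b → ι (a ℤ.+ b) ≈ ι a + ι b
   ι-* : ∀ a b → ι (a ℤ.* b) ≈ ι a * ι b
   ι-0 : ι 0ℤ ≈ 0#
   ι-1 : ι 1ℤ ≈ 1#

record FieldEmbedding (R : CommutativeRing 0ℓ 0ℓ) (ι : ℤ → CommutativeRing.Carrier R) : Set where
 open CommutativeRing R
 field
   embedding   : Embedding R ι
   ι-injective : ∀ a → ι a ≈ 0# → a ≡ 0ℤ
   ι-inverse   : ∀ k → k ≢ 0 → ∃ λ y → ι (+ k) * y ≈ 1#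
 open Embedding embedding public

module MatrixProperties (R : CommutativeRing 0ℓ 0ℓ) (ι : ℤ → CommutativeRing.Carrier R) (E : Embedding R ι) where
 open CommutativeRing R
 open SemiringSum semiring
 open LinearAlgebra R ι
 open Embedding E
 open SetoidReasoning setoid

 infix 4 _≋_
 _≋_ : ∀ {n} → Vector Carrier n → Vector Carrier n → Set
 x ≋ y = ∀ i → x i ≈ y i

 ·-cong : ∀ {m n} (M : Matrix m n) {x y} → x ≋ y → M · x ≋ M · y
 ·-cong M p i = sum-cong-≋ λ j → *-congˡ (p j)

 ·-congˡ : ∀ {m n} {M N : Matrix m n} x → (∀ i j → M i j ≡ N i j) → M · x ≋ N · x
 ·-congˡ x p i = sum-cong-≋ λ j → *-congʳ (reflexive (cong ι (p i j)))

 sum-cong : ∀ {n} (f g : Vector Carrier n) → f ≋ g → sum f ≈ sum g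
 sum-cong f g p = sum-cong-≋ p

 sum-+ : ∀ {n} (f g : Vector Carrier n) → sum (λ i → f i + g i) ≈ sum f + sum g
 sum-+ = ∑-distrib-+

 sum-*ˡ : ∀ {n} x (f : Vector Carrier n) → x * sum f ≈ sum (λ i → x * f i)
 sum-*ˡ = *-distribˡ-sum

 sum-0 : ∀ {n} (f : Vector Carrier n) → (∀ i → f i ≈ 0#) → sum f ≈ 0#
 sum-0 {n} f p = trans (sum-cong-≋ p) (sum-replicate-zero n)

 sum-++ : ∀ a {b} (f : Vector Carrier (a ℕ.+ b)) → sum f ≈ sum (λ k → f (k ↑ˡ b)) + sum (λ k → f (a ↑ʳ k))
 sum-++ zero    f = sym (+-identityˡ _)
 sum-++ (suc a) f = trans (+-congˡ (sum-++ a (f ∘ suc))) (sym (+-assoc _ _ _))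

 ι-sum : ∀ {n} (f : Vector ℤ n) → ι (ℤΣ f) ≈ sum (ι ∘ f)
 ι-sum {zero}  f = ι-0
 ι-sum {suc n} f = trans (ι-+ _ _) (+-congˡ (ι-sum (f ∘ suc)))

 ι-· : ∀ {m n} (M : Matrix m n) x → ι ∘ (M ·ℤ x) ≋ M · (ι ∘ x)
 ι-· {n = n} M x i = trans (ι-sum (λ j → M i j ℤ.* x j)) (sum-cong-≋ {n} λ j → ι-* _ _)

 ·-+ : ∀ {m n} (M : Matrix m n) x y → M · (λ j → x j + y j) ≋ λ i → (M · x) i + (M · y) i
 ·-+ {n = n} M x y i = trans (sum-cong-≋ {n} λ j → distribˡ _ _ _) (∑-distrib-+ {n} _ _)

 ·-0 : ∀ {m n} (M : Matrix m n) → M · (λ _ → 0#) ≋ λ _ → 0#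
 ·-0 {n = n} M i = sum-0 {n} _ λ j → zeroʳ _

 ·-assoc : ∀ {l m n} (M : Matrix l m) (N : Matrix m n) x → M · N · x ≋ (M ⊗ N) · x
 ·-assoc M N x i = begin
   sum (λ k → ι (M i k) * sum (λ j → ι (N k j) * x j))
     ≈⟨ sum-cong-≋ (λ k → *-distribˡ-sum (ι (M i k)) (λ j → ι (N k j) * x j)) ⟩
   sum (λ k → sum (λ j → ι (M i k) * (ι (N k j) * x j)))
     ≈⟨ ∑-comm (λ k j → ι (M i k) * (ι (N k j) * x j)) ⟩
   sum (λ j → sum (λ k → ι (M i k) * (ι (N k j) * x j)))
     ≈⟨ sum-cong-≋ (λ j → sum-cong-≋ λ k →
          trans (sym (*-assoc _ _ _)) (*-congʳ (sym (ι-* (M i k) (N k j))))) ⟩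
   sum (λ j → sum (λ k → ι (M i k ℤ.* N k j) * x j))
     ≈⟨ sum-cong-≋ (λ j → sym (*-distribʳ-sum (x j) (λ k → ι (M i k ℤ.* N k j)))) ⟩
   sum (λ j → sum (λ k → ι (M i k ℤ.* N k j)) * x j)
     ≈⟨ sum-cong-≋ (λ j → *-congʳ (sym (ι-sum (λ k → M i k ℤ.* N k j)))) ⟩
   sum (λ j → ι ((M ⊗ N) i j) * x j) ∎

 ι0*≈0 : ∀ x → ι 0ℤ * x ≈ 0#
 ι0*≈0 x = trans (*-congʳ ι-0) (zeroˡ x)

 diagonal-head : ∀ r {a b} (d : ℕ → ℕ) (y : Vector Carrier (r ℕ.+ b)) (k : Fin r) → (∀ k → r ℕ.≤ k → d k ≡ 0) →
   (diagonal {r ℕ.+ a} d · y) (k ↑ˡ a) ≈ ι (+ d (toℕ k)) * y (k ↑ˡ b)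
 diagonal-head (suc r) {b = b} d y zero    z = trans (+-congˡ (sum-0 {r ℕ.+ b} _ λ j → ι0*≈0 _)) (+-identityʳ _)
 diagonal-head (suc r) d y (suc k) z = trans (+-cong (ι0*≈0 _)
   (diagonal-head r (d ∘ suc) (y ∘ suc) k λ k p → z (suc k) (ℕ.s≤s p))) (+-identityˡ _)

 diagonal-tail : ∀ r {a b} (d : ℕ → ℕ) (y : Vector Carrier (r ℕ.+ b)) (k : Fin a) → (∀ k → r ℕ.≤ k → d k ≡ 0) →
   (diagonal {r ℕ.+ a} d · y) (r ↑ʳ k) ≈ 0#
 diagonal-tail zero {b = b} d y k z = sum-0 _ λ j → trans (*-congʳ (reflexive (cong ι (entry j)))) (ι0*≈0 _)
   where
   entry : ∀ (j : Fin b) → diagonal d k j ≡ 0ℤ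
   entry j with toℕ k ℕ.≡ᵇ toℕ j
   ... | true  = cong +_ (z (toℕ k) ℕ.z≤n)
   ... | false = refl≡
 diagonal-tail (suc r) d y k z = trans (+-cong (ι0*≈0 _)
   (diagonal-tail r (d ∘ suc) (y ∘ suc) k λ k p → z (suc k) (ℕ.s≤s p))) (+-identityˡ _)

 identity-· : ∀ {n} (x : Vector Carrier n) → identity · x ≋ x
 identity-· {suc n} x zero    = trans (+-cong (trans (*-congʳ ι-1) (*-identityˡ _)) (sum-0 {n} _ λ j → ι0*≈0 _)) (+-identityʳ _)
 identity-· x (suc i) = trans (+-cong (ι0*≈0 _) (identity-· (x ∘ suc) i)) (+-identityˡ _)

 module _ {n} {P : Matrix n n} (P-inv : Invertible P) where
   open Invertible P-inv

   cancelˡ : ∀ x → inverse · P · x ≋ x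
   cancelˡ x i = trans (·-assoc inverse P x i) (trans (·-congˡ x inverseˡ i) (identity-· x i))

   cancelʳ : ∀ x → P · inverse · x ≋ x
   cancelʳ x i = trans (·-assoc P inverse x i) (trans (·-congˡ x inverseʳ i) (identity-· x i))

   ·-injective : ∀ {x y} → P · x ≋ P · y → x ≋ y
   ·-injective {x} {y} p i = trans (sym (cancelˡ x i)) (trans (·-cong inverse p i) (cancelˡ y i))

 -- W is the image under an invertible P of a coordinate subspace.
 module CoordinateSubspace {N k : ℕ} (place : Fin k → Fin N)
   (extend : Vector Carrier k → Vector Carrier N)
   (extend-place : ∀ c i → extend c (place i) ≈ c i)
   (extend-sum : ∀ c (f : Vector Carrier N) → sum (λ t → f t * extend c t) ≈ sum (λ i → f (place i) * c i))
   (Z : Vector Carrier N → Set)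
   (Z-extend : ∀ c → Z (extend c))
   (Z-cong : ∀ {x y} → x ≋ y → Z x → Z y)
   (extend-Z : ∀ y → Z y → extend (y ∘ place) ≋ y)
   {P : Matrix N N} (P-inv : Invertible P)
   (W : Vector Carrier N → Set)
   (W⇒Z : ∀ x → W x → Z (Invertible.inverse P-inv · x))
   (Z⇒W : ∀ x → Z (Invertible.inverse P-inv · x) → W x)
   where
   open Invertible P-inv

   basis : Vector (Vector Carrier N) k
   basis i t = ι (P t (place i))

   combination-basis : ∀ c → combination c basis ≋ P · extend c
   combination-basis c t = trans (sum-cong-≋ {k} λ i → *-comm _ _) (sym (extend-sum c (ι ∘ P t)))

   isBasis : IsBasis W basis
   isBasis = independent , λ x → mk⇔ (to x) (from x)
     where
     independent : LinearlyIndependent basis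
     independent c p i = trans (sym (extend-place c i))
       (trans (sym (cancelˡ P-inv (extend c) (place i)))
         (trans (·-cong inverse (λ t → trans (sym (combination-basis c t)) (p t)) (place i))
           (·-0 inverse (place i))))
     to : ∀ x → W x → ∃ λ c → ∀ i → x i ≈ combination c basis i
     to x w = (inverse · x) ∘ place , λ t → sym (trans (combination-basis _ t)
       (trans (·-cong P (extend-Z (inverse · x) (W⇒Z x w)) t) (cancelʳ P-inv x t)))
     from : ∀ x → (∃ λ c → ∀ i → x i ≈ combination c basis i) → W x
     from x (c , p) = Z⇒W x (Z-cong (λ t → sym (trans (·-cong inverse (λ u → trans (p u) (combination-basis c u)) t)
       (cancelˡ P-inv (extend c) t))) (Z-extend c))

 module FirstCoordinates (a b : ℕ) where
   place : Fin a → Fin (a ℕ.+ b)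
   place k = k ↑ˡ b
   extend : Vector Carrier a → Vector Carrier (a ℕ.+ b)
   extend c = c ++ λ _ → 0#
   Z : Vector Carrier (a ℕ.+ b) → Set
   Z y = ∀ k → y (a ↑ʳ k) ≈ 0#
   extend-place : ∀ c i → extend c (place i) ≈ c i
   extend-place c i = reflexive (lookup-++ˡ c _ i)
   Z-extend : ∀ c → Z (extend c)
   Z-extend c k = reflexive (lookup-++ʳ c _ k)
   Z-cong : ∀ {x y} → x ≋ y → Z x → Z y
   Z-cong p z k = trans (sym (p _)) (z k)
   extend-sum : ∀ c (f : Vector Carrier (a ℕ.+ b)) → sum (λ t → f t * extend c t) ≈ sum (λ i → f (place i) * c i)
   extend-sum c f = trans (sum-++ a _) (trans (+-cong
     (sum-cong-≋ λ k → *-congˡ (extend-place c k))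
     (sum-0 _ λ k → trans (*-congˡ (Z-extend c k)) (zeroʳ _))) (+-identityʳ _))
   extend-Z : ∀ y → Z y → extend (y ∘ place) ≋ y
   extend-Z y z t with splitAt a t in eq
   ... | inj₁ k = reflexive (cong y (Finₚ.splitAt⁻¹-↑ˡ eq))
   ... | inj₂ k = trans (sym (z k)) (reflexive (cong y (Finₚ.splitAt⁻¹-↑ʳ eq)))

 module LastCoordinates (a b : ℕ) where
   place : Fin b → Fin (a ℕ.+ b)
   place k = a ↑ʳ k
   extend : Vector Carrier b → Vector Carrier (a ℕ.+ b)
   extend c = (λ (_ : Fin a) → 0#) ++ c
   Z : Vector Carrier (a ℕ.+ b) → Set
   Z y = ∀ k → y (k ↑ˡ b) ≈ 0#
   extend-place : ∀ c i → extend c (place i) ≈ c i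
   extend-place c i = reflexive (lookup-++ʳ {m = a} _ c i)
   Z-extend : ∀ c → Z (extend c)
   Z-extend c k = reflexive (lookup-++ˡ _ c k)
   Z-cong : ∀ {x y} → x ≋ y → Z x → Z y
   Z-cong p z k = trans (sym (p _)) (z k)
   extend-sum : ∀ c (f : Vector Carrier (a ℕ.+ b)) → sum (λ t → f t * extend c t) ≈ sum (λ i → f (place i) * c i)
   extend-sum c f = trans (sum-++ a _) (trans (+-cong
     (sum-0 _ λ k → trans (*-congˡ (Z-extend c k)) (zeroʳ _))
     (sum-cong-≋ λ k → *-congˡ (extend-place c k))) (+-identityˡ _))
   extend-Z : ∀ y → Z y → extend (y ∘ place) ≋ y
   extend-Z y z t with splitAt a t in eq
   ... | inj₁ k = trans (sym (z k)) (reflexive (cong y (Finₚ.splitAt⁻¹-↑ˡ eq)))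
   ... | inj₂ k = reflexive (cong y (Finₚ.splitAt⁻¹-↑ʳ eq))

 module Normalised {m n} {M : Matrix m n} (F : SmithForm M) where
   open SmithForm F
   open Invertible U-inv renaming (inverse to U⁻¹)
   open Invertible V-inv renaming (inverse to V⁻¹)

   UM : ∀ x → U · M · x ≋ diagonal d · V⁻¹ · x
   UM x i = begin
     (U · M · x) i                    ≈⟨ ·-cong U (·-cong M (λ j → sym (cancelʳ V-inv x j))) i ⟩
     (U · M · V · V⁻¹ · x) i          ≈⟨ ·-assoc U M (V · V⁻¹ · x) i ⟩
     ((U ⊗ M) · V · V⁻¹ · x) i        ≈⟨ ·-assoc (U ⊗ M) V (V⁻¹ · x) i ⟩
     ((U ⊗ M ⊗ V) · V⁻¹ · x) i        ≈⟨ ·-congˡ (V⁻¹ · x) UMV i ⟩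
     (diagonal d · V⁻¹ · x) i         ∎

   MV : ∀ y → U · M · V · y ≋ diagonal d · y
   MV y i = trans (UM (V · y) i) (·-cong (diagonal d) (cancelˡ V-inv y) i)

symInvertible : ∀ {n} {P : Matrix n n} (I : Invertible P) → Invertible (Invertible.inverse I)
symInvertible {P = P} I = record { inverse = P ; inverseˡ = Invertible.inverseʳ I ; inverseʳ = Invertible.inverseˡ I }

module SolutionSpaces (R : CommutativeRing 0ℓ 0ℓ) (ι : ℤ → CommutativeRing.Carrier R) (E : FieldEmbedding R ι) where
 open CommutativeRing R
 open FieldEmbedding E
 open LinearAlgebra R ι
 open MatrixProperties R ι embedding

 module _ (r a b : ℕ) {M : Matrix (r ℕ.+ a) (r ℕ.+ b)} (F : SmithForm M) (rk≡r : SmithForm.rk F ≡ r) where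
   open SmithForm F
   open Normalised F
   open Invertible U-inv using () renaming (inverse to U⁻¹)
   open Invertible V-inv using () renaming (inverse to V⁻¹)

   D : Matrix (r ℕ.+ a) (r ℕ.+ b)
   D = diagonal d

   vanish : ∀ k → r ℕ.≤ k → d k ≡ 0
   vanish k p = d≡0 k (subst≡ (ℕ._≤ k) (sym≡ rk≡r) p)

   nonzero : ∀ (k : Fin r) → d (toℕ k) ≢ 0
   nonzero k = d≢0 _ (subst≡ (toℕ k ℕ.<_) (sym≡ rk≡r) (Finₚ.toℕ<n k))

   d⁻¹ : Fin r → Carrier
   d⁻¹ k = proj₁ (ι-inverse _ (nonzero k))

   cancel-d : ∀ k x → ι (+ d (toℕ k)) * (d⁻¹ k * x) ≈ x
   cancel-d k x = trans (sym (*-assoc _ _ _)) (trans (*-congʳ (proj₂ (ι-inverse _ (nonzero k)))) (*-identityˡ x))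

   D-kernel : ∀ y → D · y ≋ (λ _ → 0#) → ∀ k → y (k ↑ˡ b) ≈ 0#
   D-kernel y p k = trans (sym (cancel-d k _)) (trans (x∙yz≈y∙xz _ _ _)
     (trans (*-congˡ (trans (sym (diagonal-head r d y k vanish)) (p (k ↑ˡ a)))) (zeroʳ _)))
     where open CommutativeSemigroupProperties *-commutativeSemigroup using (x∙yz≈y∙xz)

   headTail : ∀ (x y : Vector Carrier (r ℕ.+ a)) → (∀ k → x (k ↑ˡ a) ≈ y (k ↑ˡ a)) → (∀ k → x (r ↑ʳ k) ≈ y (r ↑ʳ k)) → x ≋ y
   headTail x y p q t with splitAt r t in eq
   ... | inj₁ k = subst≡ (λ t → x t ≈ y t) (Finₚ.splitAt⁻¹-↑ˡ eq) (p k)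
   ... | inj₂ k = subst≡ (λ t → x t ≈ y t) (Finₚ.splitAt⁻¹-↑ʳ eq) (q k)

   D-kernel⁻¹ : ∀ y → (∀ k → y (k ↑ˡ b) ≈ 0#) → D · y ≋ (λ _ → 0#)
   D-kernel⁻¹ y p = headTail _ _
     (λ k → trans (diagonal-head r d y k vanish) (trans (*-congˡ (p k)) (zeroʳ _)))
     (λ k → diagonal-tail r d y k vanish)

   D-solve : ∀ (e : Vector Carrier (r ℕ.+ a)) → (∀ k → e (r ↑ʳ k) ≈ 0#) → ∃ λ z → D · z ≋ e
   D-solve e p = z , headTail _ _
     (λ k → trans (diagonal-head r d z k vanish)
       (trans (*-congˡ (reflexive (lookup-++ˡ z₁ (λ _ → 0#) k))) (cancel-d k _)))
     (λ k → trans (diagonal-tail r d z k vanish) (sym (p k)))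
     where
     z₁ : Vector Carrier r
     z₁ k = d⁻¹ k * e (k ↑ˡ a)
     z : Vector Carrier (r ℕ.+ b)
     z = z₁ ++ λ _ → 0#

   columnBasis : ∃ λ (v : Vector (Vector Carrier (r ℕ.+ a)) r) → IsBasis (ColumnSpace M) v
   columnBasis = C.basis , C.isBasis
     where
     open FirstCoordinates r a
     to : ∀ y → ColumnSpace M y → Z (U · y)
     to y (x , p) k = trans (·-cong U p (r ↑ʳ k)) (trans (UM x (r ↑ʳ k)) (diagonal-tail r d _ k vanish))
     from : ∀ y → Z (U · y) → ColumnSpace M y
     from y p = let z , q = D-solve (U · y) p in
       V · z , ·-injective U-inv (λ i → sym (trans (MV z i) (q i)))
     module C = CoordinateSubspace place extend extend-place extend-sum Z Z-extend Z-cong extend-Z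
       (symInvertible U-inv) (ColumnSpace M) to from

   solutionDimension : ∀ c → ∃ (HasDimension (Solution M c)) ⊎ (∀ x → ¬ Solution M c x)
   solutionDimension c with Finₚ.all? (λ (k : Fin a) → (U ·ℤ c) (r ↑ʳ k) ℤₚ.≟ 0ℤ)
   ... | no ¬p = inj₂ λ x s → ¬p λ k → ι-injective _
     (trans (ι-· U c (r ↑ʳ k)) (trans (sym (·-cong U s (r ↑ʳ k)))
       (trans (UM x (r ↑ʳ k)) (diagonal-tail r d _ k vanish))))
   ... | yes p = inj₁ (b , point , point-solves , C.basis , C.isBasis)
     where
     open LastCoordinates r b
     solved : ∃ λ z → D · z ≋ ι ∘ (U ·ℤ c)
     solved = D-solve _ λ k → trans (reflexive (cong ι (p k))) ι-0
     point : Vector Carrier (r ℕ.+ b)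
     point = V · proj₁ solved
     point-solves : Solution M c point
     point-solves = ·-injective U-inv λ i →
       trans (MV _ i) (trans (proj₂ solved i) (ι-· U c i))
     W : Vector Carrier (r ℕ.+ b) → Set
     W x = Solution M c (λ i → point i + x i)
     to : ∀ x → W x → Z (V⁻¹ · x)
     to x w = D-kernel _ λ i → trans (sym (UM x i)) (trans (·-cong U zero-part i) (·-0 U i))
       where
       zero-part : ∀ j → (M · x) j ≈ 0#
       zero-part j = ∙-cancelˡ (ι (c j)) _ _ (trans (+-congʳ (sym (point-solves j)))
         (trans (sym (·-+ M point x j)) (trans (w j) (sym (+-identityʳ _)))))
         where open GroupProperties +-group using (∙-cancelˡ)
     from : ∀ x → Z (V⁻¹ · x) → W x
     from x z j = trans (·-+ M point x j) (trans (+-cong (point-solves j) (zero-part j)) (+-identityʳ _))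
       where
       zero-part : ∀ j → (M · x) j ≈ 0#
       zero-part = ·-injective U-inv λ i → trans (UM x i) (trans (D-kernel⁻¹ _ z i) (sym (·-0 U i)))
     module C = CoordinateSubspace place extend extend-place extend-sum Z Z-extend Z-cong extend-Z
       V-inv W to from

 columnSpaceBasis : ∀ {m n} {M : Matrix m n} → SmithForm M →
   ∃ λ k → ∃ λ (v : Vector (Vector Carrier m) k) → IsBasis (ColumnSpace M) v
 columnSpaceBasis F = rk , go F refl≡ _ _ (proj₂ (ℕₚ.m≤n⇒∃[o]m+o≡n rk≤m)) (proj₂ (ℕₚ.m≤n⇒∃[o]m+o≡n rk≤n))
   where
   open SmithForm F using (rk; rk≤m; rk≤n)
   go : ∀ {m n} {M : Matrix m n} (F : SmithForm M) {r} → SmithForm.rk F ≡ r → ∀ a b → r ℕ.+ a ≡ m → r ℕ.+ b ≡ n →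
     ∃ λ (v : Vector (Vector Carrier m) r) → IsBasis (ColumnSpace M) v
   go F eq a b refl≡ refl≡ = columnBasis _ a b F eq

 dimension? : ∀ {m n} {M : Matrix m n} → SmithForm M → ∀ c →
   ∃ (HasDimension (Solution M c)) ⊎ (∀ x → ¬ Solution M c x)
 dimension? F = go F refl≡ _ _ (proj₂ (ℕₚ.m≤n⇒∃[o]m+o≡n rk≤m)) (proj₂ (ℕₚ.m≤n⇒∃[o]m+o≡n rk≤n))
   where
   open SmithForm F using (rk; rk≤m; rk≤n)
   go : ∀ {m n} {M : Matrix m n} (F : SmithForm M) {r} → SmithForm.rk F ≡ r → ∀ a b → r ℕ.+ a ≡ m → r ℕ.+ b ≡ n →
     ∀ c → ∃ (HasDimension (Solution M c)) ⊎ (∀ x → ¬ Solution M c x)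
   go F eq a b refl≡ refl≡ = solutionDimension _ a b F eq

ℤ-embedding : Embedding ℤₚ.+-*-commutativeRing id
ℤ-embedding = record { ι-+ = λ _ _ → refl≡ ; ι-* = λ _ _ → refl≡ ; ι-0 = refl≡ ; ι-1 = refl≡ }

module ℤM = MatrixProperties ℤₚ.+-*-commutativeRing id ℤ-embedding

module SmithAlgorithm where
 open ≡-Reasoning

 infix 4 _≗_
 _≗_ : ∀ {m n} → Matrix m n → Matrix m n → Set
 M ≗ N = ∀ i j → M i j ≡ N i j

 _ᵀ : ∀ {m n} → Matrix m n → Matrix n m
 (M ᵀ) i j = M j i

 ⊗-assoc : ∀ {k l m n} (A : Matrix k l) (B : Matrix l m) (C : Matrix m n) → A ⊗ B ⊗ C ≗ A ⊗ (B ⊗ C)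
 ⊗-assoc A B C i j = sym≡ (ℤM.·-assoc A B (λ k → C k j) i)

 ⊗-cong : ∀ {l m n} {A A′ : Matrix l m} {B B′ : Matrix m n} → A ≗ A′ → B ≗ B′ → A ⊗ B ≗ A′ ⊗ B′
 ⊗-cong {A′ = A′} {B = B} p q i j = trans≡ (ℤM.·-congˡ (λ k → B k j) p i) (ℤM.·-cong A′ (λ k → q k j) i)

 ⊗-ᵀ : ∀ {l m n} (A : Matrix l m) (B : Matrix m n) → (A ⊗ B) ᵀ ≗ (B ᵀ) ⊗ (A ᵀ)
 ⊗-ᵀ {m = m} A B i j = ℤM.sum-cong {m} _ _ λ k → ℤₚ.*-comm (A j k) (B k i)

 identity-ᵀ : ∀ {n} → identity {n} ᵀ ≗ identity
 identity-ᵀ zero    zero    = refl≡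
 identity-ᵀ zero    (suc j) = refl≡
 identity-ᵀ (suc i) zero    = refl≡
 identity-ᵀ (suc i) (suc j) = identity-ᵀ i j

 ⊗-identityˡ : ∀ {m n} (M : Matrix m n) → identity ⊗ M ≗ M
 ⊗-identityˡ M i j = ℤM.identity-· (λ k → M k j) i

 ⊗-identityʳ : ∀ {m n} (M : Matrix m n) → M ⊗ identity ≗ M
 ⊗-identityʳ M i j = trans≡ (⊗-ᵀ M identity j i)
   (trans≡ (⊗-cong {B = M ᵀ} identity-ᵀ (λ _ _ → refl≡) j i) (⊗-identityˡ (M ᵀ) j i))

 cancel-middle : ∀ {l m n} (A : Matrix l m) {B : Matrix m m} {B′ : Matrix m m} (C : Matrix m n) →
   B ⊗ B′ ≗ identity → (A ⊗ B) ⊗ (B′ ⊗ C) ≗ A ⊗ C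
 cancel-middle A {B} {B′} C p i j = begin
   ((A ⊗ B) ⊗ (B′ ⊗ C)) i j  ≡⟨ ⊗-assoc A B (B′ ⊗ C) i j ⟩
   (A ⊗ (B ⊗ (B′ ⊗ C))) i j  ≡⟨ ⊗-cong {A = A} (λ _ _ → refl≡) (λ i j → sym≡ (⊗-assoc B B′ C i j)) i j ⟩
   (A ⊗ ((B ⊗ B′) ⊗ C)) i j  ≡⟨ ⊗-cong {A = A} (λ _ _ → refl≡) (⊗-cong {B = C} p (λ _ _ → refl≡)) i j ⟩
   (A ⊗ (identity ⊗ C)) i j  ≡⟨ ⊗-cong {A = A} (λ _ _ → refl≡) (⊗-identityˡ C) i j ⟩
   (A ⊗ C) i j               ∎

 identity-Invertible : ∀ {n} → Invertible (identity {n})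
 identity-Invertible = record { inverse = identity ; inverseˡ = ⊗-identityˡ identity ; inverseʳ = ⊗-identityˡ identity }

 ⊗-Invertible : ∀ {n} {P Q : Matrix n n} → Invertible P → Invertible Q → Invertible (P ⊗ Q)
 ⊗-Invertible {P = P} {Q} I J = record
   { inverse  = J.inverse ⊗ I.inverse
   ; inverseˡ = λ i j → trans≡ (cancel-middle J.inverse Q I.inverseˡ i j) (J.inverseˡ i j)
   ; inverseʳ = λ i j → trans≡ (cancel-middle P I.inverse J.inverseʳ i j) (I.inverseʳ i j)
   }
   where
   module I = Invertible I
   module J = Invertible J

 ᵀ-Invertible : ∀ {n} {P : Matrix n n} → Invertible P → Invertible (P ᵀ)
 ᵀ-Invertible {P = P} I = record
   { inverse  = inverse ᵀ
   ; inverseˡ = λ i j → trans≡ (sym≡ (⊗-ᵀ P inverse i j)) (trans≡ (inverseʳ j i) (identity-ᵀ i j))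
   ; inverseʳ = λ i j → trans≡ (sym≡ (⊗-ᵀ inverse P i j)) (trans≡ (inverseˡ j i) (identity-ᵀ i j))
   }
   where open Invertible I

 infix 4 _∼_
 record _∼_ {m n} (M N : Matrix m n) : Set where
   field
     P     : Matrix m m
     Q     : Matrix n n
     P-inv : Invertible P
     Q-inv : Invertible Q
     PMQ   : P ⊗ M ⊗ Q ≗ N

 shuffle : ∀ {m n} (A B : Matrix m m) (M : Matrix m n) (C D : Matrix n n) → (A ⊗ B) ⊗ M ⊗ (C ⊗ D) ≗ A ⊗ (B ⊗ M ⊗ C) ⊗ D
 shuffle A B M C D i j = begin
   ((A ⊗ B) ⊗ M ⊗ (C ⊗ D)) i j  ≡⟨ sym≡ (⊗-assoc ((A ⊗ B) ⊗ M) C D i j) ⟩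
   ((A ⊗ B) ⊗ M ⊗ C ⊗ D) i j    ≡⟨ ⊗-cong {B = D} (⊗-assoc (A ⊗ B) M C) (λ _ _ → refl≡) i j ⟩
   ((A ⊗ B) ⊗ (M ⊗ C) ⊗ D) i j  ≡⟨ ⊗-cong {B = D} (⊗-assoc A B (M ⊗ C)) (λ _ _ → refl≡) i j ⟩
   (A ⊗ (B ⊗ (M ⊗ C)) ⊗ D) i j  ≡⟨ ⊗-cong {B = D} (⊗-cong {A = A} (λ _ _ → refl≡) (λ i j → sym≡ (⊗-assoc B M C i j))) (λ _ _ → refl≡) i j ⟩
   (A ⊗ (B ⊗ M ⊗ C) ⊗ D) i j    ∎

 ∼-trans : ∀ {m n} {L M N : Matrix m n} → L ∼ M → M ∼ N → L ∼ N
 ∼-trans {L = L} f g = record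
   { P = G.P ⊗ F.P ; Q = F.Q ⊗ G.Q
   ; P-inv = ⊗-Invertible G.P-inv F.P-inv ; Q-inv = ⊗-Invertible F.Q-inv G.Q-inv
   ; PMQ = λ i j → trans≡ (shuffle G.P F.P L F.Q G.Q i j)
       (trans≡ (⊗-cong {B = G.Q} (⊗-cong {A = G.P} (λ _ _ → refl≡) F.PMQ) (λ _ _ → refl≡) i j) (G.PMQ i j))
   }
   where
   module F = _∼_ f
   module G = _∼_ g

 ∼-ᵀ : ∀ {m n} {M N : Matrix m n} → M ∼ N → M ᵀ ∼ N ᵀ
 ∼-ᵀ {M = M} f = record
   { P = Q ᵀ ; Q = P ᵀ ; P-inv = ᵀ-Invertible Q-inv ; Q-inv = ᵀ-Invertible P-inv
   ; PMQ = λ i j → trans≡ (⊗-assoc (Q ᵀ) (M ᵀ) (P ᵀ) i j)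
       (trans≡ (⊗-cong {A = Q ᵀ} (λ _ _ → refl≡) (λ i j → sym≡ (⊗-ᵀ P M i j)) i j)
         (trans≡ (sym≡ (⊗-ᵀ (P ⊗ M) Q i j)) (PMQ j i)))
   }
   where open _∼_ f

 -- An elementary operation, given by its action on columns.
 matrix : ∀ {n} → (Vector ℤ n → Vector ℤ n) → Matrix n n
 matrix f i j = f (λ k → identity k j) i

 Linear : ∀ {n} → (Vector ℤ n → Vector ℤ n) → Set
 Linear f = ∀ v i → (matrix f ·ℤ v) i ≡ f v i

 operation-Invertible : ∀ {n} (f g : Vector ℤ n → Vector ℤ n) → Linear f → Linear g →
   (∀ v i → f (g v) i ≡ v i) → (∀ v i → g (f v) i ≡ v i) → Invertible (matrix f)
 operation-Invertible f g f-lin g-lin fg gf = record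
   { inverse  = matrix g
   ; inverseˡ = λ i j → trans≡ (g-lin _ i) (gf _ i)
   ; inverseʳ = λ i j → trans≡ (f-lin _ i) (fg _ i)
   }

 rowOperation : ∀ {m n} (f : Vector ℤ m → Vector ℤ m) → Linear f → Invertible (matrix f) → (M : Matrix m n) →
   M ∼ (λ i j → f (λ k → M k j) i)
 rowOperation f f-lin f-inv M = record
   { P = matrix f ; Q = identity ; P-inv = f-inv ; Q-inv = identity-Invertible
   ; PMQ = λ i j → trans≡ (⊗-identityʳ (matrix f ⊗ M) i j) (f-lin _ i)
   }

 exchange : ∀ {n} → Fin (suc n) → Vector ℤ (suc n) → Vector ℤ (suc n)
 exchange t v i = v (transpose zero t i)

 exchange⁻¹ : ∀ {n} → Fin (suc n) → Vector ℤ (suc n) → Vector ℤ (suc n)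
 exchange⁻¹ t v i = v (transpose t zero i)

 exchange-row : ∀ {m n} t (M : Matrix (suc m) n) → M ∼ (λ i j → exchange t (λ k → M k j) i)
 exchange-row t = rowOperation (exchange t) (λ v i → ℤM.identity-· v _)
   (operation-Invertible (exchange t) (exchange⁻¹ t) (λ v i → ℤM.identity-· v _) (λ v i → ℤM.identity-· v _)
     (λ v i → cong v (transpose-inverse t zero)) (λ v i → cong v (transpose-inverse zero t)))

 -- add c i times row t to row i
 shear : ∀ {n} → Fin n → Vector ℤ n → Vector ℤ n → Vector ℤ n
 shear t c v i = v i ℤ.+ c i ℤ.* v t

 shear-Linear : ∀ {n} t c → Linear {n} (shear t c)
 shear-Linear {n} t c v i = begin
   ℤΣ (λ k → (identity i k ℤ.+ c i ℤ.* identity t k) ℤ.* v k)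
     ≡⟨ ℤM.sum-cong {n} _ _ (λ k → rearrange (identity i k) (c i) (identity t k) (v k)) ⟩
   ℤΣ (λ k → identity i k ℤ.* v k ℤ.+ c i ℤ.* (identity t k ℤ.* v k))
     ≡⟨ ℤM.sum-+ {n} (λ k → identity i k ℤ.* v k) (λ k → c i ℤ.* (identity t k ℤ.* v k)) ⟩
   (identity ·ℤ v) i ℤ.+ ℤΣ (λ k → c i ℤ.* (identity t k ℤ.* v k))
     ≡⟨ cong₂ ℤ._+_ (ℤM.identity-· v i) (trans≡ (sym≡ (ℤM.sum-*ˡ {n} (c i) (λ k → identity t k ℤ.* v k)))
          (cong (c i ℤ.*_) (ℤM.identity-· v t))) ⟩
   v i ℤ.+ c i ℤ.* v t ∎
   where
   rearrange : ∀ a c b v → (a ℤ.+ c ℤ.* b) ℤ.* v ≡ a ℤ.* v ℤ.+ c ℤ.* (b ℤ.* v)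
   rearrange = solve-∀

 shear-inverse : ∀ {n} t (c c′ : Vector ℤ n) → (∀ i → c i ℤ.+ c′ i ≡ 0ℤ) → c t ≡ 0ℤ → ∀ v i → shear t c′ (shear t c v) i ≡ v i
 shear-inverse t c c′ opp c≡0 v i = begin
   (v i ℤ.+ c i ℤ.* v t) ℤ.+ c′ i ℤ.* (v t ℤ.+ c t ℤ.* v t)  ≡⟨ cong (λ z → (v i ℤ.+ c i ℤ.* v t) ℤ.+ c′ i ℤ.* (v t ℤ.+ z ℤ.* v t)) c≡0 ⟩
   (v i ℤ.+ c i ℤ.* v t) ℤ.+ c′ i ℤ.* (v t ℤ.+ 0ℤ ℤ.* v t)   ≡⟨ rearrange (v i) (c i) (c′ i) (v t) ⟩
   v i ℤ.+ (c i ℤ.+ c′ i) ℤ.* v t                            ≡⟨ cong (λ z → v i ℤ.+ z ℤ.* v t) (opp i) ⟩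
   v i ℤ.+ 0ℤ ℤ.* v t                                        ≡⟨ ℤₚ.+-identityʳ (v i) ⟩
   v i                                                       ∎
   where
   rearrange : ∀ a c d b → (a ℤ.+ c ℤ.* b) ℤ.+ d ℤ.* (b ℤ.+ 0ℤ ℤ.* b) ≡ a ℤ.+ (c ℤ.+ d) ℤ.* b
   rearrange = solve-∀

 shear-row : ∀ {m n} t (c : Vector ℤ m) → c t ≡ 0ℤ → (M : Matrix m n) → M ∼ (λ i j → shear t c (λ k → M k j) i)
 shear-row t c c≡0 = rowOperation (shear t c) (shear-Linear t c)
   (operation-Invertible (shear t c) (shear t c′) (shear-Linear t c) (shear-Linear t c′)
     (shear-inverse t c′ c (λ i → ℤₚ.+-inverseˡ (c i)) (cong ℤ.-_ c≡0))
     (shear-inverse t c c′ (λ i → ℤₚ.+-inverseʳ (c i)) c≡0))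
   where
   c′ = λ i → ℤ.- c i

 corner : ∀ {m n} → Matrix (suc m) (suc n) → ℤ
 corner M = M zero zero

 record Smaller {m n} (M : Matrix (suc m) (suc n)) : Set where
   constructor smaller
   field
     {N}     : Matrix (suc m) (suc n)
     M∼N     : M ∼ N
     corner≢0 : corner N ≢ 0ℤ
     corner<  : ℤ.∣ corner N ∣ ℕ.< ℤ.∣ corner M ∣

 Smaller-ᵀ : ∀ {m n} {M : Matrix (suc m) (suc n)} → Smaller (M ᵀ) → Smaller M
 Smaller-ᵀ (smaller p q r) = smaller (∼-ᵀ p) q r

 lowerColumn : ∀ {m n} (M : Matrix (suc m) (suc n)) → corner M ≢ 0ℤ → (∃ λ i → ¬ corner M ∣ M (suc i) zero) → Smaller M
 lowerColumn {m} M p≢0 (i , ¬div) = smaller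
   (∼-trans (shear-row zero c refl≡ M) (exchange-row (suc i) _))
   (λ r≡0 → ¬div (divides (a ℤ./ p) (trans≡ (ℤ/.a≡a%n+[a/n]*n a p) (trans≡ (cong (ℤ._+ (a ℤ./ p) ℤ.* p) (trans≡ (sym≡ entry) r≡0)) (ℤₚ.+-identityˡ ((a ℤ./ p) ℤ.* p))))))
   (subst≡ (λ z → ℤ.∣ z ∣ ℕ.< ℤ.∣ p ∣) (sym≡ entry) (ℤ/.n%d<d a p))
   where
   p a : ℤ
   p = corner M
   a = M (suc i) zero
   instance _ = ℤ.≢-nonZero p≢0
   c : Vector ℤ (suc m)
   c zero    = 0ℤ
   c (suc j) = ℤ.- (M (suc j) zero ℤ./ p)
   entry : a ℤ.+ ℤ.- (a ℤ./ p) ℤ.* p ≡ + (a ℤ.% p)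
   entry = trans≡ (cong (ℤ._+ ℤ.- (a ℤ./ p) ℤ.* p) (ℤ/.a≡a%n+[a/n]*n a p)) (rearrange (+ (a ℤ.% p)) (a ℤ./ p) p)
     where
     rearrange : ∀ r q p → r ℤ.+ q ℤ.* p ℤ.+ ℤ.- q ℤ.* p ≡ r
     rearrange = solve-∀

 lowerRow : ∀ {m n} (M : Matrix (suc m) (suc n)) → corner M ≢ 0ℤ → (∃ λ j → ¬ corner M ∣ M zero (suc j)) → Smaller M
 lowerRow M p≢0 q = Smaller-ᵀ (lowerColumn (M ᵀ) p≢0 q)

 record ClearedColumn {m n} (M : Matrix (suc m) (suc n)) : Set where
   constructor cleared
   field
     {N}   : Matrix (suc m) (suc n)
     M∼N   : M ∼ N
     row   : ∀ j → N zero j ≡ M zero j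
     below : ∀ i → N (suc i) zero ≡ 0ℤ

 clearColumn : ∀ {m n} (M : Matrix (suc m) (suc n)) → (∀ i → corner M ∣ M (suc i) zero) → ClearedColumn M
 clearColumn {m} M div = cleared (shear-row zero c refl≡ M) (λ j → ℤₚ.+-identityʳ _) below
   where
   open Signed._∣_
   c : Vector ℤ (suc m)
   c zero    = 0ℤ
   c (suc i) = ℤ.- quotient (div i)
   below : ∀ i → M (suc i) zero ℤ.+ ℤ.- quotient (div i) ℤ.* corner M ≡ 0ℤ
   below i = trans≡ (cong (ℤ._+ ℤ.- quotient (div i) ℤ.* corner M) (equality (div i))) (rearrange (quotient (div i)) (corner M))
     where
     rearrange : ∀ q p → q ℤ.* p ℤ.+ ℤ.- q ℤ.* p ≡ 0ℤ
     rearrange = solve-∀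

 record Block {m n} (M : Matrix (suc m) (suc n)) : Set where
   field
     corner≢0 : corner M ≢ 0ℤ
     row      : ∀ j → M zero (suc j) ≡ 0ℤ
     column   : ∀ i → M (suc i) zero ≡ 0ℤ
     rest     : ∀ i j → corner M ∣ M (suc i) (suc j)

 Blocked : ∀ {m n} → Matrix (suc m) (suc n) → Set
 Blocked M = ∃ λ N → M ∼ N × Block N

 via : ∀ {m n} {M N : Matrix (suc m) (suc n)} → M ∼ N → Blocked N → Blocked M
 via f (L , g , b) = L , ∼-trans f g , b

 counterexample : ∀ {n} {P : Fin n → Set} → (∀ i → Dec (P i)) → ¬ (∀ i → P i) → ∃ λ i → ¬ P i
 counterexample {n} {P} P? ¬p = Finₚ.¬∀⟶∃¬ n P P? ¬p

 block : ∀ {m n} (M : Matrix (suc m) (suc n)) → corner M ≢ 0ℤ → Acc ℕ._<_ ℤ.∣ corner M ∣ → Blocked M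
 block {m} {n} M p≢0 (acc rec) = columns (Finₚ.all? λ i → corner M ∣? M (suc i) zero)
   where
   again : ∀ {M′} → M ∼ M′ → corner M′ ≡ corner M → Smaller M′ → Blocked M
   again f eq (smaller g q r) = via (∼-trans f g) (block _ q (rec (subst≡ (λ z → _ ℕ.< ℤ.∣ z ∣) eq r)))

   entries : ∀ {M₂} → M ∼ M₂ → corner M₂ ≡ corner M → (∀ i → M₂ (suc i) zero ≡ 0ℤ) → (∀ j → M₂ zero (suc j) ≡ 0ℤ) →
     Dec (∀ i j → corner M₂ ∣ M₂ (suc i) (suc j)) → Blocked M
   entries {M₂} f eq col row (yes div) = M₂ , f , record
     { corner≢0 = λ z → p≢0 (trans≡ (sym≡ eq) z) ; row = row ; column = col ; rest = div }
   entries {M₂} f eq col row (no ¬div) = again (∼-trans f (shear-row (suc i) c refl≡ M₂)) (trans≡ corner≡ eq)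
     (lowerRow _ (λ z → p≢0 (trans≡ (sym≡ eq) (trans≡ (sym≡ corner≡) z)))
       (j , λ div → proj₂ badEntry (subst₂≡ corner≡ entry≡ div)))
     where
     badRow : ∃ λ i → ¬ (∀ j → corner M₂ ∣ M₂ (suc i) (suc j))
     badRow = counterexample (λ i → Finₚ.all? λ j → corner M₂ ∣? M₂ (suc i) (suc j)) ¬div
     i = proj₁ badRow
     badEntry : ∃ λ j → ¬ corner M₂ ∣ M₂ (suc i) (suc j)
     badEntry = counterexample (λ j → corner M₂ ∣? M₂ (suc i) (suc j)) (proj₂ badRow)
     j = proj₁ badEntry
     c : Vector ℤ (suc m)
     c zero    = 1ℤ
     c (suc _) = 0ℤ
     corner≡ : M₂ zero zero ℤ.+ 1ℤ ℤ.* M₂ (suc i) zero ≡ M₂ zero zero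
     corner≡ = trans≡ (cong (λ z → M₂ zero zero ℤ.+ 1ℤ ℤ.* z) (col i)) (ℤₚ.+-identityʳ _)
     entry≡ : M₂ zero (suc j) ℤ.+ 1ℤ ℤ.* M₂ (suc i) (suc j) ≡ M₂ (suc i) (suc j)
     entry≡ = trans≡ (cong (ℤ._+ 1ℤ ℤ.* M₂ (suc i) (suc j)) (row j)) (trans≡ (ℤₚ.+-identityˡ _) (ℤₚ.*-identityˡ _))
     subst₂≡ : ∀ {a b c d} → a ≡ b → c ≡ d → a ∣ c → b ∣ d
     subst₂≡ refl≡ refl≡ x = x

   rows : ∀ {M₁} → M ∼ M₁ → corner M₁ ≡ corner M → (∀ i → M₁ (suc i) zero ≡ 0ℤ) →
     Dec (∀ j → corner M₁ ∣ M₁ zero (suc j)) → Blocked M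
   rows {M₁} f eq col (no ¬div) = again f eq
     (lowerRow M₁ (λ z → p≢0 (trans≡ (sym≡ eq) z)) (counterexample (λ j → corner M₁ ∣? M₁ zero (suc j)) ¬div))
   rows {M₁} f eq col (yes div) = entries {N ᵀ} (∼-trans f (∼-ᵀ M∼N)) (trans≡ (row zero) eq)
     (λ i → trans≡ (row (suc i)) (col i)) below
     (Finₚ.all? λ i → Finₚ.all? λ j → corner N ∣? N (suc j) (suc i))
     where open ClearedColumn (clearColumn (M₁ ᵀ) div)

   columns : Dec (∀ i → corner M ∣ M (suc i) zero) → Blocked M
   columns (no ¬div) = again ∼-refl refl≡ (lowerColumn M p≢0 (counterexample (λ i → corner M ∣? M (suc i) zero) ¬div))
     where
     ∼-refl : M ∼ M
     ∼-refl = record { P = identity ; Q = identity ; P-inv = identity-Invertible ; Q-inv = identity-Invertible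
       ; PMQ = λ i j → trans≡ (⊗-identityʳ (identity ⊗ M) i j) (⊗-identityˡ M i j) }
   columns (yes div) = rows {N} M∼N (row zero) below (Finₚ.all? λ j → corner N ∣? N zero (suc j))
     where open ClearedColumn (clearColumn M div)

 infixr 5 _⊕_
 _⊕_ : ∀ {m n} → ℤ → Matrix m n → Matrix (suc m) (suc n)
 (a ⊕ X) zero    zero    = a
 (a ⊕ X) zero    (suc j) = 0ℤ
 (a ⊕ X) (suc i) zero    = 0ℤ
 (a ⊕ X) (suc i) (suc j) = X i j

 ⊕-⊗ : ∀ {l m n} a b (X : Matrix l m) (Y : Matrix m n) → (a ⊕ X) ⊗ (b ⊕ Y) ≗ (a ℤ.* b) ⊕ (X ⊗ Y)
 ⊕-⊗ {m = m} a b X Y zero    zero    = trans≡ (cong (λ z → a ℤ.* b ℤ.+ z) (ℤM.sum-0 {m} (λ _ → 0ℤ) λ _ → refl≡)) (ℤₚ.+-identityʳ _)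
 ⊕-⊗ {m = m} a b X Y zero    (suc j) = trans≡ (cong (λ z → a ℤ.* 0ℤ ℤ.+ z) (ℤM.sum-0 {m} (λ k → 0ℤ ℤ.* Y k j) λ _ → refl≡)) (trans≡ (ℤₚ.+-identityʳ _) (ℤₚ.*-zeroʳ a))
 ⊕-⊗ {m = m} a b X Y (suc i) zero    = ℤM.sum-0 {suc m} (λ k → (a ⊕ X) (suc i) k ℤ.* (b ⊕ Y) k zero) λ { zero → refl≡ ; (suc k) → ℤₚ.*-zeroʳ (X i k) }
 ⊕-⊗ a b X Y (suc i) (suc j) = ℤₚ.+-identityˡ _

 ⊕-cong : ∀ {m n a b} {X Y : Matrix m n} → a ≡ b → X ≗ Y → a ⊕ X ≗ b ⊕ Y
 ⊕-cong p q zero    zero    = p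
 ⊕-cong p q zero    (suc j) = refl≡
 ⊕-cong p q (suc i) zero    = refl≡
 ⊕-cong p q (suc i) (suc j) = q i j

 prepend : ℕ → (ℕ → ℕ) → ℕ → ℕ
 prepend p d zero    = p
 prepend p d (suc k) = d k

 ⊕-diagonal : ∀ {m n} p (d : ℕ → ℕ) → (+ p) ⊕ diagonal d ≗ diagonal {suc m} {suc n} (prepend p d)
 ⊕-diagonal p d zero    zero    = refl≡
 ⊕-diagonal p d zero    (suc j) = refl≡
 ⊕-diagonal p d (suc i) zero    = refl≡
 ⊕-diagonal p d (suc i) (suc j) = refl≡

 ⊕-identity : ∀ {n} → 1ℤ ⊕ identity {n} ≗ identity
 ⊕-identity zero    zero    = refl≡
 ⊕-identity zero    (suc j) = refl≡
 ⊕-identity (suc i) zero    = refl≡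
 ⊕-identity (suc i) (suc j) = refl≡

 ⊕-Invertible : ∀ {n} s {X : Matrix n n} → s ℤ.* s ≡ 1ℤ → Invertible X → Invertible (s ⊕ X)
 ⊕-Invertible s {X} ss I = record
   { inverse  = s ⊕ inverse
   ; inverseˡ = λ i j → trans≡ (⊕-⊗ s s inverse X i j) (trans≡ (⊕-cong ss inverseˡ i j) (⊕-identity i j))
   ; inverseʳ = λ i j → trans≡ (⊕-⊗ s s X inverse i j) (trans≡ (⊕-cong ss inverseʳ i j) (⊕-identity i j))
   }
   where open Invertible I

 sum-∣ : ∀ {n} p (f : Vector ℤ n) → (∀ i → p ∣ f i) → p ∣ ℤΣ f
 sum-∣ {zero}  p f div = divides 0ℤ refl≡
 sum-∣ {suc n} p f div = ∣m∣n⇒∣m+n (div zero) (sum-∣ p (f ∘ suc) (div ∘ suc))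

 ⊗-∣ : ∀ {k l m n} p (A : Matrix k l) (M : Matrix l m) (B : Matrix m n) → (∀ i j → p ∣ M i j) → ∀ i j → p ∣ (A ⊗ M ⊗ B) i j
 ⊗-∣ p A M B div i j = sum-∣ p _ λ t → ∣m⇒∣m*n (B t j) (sum-∣ p _ λ u → ∣n⇒∣m*n (A i u) (div u t))

 sign : ∀ p → ∃ λ s → s ℤ.* s ≡ 1ℤ × s ℤ.* p ≡ + ℤ.∣ p ∣
 sign (+ n)      = 1ℤ , refl≡ , ℤₚ.*-identityˡ (+ n)
 sign (-[1+ n ]) = -1ℤ , refl≡ , ℤₚ.-1*i≡-i -[1+ n ]

 smith-∼ : ∀ {m n} {M N : Matrix m n} → M ∼ N → SmithForm N → SmithForm M
 smith-∼ {M = M} f F = record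
   { U = U ⊗ P ; V = Q ⊗ V ; U-inv = ⊗-Invertible U-inv P-inv ; V-inv = ⊗-Invertible Q-inv V-inv
   ; d = d ; d-∣ = d-∣ ; rk = rk ; rk≤m = rk≤m ; rk≤n = rk≤n ; d≢0 = d≢0 ; d≡0 = d≡0
   ; UMV = λ i j → trans≡ (shuffle U P M Q V i j)
       (trans≡ (⊗-cong {B = V} (⊗-cong {A = U} (λ _ _ → refl≡) PMQ) (λ _ _ → refl≡) i j) (UMV i j))
   }
   where
   open _∼_ f
   open SmithForm F

 smith-zero : ∀ {m n} (M : Matrix m n) → (∀ i j → M i j ≡ 0ℤ) → SmithForm M
 smith-zero M z = record
   { U = identity ; V = identity ; U-inv = identity-Invertible ; V-inv = identity-Invertible
   ; d = λ _ → 0 ; d-∣ = λ _ → 0 ∣0 ; rk = 0 ; rk≤m = ℕ.z≤n ; rk≤n = ℕ.z≤n ; d≢0 = λ _ () ; d≡0 = λ _ _ → refl≡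
   ; UMV = λ i j → trans≡ (⊗-identityʳ (identity ⊗ M) i j) (trans≡ (⊗-identityˡ M i j) (trans≡ (z i j) (sym≡ (zero-entry i j))))
   }
   where
   zero-entry : ∀ i j → diagonal (λ _ → 0) i j ≡ 0ℤ
   zero-entry i j with toℕ i ℕ.≡ᵇ toℕ j
   ... | true  = refl≡
   ... | false = refl≡

 smith-block : ∀ {m n} (M : Matrix (suc m) (suc n)) → Block M → SmithForm (λ i j → M (suc i) (suc j)) → SmithForm M
 smith-block {m} {n} M B F = record
   { U = s ⊕ U ; V = 1ℤ ⊕ V ; U-inv = ⊕-Invertible s ss U-inv ; V-inv = ⊕-Invertible 1ℤ refl≡ V-inv
   ; d = e ; d-∣ = e-∣ ; rk = suc rk ; rk≤m = ℕ.s≤s rk≤m ; rk≤n = ℕ.s≤s rk≤n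
   ; d≢0 = λ { zero _ z → corner≢0 (ℤₚ.∣i∣≡0⇒i≡0 z) ; (suc k) (ℕ.s≤s q) → d≢0 k q }
   ; d≡0 = λ { (suc k) (ℕ.s≤s q) → d≡0 k q }
   ; UMV = λ i j → trans≡ (⊗-cong {B = 1ℤ ⊕ V} (⊗-cong {A = s ⊕ U} (λ _ _ → refl≡) M≗) (λ _ _ → refl≡) i j)
       (trans≡ (⊗-cong {B = 1ℤ ⊕ V} (⊕-⊗ s p U M′) (λ _ _ → refl≡) i j)
       (trans≡ (⊕-⊗ (s ℤ.* p) 1ℤ (U ⊗ M′) V i j)
       (trans≡ (⊕-cong (trans≡ (ℤₚ.*-identityʳ _) sp) UMV i j) (⊕-diagonal ℤ.∣ p ∣ d i j))))
   }
   where
   open Block B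
   open SmithForm F
   p = corner M
   s = proj₁ (sign p)
   ss = proj₁ (proj₂ (sign p))
   sp = proj₂ (proj₂ (sign p))
   M′ : Matrix m n
   M′ i j = M (suc i) (suc j)
   e : ℕ → ℕ
   e = prepend ℤ.∣ p ∣ d
   M≗ : M ≗ p ⊕ M′
   M≗ zero    zero    = refl≡
   M≗ zero    (suc j) = row j
   M≗ (suc i) zero    = column i
   M≗ (suc i) (suc j) = refl≡
   first : ∀ {m n} (M′ : Matrix m n) (F : SmithForm M′) → (∀ i j → p ∣ M′ i j) → ℤ.∣ p ∣ ∣ℕ SmithForm.d F 0
   first {zero}  {_}     M′ F r = subst≡ (_ ∣ℕ_) (sym≡ (SmithForm.d≡0 F 0 (SmithForm.rk≤m F))) (_ ∣0)
   first {suc _} {zero}  M′ F r = subst≡ (_ ∣ℕ_) (sym≡ (SmithForm.d≡0 F 0 (SmithForm.rk≤n F))) (_ ∣0)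
   first {suc _} {suc _} M′ F r = ∣⇒∣ᵤ (subst≡ (p ∣_) (SmithForm.UMV F zero zero) (⊗-∣ p (SmithForm.U F) M′ (SmithForm.V F) r zero zero))
   e-∣ : ∀ k → e k ∣ℕ e (suc k)
   e-∣ zero    = first M′ F rest
   e-∣ (suc k) = d-∣ k

 smith : ∀ {m n} (M : Matrix m n) → SmithForm M
 smith {zero}          M = smith-zero M λ ()
 smith {suc m} {zero}  M = smith-zero M λ _ ()
 smith {suc m} {suc n} M with Finₚ.all? (λ i → Finₚ.all? λ j → M i j ℤₚ.≟ 0ℤ)
 ... | yes z = smith-zero M z
 ... | no ¬z = reduce (counterexample (λ i → Finₚ.all? λ j → M i j ℤₚ.≟ 0ℤ) ¬z)
   where
   finish : Blocked M → SmithForm M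
   finish (N , f , b) = smith-∼ f (smith-block N b (smith (λ i j → N (suc i) (suc j))))
   reduce : (∃ λ i → ¬ (∀ j → M i j ≡ 0ℤ)) → SmithForm M
   reduce (i , ¬zᵢ) with counterexample (λ j → M i j ℤₚ.≟ 0ℤ) ¬zᵢ
   ... | j , ¬zᵢⱼ = finish (via (∼-trans (exchange-row i M) (∼-ᵀ (exchange-row j _)))
           (block _ ¬zᵢⱼ (<-wellFounded _)))

open SmithAlgorithm using (smith) public

fromℤℝ : ℤ → ℝ
fromℤℝ = fromℚ ∘ fromℤ

module ℚ-Space = LinearAlgebra ℚₚ.+-*-commutativeRing fromℤ
module ℝ-Space = LinearAlgebra ℝ-ring fromℤℝ

ℚ-fieldEmbedding : FieldEmbedding ℚₚ.+-*-commutativeRing fromℤ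
ℚ-fieldEmbedding = record
  { embedding = record
    { ι-+ = λ a b → ℚₚ.toℚᵘ-injective (ℚᵘₚ.≃-sym (ℚᵘₚ.≃-trans
        (ℚₚ.toℚᵘ-homo-+ (fromℤ a) (fromℤ b)) (ℚᵘ.*≡* (cong (ℤ._* 1ℤ) (cong₂ ℤ._+_ (ℤₚ.*-identityʳ a) (ℤₚ.*-identityʳ b))))))
    ; ι-* = λ a b → ℚₚ.toℚᵘ-injective (ℚᵘₚ.≃-sym (ℚₚ.toℚᵘ-homo-* (fromℤ a) (fromℤ b)))
    ; ι-0 = refl≡
    ; ι-1 = refl≡
    }
  ; ι-injective = λ a eq → cong ℚ.numerator eq
  ; ι-inverse = inverse
  }
  where
  inverse : ∀ k → k ≢ 0 → ∃ λ y → fromℤ (+ k) ℚ.* y ≡ 1ℚ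
  inverse zero    k≢0 = contradiction refl≡ k≢0
  inverse (suc k) _   = ℚ.1/ fromℤ (+ suc k) , ℚₚ.*-inverseʳ (fromℤ (+ suc k))

ℝ-fieldEmbedding : FieldEmbedding ℝ-ring fromℤℝ
ℝ-fieldEmbedding = record
  { embedding = record
    { ι-+ = λ a b → ℝ≡ (ι-+ a b) ; ι-* = λ a b → ℝ≡ (ι-* a b) ; ι-0 = ℝ≡ refl≡ ; ι-1 = ℝ≡ refl≡ }
  ; ι-injective = λ a eq → ι-injective a (fromℚ-injective eq)
  ; ι-inverse = λ k k≢0 → let y , p = ι-inverse k k≢0 in fromℚ y , ℝ≡ p
  }
  where
  open FieldEmbedding ℚ-fieldEmbedding
  ℝ≡ : ∀ {x y} → (∀ {i} → seq x i ≡ seq y i) → x ≈ℝ y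
  ℝ≡ p = ≗⇒≈ λ _ → p

-- Rank over ℚ: the number of vectors in a basis of the column space.
rank : ∀ {m n} → Matrix m n → ℕ
rank M = proj₁ basis
  where
  basis : ∃ λ k → ∃ λ v → ℚ-Space.IsBasis {k} (ℚ-Space.ColumnSpace M) v
  basis = SolutionSpaces.columnSpaceBasis ℚₚ.+-*-commutativeRing fromℤ ℚ-fieldEmbedding (smith M)

-- The j-th invariant factor, 1 ≤ j ≤ rank M, with the convention that the 0-th
-- is 1.  These do not depend on the Smith normal form that smith finds.
invariantFactor : ∀ {m n} → Matrix m n → ℕ → ℕ
invariantFactor M zero    = 1
invariantFactor M (suc k) = SmithForm.d (smith M) k

-- [c]_q ∈ Col_q(M); residues modulo q are represented by integers.
InColumnSpan : ∀ {m n} → ℕ → Matrix m n → Vector ℤ m → Set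
InColumnSpan q M c = ∃ λ x → ∀ i → + q ∣ (M ·ℤ x) i ℤ.- c i

subsets : ∀ m → List (Subset m)
subsets zero    = []ᵥ ∷ []
subsets (suc m) = map (outside ∷ᵥ_) (subsets m) List.++ map (inside ∷ᵥ_) (subsets m)

select : ∀ {m} (J : Subset m) → Fin ∣ J ∣ → Fin m
select (outside ∷ᵥ J) k       = suc (select J k)
select (inside  ∷ᵥ J) zero    = zero
select (inside  ∷ᵥ J) (suc k) = suc (select J k)

select-∈ : ∀ {m} (J : Subset m) k → select J k ∈ J
select-∈ (outside ∷ᵥ J) k       = there (select-∈ J k)
select-∈ (inside  ∷ᵥ J) zero    = here
select-∈ (inside  ∷ᵥ J) (suc k) = there (select-∈ J k)

∈-select : ∀ {m} (J : Subset m) {i} → i ∈ J → ∃ λ k → select J k ≡ i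
∈-select (outside ∷ᵥ J) (there p) = let k , eq = ∈-select J p in k , cong suc eq
∈-select (inside  ∷ᵥ J) here      = zero , refl≡
∈-select (inside  ∷ᵥ J) (there p) = let k , eq = ∈-select J p in suc k , cong suc eq

sumOver : ∀ {X : Set} → List X → (X → ℤ) → ℤ
sumOver xs f = foldr ℤ._+_ 0ℤ (map f xs)

-- Polynomials in t are sequences of coefficients; monomial d is t^d.
monomial : ℕ → ℕ → ℤ
monomial d k = if d ℕ.≡ᵇ k then 1ℤ else 0ℤ

module Arrangement {m n l : ℕ} (A : Matrix m n) (B : Matrix l n) (a : Vector ℤ m) (b : Vector ℤ l) where

  open ℝ-Space using (_·_; HasDimension; Solution)

  V : Vector ℝ n → Set
  V = Solution B b

  H : Fin m → Vector ℝ n → Set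
  H i x = V x × (A · x) i ≈ℝ fromℤℝ (a i)

  ⋂H : Subset m → Vector ℝ n → Set
  ⋂H J x = V x × (∀ i → i ∈ J → H i x)

  C : (J : Subset m) → Matrix (l ℕ.+ ∣ J ∣) n
  C J = B ++ (A ∘ select J)

  c : (J : Subset m) → Vector ℤ (l ℕ.+ ∣ J ∣)
  c J = b ++ (a ∘ select J)

  C̄ : (J : Subset m) → Matrix (l ℕ.+ ∣ J ∣) (n ℕ.+ 1)
  C̄ J i = C J i ++ λ (_ : Fin 1) → c J i

  Solution⇔⋂H : ∀ J x → Solution (C J) (c J) x ⇔ ⋂H J x
  Solution⇔⋂H J x = mk⇔ to from
    where
    Holds : Vector ℤ n → ℤ → Set
    Holds α e = ((λ (_ : Fin 1) → α) · x) zero ≈ℝ fromℤℝ e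
    to : Solution (C J) (c J) x → ⋂H J x
    to s = v , λ i p → let k , eq = ∈-select J p in v , subst≡ (λ i → Holds (A i) (a i)) eq (h k)
      where
      v : V x
      v i = subst₂ Holds (lookup-++ˡ B (A ∘ select J) i) (lookup-++ˡ b (a ∘ select J) i) (s (i ↑ˡ ∣ J ∣))
      h : ∀ k → Holds (A (select J k)) (a (select J k))
      h k = subst₂ Holds (lookup-++ʳ B (A ∘ select J) k) (lookup-++ʳ b (a ∘ select J) k) (s (l ↑ʳ k))
    from : ⋂H J x → Solution (C J) (c J) x
    from (v , h) i with splitAt l i
    ... | inj₁ i′ = v i′
    ... | inj₂ k  = proj₂ (h (select J k) (select-∈ J k))

  -- Either ⋂H J has dimension d, and then d is unique, or it is empty.
  flat : ∀ J → ∃ (HasDimension (⋂H J)) ⊎ (∀ x → ¬ ⋂H J x)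
  flat J = Sum.map
    (λ { (d , p , s , v , ind , span) → d , p , to s , v , ind , λ x →
         mk⇔ (λ h → Equivalence.to (span x) (from h)) (λ z → to (Equivalence.from (span x) z)) })
    (λ empty x h → empty x (from h))
    (SolutionSpaces.dimension? ℝ-ring fromℤℝ ℝ-fieldEmbedding (smith (C J)) (c J))
    where
    to : ∀ {x} → Solution (C J) (c J) x → ⋂H J x
    to = Equivalence.to (Solution⇔⋂H J _)
    from : ∀ {x} → ⋂H J x → Solution (C J) (c J) x
    from = Equivalence.from (Solution⇔⋂H J _)

  -- The coefficients of the characteristic polynomial.
  χ : ℕ → ℤ
  χ k = sumOver (subsets m) λ J →
    [ (λ f → -1ℤ ℤ.^ ∣ J ∣ ℤ.* monomial (proj₁ f) k) , (λ _ → 0ℤ) ] (flat J)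

  r s : ℕ
  r = rank B
  s = rank (B ++ A)

  -- Read off from χ(t) = Σ_{r ≤ j ≤ s} (-1)^(j - r) w j t^(n - j).
  w : ℕ → ℤ
  w j = -1ℤ ℤ.^ (j ℕ.∸ r) ℤ.* χ (n ℕ.∸ j)

  r⟨_⟩ r̄⟨_⟩ : Subset m → ℕ
  r⟨ J ⟩ = rank (C J)
  r̄⟨ J ⟩ = rank (C̄ J)

  -- d J j is d_{J,j}, with j counted from 1.
  d d̄ : Subset m → ℕ → ℕ
  d J = invariantFactor (C J)
  d̄ J = invariantFactor (C̄ J)

  ρ : ℕ
  ρ = foldr lcm 1 (map (λ J → d J r⟨ J ⟩) (filter (λ J → r̄⟨ J ⟩ ℕₚ.≟ r⟨ J ⟩) (subsets m)))

  -- The maximum over the empty set is 0.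
  q₀ : ℕ
  q₀ = foldr ℕ._⊔_ 0 (map (λ J → d̄ J r̄⟨ J ⟩) (filter (λ J → r̄⟨ J ⟩ ℕₚ.≟ r⟨ J ⟩ ℕ.+ 1) (subsets m)))

  d̃ : Subset m → ℕ → ℕ
  d̃ J q = if does (All.all? (λ j → gcd q (d J j) ℕₚ.≟ gcd q (d̄ J j)) js)
          then ℕList.product (map (λ j → gcd (d J j) q) js)
          else 0
    where
    js : List ℕ
    js = map suc (upTo r⟨ J ⟩)

  β : ℕ → ℕ → ℤ
  β j q = -1ℤ ℤ.^ (j ℕ.∸ r) ℤ.*
    sumOver (filter (λ J → (r̄⟨ J ⟩ ℕₚ.≟ r⟨ J ⟩) ×-dec (r⟨ J ⟩ ℕₚ.≟ j)) (subsets m))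
      λ J → -1ℤ ℤ.^ ∣ J ∣ ℤ.* + d̃ J q

  -- Coefficients of the a-constituent: the formula for β, evaluated at a.
  γ : ℕ → ℕ → ℤ
  γ j a = β j a

{-# OPTIONS --safe #-}

-- Up to sign, w_j and β_j are alternating sums over the consistent J of rank j,
-- with weights 1 and d̃_J(q).  Deletion and contraction show that the signed sum
-- with weight 1 is nonnegative, and positive when no hyperplane is a loop.  If
-- [c_J]_q lies in Col_q(C_J), then q^(n-j) d̃_J(q) counts the x mod q with
-- C_J x = c_J.  Writing F(x) for the set of hyperplanes that contain x mod q,
-- this count is a sum over x of the weights J ↦ [J ⊆ F(x)]; for such sums the
-- same induction bounds the weighted sum below by κ times the unweighted one
-- whenever every weight is at least κ, here with κ = q^(n-j).
--
-- Ranks and invariant factors enter through one principle: if g divides the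
-- k-th invariant factor of M and N x ≡ 0 mod g whenever M x ≡ 0 mod g, then g
-- divides the k-th invariant factor of N.

module Submission where

open import Defs
open import Data.Fin.Base using (Fin)
open import Data.Integer.Base using (ℤ; 0ℤ) renaming (_<_ to _<ℤ_; _≤_ to _≤ℤ_)
open import Data.Nat.Base using (ℕ; suc; _≤_; _<_)
open import Data.Nat.GCD using (gcd)
open import Data.Product.Base using (∃; _×_)
open import Data.Vec.Functional using (Vector)
open import Relation.Binary.PropositionalEquality using (_≡_)

open import Algebra.Bundles using (CommutativeRing)
import Algebra.Properties.CommutativeSemigroup as CommutativeSemigroupProperties
import Algebra.Properties.Ring as RingProperties
import Algebra.Properties.Semiring.Sum as SemiringSum
open import Data.Bool.Base using (T; true; false; if_then_else_)
open import Data.Fin.Base using (zero; suc; toℕ; fromℕ; fromℕ<; inject≤; splitAt; _↑ˡ_; _↑ʳ_; punchIn)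
import Data.Fin.Properties as Finₚ
open import Data.Fin.Subset using (Subset; inside; outside; ∣_∣; _∈_)
open import Data.Integer.Base using (1ℤ; -1ℤ; +_)
import Data.Integer.Base as ℤ
import Data.Integer.DivMod as ℤ/
open import Data.Integer.Divisibility.Signed using (_∣_; _∣?_; divides; ∣m∣n⇒∣m+n; ∣m∣n⇒∣m-n; ∣n⇒∣m*n; ∣m⇒∣m*n; ∣ᵤ⇒∣; ∣⇒∣ᵤ; ∣-trans; ∣-refl; 0∣⇒≡0)
import Data.Integer.Properties as ℤₚ
open import Data.Integer.Tactic.RingSolver using (solve-∀)
open import Data.List.Base using (List; []; _∷_; map; upTo; applyUpTo; filter; foldr)
import Data.List.Base as List
open import Data.List.Membership.Propositional using () renaming (_∈_ to _∈ᴸ_)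
open import Data.List.Membership.Propositional.Properties using (∈-filter⁺; ∈-map⁺; ∈-++⁺ˡ; ∈-++⁺ʳ)
open import Data.List.Properties using (map-cong-local)
open import Data.List.Relation.Unary.All using (All; []; _∷_)
import Data.List.Relation.Unary.All as All
import Data.List.Relation.Unary.All.Properties as Allₚ
import Data.List.Relation.Unary.Any as Any
open import Data.Maybe.Base using (Maybe; just; nothing)
open import Data.Nat.Base using (zero)
import Data.Nat.Base as ℕ
open import Data.Nat.Divisibility as ℕ∣ using () renaming (_∣_ to _∣ℕ_)
open import Data.Nat.GCD using (gcd[m,n]∣m; gcd[m,n]∣n; gcd-greatest; gcd-comm; gcd[m,n]≢0; gcd-zeroˡ; gcd-zeroʳ; gcd-identityˡ; c*gcd[m,n]≡gcd[cm,cn])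
open import Data.Nat.LCM using (lcm; m∣lcm[m,n]; n∣lcm[m,n])
import Data.Nat.ListAction as ℕList
import Data.Nat.Properties as ℕₚ
open import Data.Product.Base using (_,_; proj₁; proj₂)
open import Data.Rational.Base using (0ℚ; 1ℚ)
import Data.Rational.Base as ℚ
import Data.Rational.Properties as ℚₚ
open import Data.Sum.Base using (_⊎_; inj₁; inj₂; [_,_]; [_,_]′)
open import Data.Vec.Base using (here; there) renaming (_∷_ to _∷ᵥ_; [] to []ᵥ)
open import Data.Vec.Functional using (_++_) renaming (_∷_ to _∷ᶠ_; [] to []ᶠ)
open import Data.Vec.Functional.Properties using (lookup-++ˡ; lookup-++ʳ)
open import Function.Base using (_∘_; id)
open import Function.Bundles using (_⇔_; mk⇔; Equivalence)
open import Level using (0ℓ)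
import Relation.Binary.Reasoning.Setoid as SetoidReasoning
open import Relation.Binary.PropositionalEquality using (_≢_; refl; sym; trans; cong; cong₂; subst; subst₂; module ≡-Reasoning)
open import Relation.Nullary using (¬_; Dec; yes; no; does; contradiction)
open import Relation.Nullary.Decidable using (_×-dec_; _→-dec_; dec-true; dec-false)
open import Relation.Unary using (Decidable)

open CommutativeSemigroupProperties ℤₚ.*-commutativeSemigroup using () renaming (x∙yz≈y∙xz to exchange)
open SmithAlgorithm using (_ᵀ; ⊗-assoc; ⊗-cong; ⊗-identityʳ; ⊗-ᵀ; ᵀ-Invertible; sum-∣; counterexample)

-- Signed sums over subsets

-- The sums alternate, so d̃_J(q) ≥ 1 gives no inequality term by term, and J ↦ d̃_J(q) is not
-- visibly a sum of weights [J ⊆ F]. Multiplied by q^(n - r(J)) it becomes a solution count, which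
-- has that form on all subsets, inconsistent ones included; on the sets of rank j the multiplier is
-- the constant κ and cancels at the end. The induction needs more than nonnegative weights: at a
-- loop the unweighted sum vanishes and the weight is replaced by its difference, which must be of
-- the same kind again. For positivity the danger is a contraction that creates loops. The chosen
-- branch deletes while the remaining rows still reach rank j, and contracts only a coloop. The
-- index a of a constituent enters through gcds alone: the invariant factors concerned divide ρ, so
-- d̃_J(a) = d̃_J(q), and at 1 all gcds are 1, so γ_j(1) is the unweighted sum. Dimensions live over
-- Cauchy reals, where vanishing is undecidable. Hence bases are compared without choosing real
-- pivots, and all case distinctions are made on integer matrices through Smith forms.

sumOver-++ : ∀ {X : Set} (xs ys : List X) f → sumOver (xs List.++ ys) f ≡ sumOver xs f ℤ.+ sumOver ys f
sumOver-++ []       ys f = sym (ℤₚ.+-identityˡ _)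
sumOver-++ (x ∷ xs) ys f = trans (cong (λ s → f x ℤ.+ s) (sumOver-++ xs ys f)) (sym (ℤₚ.+-assoc (f x) _ _))

sumOver-map : ∀ {X Y : Set} (g : X → Y) (xs : List X) f → sumOver (map g xs) f ≡ sumOver xs (f ∘ g)
sumOver-map g []       f = refl
sumOver-map g (x ∷ xs) f = cong (λ s → f (g x) ℤ.+ s) (sumOver-map g xs f)

sumOver-cong : ∀ {X : Set} (xs : List X) {f g : X → ℤ} → (∀ x → f x ≡ g x) → sumOver xs f ≡ sumOver xs g
sumOver-cong []       p = refl
sumOver-cong (x ∷ xs) p = cong₂ ℤ._+_ (p x) (sumOver-cong xs p)

sumOver-*ˡ : ∀ {X : Set} z (xs : List X) f → z ℤ.* sumOver xs f ≡ sumOver xs (λ x → z ℤ.* f x)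
sumOver-*ˡ z []       f = ℤₚ.*-zeroʳ z
sumOver-*ˡ z (x ∷ xs) f = trans (ℤₚ.*-distribˡ-+ z (f x) _) (cong (λ s → z ℤ.* f x ℤ.+ s) (sumOver-*ˡ z xs f))

-- The sum of (-1)^|J| f J, given by recursion on the first element so that one unfolding is one
-- deletion-contraction step.
alternating : ∀ {m} → (Subset m → ℤ) → ℤ
alternating {zero}  f = f []ᵥ
alternating {suc m} f = alternating (f ∘ (outside ∷ᵥ_)) ℤ.- alternating (f ∘ (inside ∷ᵥ_))

alternating-cong : ∀ {m} {f g : Subset m → ℤ} → (∀ J → f J ≡ g J) → alternating f ≡ alternating g
alternating-cong {zero}  p = p []ᵥ
alternating-cong {suc m} p = cong₂ ℤ._-_ (alternating-cong (p ∘ (outside ∷ᵥ_))) (alternating-cong (p ∘ (inside ∷ᵥ_)))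

alternating-0 : ∀ {m} {f : Subset m → ℤ} → (∀ J → f J ≡ 0ℤ) → alternating f ≡ 0ℤ
alternating-0 {zero}  p = p []ᵥ
alternating-0 {suc m} p = cong₂ ℤ._-_ (alternating-0 (p ∘ (outside ∷ᵥ_))) (alternating-0 (p ∘ (inside ∷ᵥ_)))

alternating-− : ∀ {m} (f g : Subset m → ℤ) → alternating f ℤ.- alternating g ≡ alternating (λ J → f J ℤ.- g J)
alternating-− {zero}  f g = refl
alternating-− {suc m} f g = trans (rearrange (alternating (f ∘ (outside ∷ᵥ_))) _ _ _)
  (cong₂ ℤ._-_ (alternating-− (f ∘ (outside ∷ᵥ_)) _) (alternating-− (f ∘ (inside ∷ᵥ_)) _))
  where
  rearrange : ∀ a b c d → (a ℤ.- b) ℤ.- (c ℤ.- d) ≡ (a ℤ.- c) ℤ.- (b ℤ.- d)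
  rearrange = solve-∀

alternating-*ˡ : ∀ {m} z (f : Subset m → ℤ) → z ℤ.* alternating f ≡ alternating (λ J → z ℤ.* f J)
alternating-*ˡ {zero}  z f = refl
alternating-*ˡ {suc m} z f = trans (distrib z _ _)
  (cong₂ ℤ._-_ (alternating-*ˡ z (f ∘ (outside ∷ᵥ_))) (alternating-*ˡ z (f ∘ (inside ∷ᵥ_))))
  where
  distrib : ∀ z a b → z ℤ.* (a ℤ.- b) ≡ z ℤ.* a ℤ.- z ℤ.* b
  distrib = solve-∀

sumOver-alternating : ∀ {m} (f : Subset m → ℤ) → sumOver (subsets m) (λ J → -1ℤ ℤ.^ ∣ J ∣ ℤ.* f J) ≡ alternating f
sumOver-alternating {zero}  f = trans (ℤₚ.+-identityʳ _) (ℤₚ.*-identityˡ _)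
sumOver-alternating {suc m} f = begin
  sumOver (map (outside ∷ᵥ_) (subsets m) List.++ map (inside ∷ᵥ_) (subsets m)) g
    ≡⟨ sumOver-++ (map (outside ∷ᵥ_) (subsets m)) _ g ⟩
  sumOver (map (outside ∷ᵥ_) (subsets m)) g ℤ.+ sumOver (map (inside ∷ᵥ_) (subsets m)) g
    ≡⟨ cong₂ ℤ._+_ (sumOver-map _ (subsets m) g) (sumOver-map _ (subsets m) g) ⟩
  sumOver (subsets m) (g ∘ (outside ∷ᵥ_)) ℤ.+ sumOver (subsets m) (g ∘ (inside ∷ᵥ_))
    ≡⟨ cong (λ s → sumOver (subsets m) (g ∘ (outside ∷ᵥ_)) ℤ.+ s)
         (trans (sumOver-cong (subsets m) λ J → ℤₚ.*-assoc -1ℤ (-1ℤ ℤ.^ ∣ J ∣) _)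
           (trans (sym (sumOver-*ˡ -1ℤ (subsets m) _)) (ℤₚ.-1*i≡-i _))) ⟩
  sumOver (subsets m) (g ∘ (outside ∷ᵥ_)) ℤ.- sumOver (subsets m) (λ J → -1ℤ ℤ.^ ∣ J ∣ ℤ.* f (inside ∷ᵥ J))
    ≡⟨ cong₂ ℤ._-_ (sumOver-alternating (f ∘ (outside ∷ᵥ_))) (sumOver-alternating (f ∘ (inside ∷ᵥ_))) ⟩
  alternating f ∎
  where
  open ≡-Reasoning
  g : Subset (suc m) → ℤ
  g J = -1ℤ ℤ.^ ∣ J ∣ ℤ.* f J

-- J is sent to the rank of its flat, or to nothing if the flat is empty.
-- The constructors record what the first hyperplane is relative to the base space.
data Semimatroid : ∀ {m} → ℕ → (Subset m → Maybe ℕ) → Set where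
  empty    : ∀ {r} {ρ : Subset 0 → Maybe ℕ} → ρ []ᵥ ≡ just r → Semimatroid r ρ
  parallel : ∀ {m r} {ρ : Subset (suc m) → Maybe ℕ} → (∀ J → ρ (inside ∷ᵥ J) ≡ nothing) →
             Semimatroid r (ρ ∘ (outside ∷ᵥ_)) → Semimatroid r ρ
  loop     : ∀ {m r} {ρ : Subset (suc m) → Maybe ℕ} → (∀ J → ρ (inside ∷ᵥ J) ≡ ρ (outside ∷ᵥ J)) →
             Semimatroid r (ρ ∘ (outside ∷ᵥ_)) → Semimatroid r ρ
  nonloop  : ∀ {m r} {ρ : Subset (suc m) → Maybe ℕ} → Semimatroid r (ρ ∘ (outside ∷ᵥ_)) →
             Semimatroid (suc r) (ρ ∘ (inside ∷ᵥ_)) → Semimatroid r ρ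

-- N J = #{F ∈ 𝓕 : J ⊆ F} for some multiset 𝓕 of subsets.
data CompletelyMonotone : ∀ {m} → (Subset m → ℤ) → Set where
  nonneg : {N : Subset 0 → ℤ} → 0ℤ ℤ.≤ N []ᵥ → CompletelyMonotone N
  split  : ∀ {m} {N : Subset (suc m) → ℤ} → CompletelyMonotone (λ J → N (outside ∷ᵥ J) ℤ.- N (inside ∷ᵥ J)) →
           CompletelyMonotone (N ∘ (inside ∷ᵥ_)) → CompletelyMonotone N

cm-cong : ∀ {m} {N N′ : Subset m → ℤ} → (∀ J → N J ≡ N′ J) → CompletelyMonotone N → CompletelyMonotone N′
cm-cong p (nonneg c)  = nonneg (subst (0ℤ ℤ.≤_) (p []ᵥ) c)
cm-cong p (split c d) =
  split (cm-cong (λ J → cong₂ ℤ._-_ (p (outside ∷ᵥ J)) (p (inside ∷ᵥ J))) c) (cm-cong (p ∘ (inside ∷ᵥ_)) d)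

cm-+ : ∀ {m} {N N′ : Subset m → ℤ} → CompletelyMonotone N → CompletelyMonotone N′ →
  CompletelyMonotone (λ J → N J ℤ.+ N′ J)
cm-+ (nonneg c) (nonneg c′) = nonneg (ℤₚ.+-mono-≤ c c′)
cm-+ {N = N} {N′} (split c d) (split c′ d′) = split
  (cm-cong (λ J → rearrange (N (outside ∷ᵥ J)) (N (inside ∷ᵥ J)) (N′ (outside ∷ᵥ J)) (N′ (inside ∷ᵥ J))) (cm-+ c c′)) (cm-+ d d′)
  where
  rearrange : ∀ a b c d → (a ℤ.- b) ℤ.+ (c ℤ.- d) ≡ (a ℤ.+ c) ℤ.- (b ℤ.+ d)
  rearrange = solve-∀

cm-0 : ∀ {m} → CompletelyMonotone {m} (λ _ → 0ℤ)
cm-0 {zero}  = nonneg ℤₚ.≤-refl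
cm-0 {suc m} = split cm-0 cm-0

-- `split` stores the difference and the restriction to sets containing the first element; their sum
-- is the restriction to sets avoiding it.
cm-outside : ∀ {m} {N : Subset (suc m) → ℤ} → CompletelyMonotone N → CompletelyMonotone (N ∘ (outside ∷ᵥ_))
cm-outside {N = N} (split c d) = cm-cong (λ J → cancel (N (outside ∷ᵥ J)) (N (inside ∷ᵥ J))) (cm-+ c d)
  where
  cancel : ∀ a b → a ℤ.- b ℤ.+ b ≡ a
  cancel = solve-∀

cm-≥0 : ∀ {m} {N : Subset m → ℤ} → CompletelyMonotone N → ∀ J → 0ℤ ℤ.≤ N J
cm-≥0 (nonneg c)    []ᵥ            = c
cm-≥0 c@(split _ _) (outside ∷ᵥ J) = cm-≥0 (cm-outside c) J
cm-≥0 (split _ d)   (inside ∷ᵥ J)  = cm-≥0 d J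

-- Deletion and contraction of weighted sums

indicator : ℕ → Maybe ℕ → ℤ
indicator j nothing  = 0ℤ
indicator j (just k) = monomial k j

monomial-≡ : ∀ {k j} → k ≡ j → monomial k j ≡ 1ℤ
monomial-≡ {k} {j} p with k ℕ.≡ᵇ j in eq
... | true  = refl
... | false = contradiction (subst (_≡ false) (dec-true (k ℕₚ.≟ j) p) eq) λ ()

monomial-≢ : ∀ {k j} → k ≢ j → monomial k j ≡ 0ℤ
monomial-≢ {k} {j} p with k ℕ.≡ᵇ j in eq
... | false = refl
... | true  = contradiction (subst (_≡ true) (dec-false (k ℕₚ.≟ j) p) eq) λ ()

-- The exponent `j + r` has the parity of j - r, but unlike `j ∸ r` it keeps changing parity when
-- contractions push r past j.
weighted : ∀ {m} → ℕ → ℕ → (Subset m → Maybe ℕ) → (Subset m → ℤ) → ℤ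
weighted j r ρ N = -1ℤ ℤ.^ (j ℕ.+ r) ℤ.* alternating (λ J → indicator j (ρ J) ℤ.* N J)

whitney : ∀ {m} → ℕ → ℕ → (Subset m → Maybe ℕ) → ℤ
whitney j r ρ = weighted j r ρ (λ _ → 1ℤ)

-1^[n+n]≡1 : ∀ n → -1ℤ ℤ.^ (n ℕ.+ n) ≡ 1ℤ
-1^[n+n]≡1 zero    = refl
-1^[n+n]≡1 (suc n) = trans (cong (λ k → -1ℤ ℤ.* -1ℤ ℤ.^ k) (ℕₚ.+-suc n n))
  (trans (sym (ℤₚ.*-assoc -1ℤ -1ℤ (-1ℤ ℤ.^ (n ℕ.+ n)))) (trans (ℤₚ.*-identityˡ _) (-1^[n+n]≡1 n)))

-1^[j∸r]≡-1^[j+r] : ∀ {r j} → r ℕ.≤ j → -1ℤ ℤ.^ (j ℕ.∸ r) ≡ -1ℤ ℤ.^ (j ℕ.+ r)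
-1^[j∸r]≡-1^[j+r] {r} {j} r≤j = sym (begin
  -1ℤ ℤ.^ (j ℕ.+ r)                            ≡⟨ cong (λ k → -1ℤ ℤ.^ (k ℕ.+ r)) (sym (ℕₚ.m∸n+n≡m r≤j)) ⟩
  -1ℤ ℤ.^ (j ℕ.∸ r ℕ.+ r ℕ.+ r)                ≡⟨ cong (-1ℤ ℤ.^_) (ℕₚ.+-assoc (j ℕ.∸ r) r r) ⟩
  -1ℤ ℤ.^ (j ℕ.∸ r ℕ.+ (r ℕ.+ r))              ≡⟨ ℤₚ.^-distribˡ-+-* -1ℤ (j ℕ.∸ r) (r ℕ.+ r) ⟩
  -1ℤ ℤ.^ (j ℕ.∸ r) ℤ.* -1ℤ ℤ.^ (r ℕ.+ r)      ≡⟨ cong (-1ℤ ℤ.^ (j ℕ.∸ r) ℤ.*_) (-1^[n+n]≡1 r) ⟩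
  -1ℤ ℤ.^ (j ℕ.∸ r) ℤ.* 1ℤ                     ≡⟨ ℤₚ.*-identityʳ _ ⟩
  -1ℤ ℤ.^ (j ℕ.∸ r)                            ∎)
  where open ≡-Reasoning

module _ (j : ℕ) where

  weighted-parallel : ∀ {m r} {ρ : Subset (suc m) → Maybe ℕ} N → (∀ J → ρ (inside ∷ᵥ J) ≡ nothing) →
    weighted j r ρ N ≡ weighted j r (ρ ∘ (outside ∷ᵥ_)) (N ∘ (outside ∷ᵥ_))
  weighted-parallel {r = r} {ρ} N none = cong (-1ℤ ℤ.^ (j ℕ.+ r) ℤ.*_)
    (trans (cong (λ s → alternating (λ J → indicator j (ρ (outside ∷ᵥ J)) ℤ.* N (outside ∷ᵥ J)) ℤ.- s)
      (alternating-0 λ J → cong (λ z → indicator j z ℤ.* N (inside ∷ᵥ J)) (none J)))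
      (ℤₚ.+-identityʳ _))

  weighted-loop : ∀ {m r} {ρ : Subset (suc m) → Maybe ℕ} N → (∀ J → ρ (inside ∷ᵥ J) ≡ ρ (outside ∷ᵥ J)) →
    weighted j r ρ N ≡ weighted j r (ρ ∘ (outside ∷ᵥ_)) (λ J → N (outside ∷ᵥ J) ℤ.- N (inside ∷ᵥ J))
  weighted-loop {r = r} {ρ} N same = cong (-1ℤ ℤ.^ (j ℕ.+ r) ℤ.*_)
    (trans (alternating-− (λ J → indicator j (ρ (outside ∷ᵥ J)) ℤ.* N (outside ∷ᵥ J)) (λ J → indicator j (ρ (inside ∷ᵥ J)) ℤ.* N (inside ∷ᵥ J)))
      (alternating-cong λ J → trans
        (cong (λ z → indicator j (ρ (outside ∷ᵥ J)) ℤ.* N (outside ∷ᵥ J) ℤ.- indicator j z ℤ.* N (inside ∷ᵥ J)) (same J))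
        (factor (indicator j (ρ (outside ∷ᵥ J))) (N (outside ∷ᵥ J)) (N (inside ∷ᵥ J)))))
    where
    factor : ∀ i x y → i ℤ.* x ℤ.- i ℤ.* y ≡ i ℤ.* (x ℤ.- y)
    factor = solve-∀

  -- The minus sign of the sets containing the first hyperplane is absorbed by the passage from r to
  -- `suc r`. The two branches therefore add, which lets lower bounds pass through the induction.
  weighted-nonloop : ∀ {m r} {ρ : Subset (suc m) → Maybe ℕ} N →
    weighted j r ρ N ≡ weighted j r (ρ ∘ (outside ∷ᵥ_)) (N ∘ (outside ∷ᵥ_)) ℤ.+ weighted j (suc r) (ρ ∘ (inside ∷ᵥ_)) (N ∘ (inside ∷ᵥ_))
  weighted-nonloop {r = r} {ρ} N = trans
    (distrib (-1ℤ ℤ.^ (j ℕ.+ r)) (alternating (λ J → indicator j (ρ (outside ∷ᵥ J)) ℤ.* N (outside ∷ᵥ J))) _)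
    (cong (λ k → weighted j r (ρ ∘ (outside ∷ᵥ_)) (N ∘ (outside ∷ᵥ_)) ℤ.+ -1ℤ ℤ.^ k ℤ.* alternating (λ J → indicator j (ρ (inside ∷ᵥ J)) ℤ.* N (inside ∷ᵥ J))) (sym (ℕₚ.+-suc j r)))
    where
    distrib : ∀ z a b → z ℤ.* (a ℤ.- b) ≡ z ℤ.* a ℤ.+ (-1ℤ ℤ.* z) ℤ.* b
    distrib = solve-∀

  weighted-empty : ∀ {r} {ρ : Subset 0 → Maybe ℕ} N → ρ []ᵥ ≡ just r → weighted j r ρ N ≡ monomial r j ℤ.* N []ᵥ
  weighted-empty {r} {ρ} N eq with r ℕₚ.≟ j
  ... | yes refl = trans (cong (ℤ._* (indicator r (ρ []ᵥ) ℤ.* N []ᵥ)) (-1^[n+n]≡1 r))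
                     (trans (ℤₚ.*-identityˡ _) (cong (λ z → indicator r z ℤ.* N []ᵥ) eq))
  ... | no r≢j = trans (cong (λ z → -1ℤ ℤ.^ (j ℕ.+ r) ℤ.* (z ℤ.* N []ᵥ)) (trans (cong (indicator j) eq) (monomial-≢ r≢j)))
                   (trans (ℤₚ.*-zeroʳ (-1ℤ ℤ.^ (j ℕ.+ r))) (cong (ℤ._* N []ᵥ) (sym (monomial-≢ r≢j))))

  whitney-loop : ∀ {m r} {ρ : Subset (suc m) → Maybe ℕ} → (∀ J → ρ (inside ∷ᵥ J) ≡ ρ (outside ∷ᵥ J)) → whitney j r ρ ≡ 0ℤ
  whitney-loop {r = r} {ρ} same = trans (weighted-loop {ρ = ρ} (λ _ → 1ℤ) same)
    (trans (cong (-1ℤ ℤ.^ (j ℕ.+ r) ℤ.*_) (alternating-0 λ J → ℤₚ.*-zeroʳ (indicator j (ρ (outside ∷ᵥ J))))) (ℤₚ.*-zeroʳ (-1ℤ ℤ.^ (j ℕ.+ r))))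

  -- Deletion and contraction restrict the weight and a loop replaces it by its difference, so
  -- complete monotonicity persists down to the leaves. At a leaf of rank j the bound and the weight
  -- of a single set are compared.
  weighted-≥ : ∀ {m r} {ρ : Subset m → Maybe ℕ} {N} κ → Semimatroid r ρ → CompletelyMonotone N → 0ℤ ℤ.≤ κ →
    (∀ J → ρ J ≡ just j → κ ℤ.≤ N J) → κ ℤ.* whitney j r ρ ℤ.≤ weighted j r ρ N
  weighted-≥ {r = r} {ρ} {N} κ (empty eq) c 0≤κ κ≤N = subst₂ ℤ._≤_
    (cong (κ ℤ.*_) (sym (weighted-empty {ρ = ρ} (λ _ → 1ℤ) eq))) (sym (weighted-empty {ρ = ρ} N eq)) (go (r ℕₚ.≟ j))
    where
    go : Dec (r ≡ j) → κ ℤ.* (monomial r j ℤ.* 1ℤ) ℤ.≤ monomial r j ℤ.* N []ᵥ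
    go (yes r≡j) = subst₂ ℤ._≤_
      (trans (sym (ℤₚ.*-identityʳ κ)) (cong (λ z → κ ℤ.* (z ℤ.* 1ℤ)) (sym (monomial-≡ r≡j))))
      (trans (sym (ℤₚ.*-identityˡ _)) (cong (ℤ._* N []ᵥ) (sym (monomial-≡ r≡j))))
      (κ≤N []ᵥ (trans eq (cong just r≡j)))
    go (no r≢j) = ℤₚ.≤-reflexive (trans (cong (λ z → κ ℤ.* (z ℤ.* 1ℤ)) (monomial-≢ r≢j))
      (trans (ℤₚ.*-zeroʳ κ) (cong (ℤ._* N []ᵥ) (sym (monomial-≢ r≢j)))))
  weighted-≥ {ρ = ρ} {N} κ (parallel none S) c 0≤κ κ≤N = subst₂ ℤ._≤_
    (cong (κ ℤ.*_) (sym (weighted-parallel {ρ = ρ} (λ _ → 1ℤ) none))) (sym (weighted-parallel {ρ = ρ} N none))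
    (weighted-≥ κ S (cm-outside c) 0≤κ (λ J → κ≤N (outside ∷ᵥ J)))
  weighted-≥ {m} {r} {ρ} {N} κ (loop same S) (split c d) 0≤κ κ≤N = subst₂ ℤ._≤_
    (trans (sym (ℤₚ.*-zeroʳ κ)) (cong (κ ℤ.*_) (sym (whitney-loop {r = r} {ρ} same))))
    (sym (weighted-loop {ρ = ρ} N same))
    -- The unweighted sum is zero at a loop, so only nonnegativity is left. The differences may fall
    -- below κ, hence the restart with bound 0.
    (weighted-≥ 0ℤ S c ℤₚ.≤-refl λ J _ → cm-≥0 c J)
  weighted-≥ {ρ = ρ} {N} κ (nonloop S S′) c@(split _ d) 0≤κ κ≤N = subst₂ ℤ._≤_
    (trans (sym (ℤₚ.*-distribˡ-+ κ _ _)) (cong (κ ℤ.*_) (sym (weighted-nonloop {ρ = ρ} (λ _ → 1ℤ)))))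
    (sym (weighted-nonloop {ρ = ρ} N))
    (ℤₚ.+-mono-≤ (weighted-≥ κ S (cm-outside c) 0≤κ (λ J → κ≤N (outside ∷ᵥ J)))
                 (weighted-≥ κ S′ d 0≤κ (λ J → κ≤N (inside ∷ᵥ J))))

  -- The bound 0 for the constant weight 1, which comes from the multiset whose only member is the
  -- full set.
  whitney-≥0 : ∀ {m r} {ρ : Subset m → Maybe ℕ} → Semimatroid r ρ → 0ℤ ℤ.≤ whitney j r ρ
  whitney-≥0 {ρ = ρ} S = weighted-≥ 0ℤ S cm-1 ℤₚ.≤-refl (λ _ _ → ℤ.+≤+ ℕ.z≤n)
    where
    cm-1 : ∀ {m} → CompletelyMonotone {m} (λ _ → 1ℤ)
    cm-1 {zero}  = nonneg (ℤ.+≤+ ℕ.z≤n)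
    cm-1 {suc m} = split cm-0 cm-1

  -- Some branch of the deletion–contraction tree ends in rank j without meeting a loop.
  data Reaches : ∀ {m} → ℕ → (Subset m → Maybe ℕ) → Set where
    here     : {ρ : Subset 0 → Maybe ℕ} → ρ []ᵥ ≡ just j → Reaches j ρ
    deletion : ∀ {m r} {ρ : Subset (suc m) → Maybe ℕ} → Reaches r (ρ ∘ (outside ∷ᵥ_)) →
               Semimatroid (suc r) (ρ ∘ (inside ∷ᵥ_)) → Reaches r ρ
    contraction : ∀ {m r} {ρ : Subset (suc m) → Maybe ℕ} → Semimatroid r (ρ ∘ (outside ∷ᵥ_)) →
               Reaches (suc r) (ρ ∘ (inside ∷ᵥ_)) → Reaches r ρ

  whitney->0 : ∀ {m r} {ρ : Subset m → Maybe ℕ} → Reaches r ρ → 0ℤ ℤ.< whitney j r ρ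
  whitney->0 {ρ = ρ} (here eq) = subst (0ℤ ℤ.<_)
    (trans (cong (ℤ._* 1ℤ) (sym (monomial-≡ {j} refl))) (sym (weighted-empty {ρ = ρ} (λ _ → 1ℤ) eq))) (ℤ.+<+ (ℕ.s≤s ℕ.z≤n))
  whitney->0 {ρ = ρ} (deletion R S) = subst (0ℤ ℤ.<_) (sym (weighted-nonloop {ρ = ρ} (λ _ → 1ℤ))) (ℤₚ.+-mono-<-≤ (whitney->0 R) (whitney-≥0 S))
  whitney->0 {ρ = ρ} (contraction S R) = subst (0ℤ ℤ.<_) (sym (weighted-nonloop {ρ = ρ} (λ _ → 1ℤ))) (ℤₚ.+-mono-≤-< (whitney-≥0 S) (whitney->0 R))

-- Integer kernels and invariant factors

-- Coprimality of the entries, certified by Bézout coefficients rather than by a gcd.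
record Primitive {n} (w : Vector ℤ n) : Set where
  constructor _⟂_
  field
    dual  : Vector ℤ n
    dual· : ℤΣ (λ i → w i ℤ.* dual i) ≡ 1ℤ

primitive-∣ : ∀ {n} {w : Vector ℤ n} {g z : ℤ} → Primitive w → (∀ i → g ∣ z ℤ.* w i) → g ∣ z
primitive-∣ {n} {w} {g} {z} (w* ⟂ eq) div = subst (g ∣_) (begin
  ℤΣ (λ i → z ℤ.* w i ℤ.* w* i)      ≡⟨ ℤM.sum-cong {n} _ _ (λ i → ℤₚ.*-assoc z (w i) (w* i)) ⟩
  ℤΣ (λ i → z ℤ.* (w i ℤ.* w* i))    ≡⟨ sym (ℤM.sum-*ˡ {n} z (λ i → w i ℤ.* w* i)) ⟩
  z ℤ.* ℤΣ (λ i → w i ℤ.* w* i)      ≡⟨ cong (z ℤ.*_) eq ⟩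
  z ℤ.* 1ℤ                           ≡⟨ ℤₚ.*-identityʳ z ⟩
  z                                  ∎)
  (sum-∣ g _ λ i → ∣m⇒∣m*n (w* i) (div i))
  where open ≡-Reasoning

primitive-≢0 : ∀ {n} {w : Vector ℤ n} → Primitive w → ¬ (∀ i → w i ≡ 0ℤ)
primitive-≢0 {n} {w} (w* ⟂ eq) w≡0 with trans (sym eq) (ℤM.sum-0 {n} _ λ i → cong (ℤ._* w* i) (w≡0 i))
... | ()

·-∣ : ∀ {m n} g (M : Matrix m n) x → (∀ j → g ∣ x j) → ∀ i → g ∣ (M ·ℤ x) i
·-∣ g M x div i = sum-∣ g _ λ j → ∣n⇒∣m*n (M i j) (div j)

·-∣⁻¹ : ∀ {n} g {P : Matrix n n} → Invertible P → ∀ x → (∀ i → g ∣ (P ·ℤ x) i) → ∀ i → g ∣ x i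
·-∣⁻¹ g P-inv x div i = subst (g ∣_) (ℤM.cancelˡ P-inv x i) (·-∣ g (Invertible.inverse P-inv) _ div i)

diagonal-≢ : ∀ {m n} d {i : Fin m} {j : Fin n} → toℕ i ≢ toℕ j → diagonal d i j ≡ 0ℤ
diagonal-≢ d {i} {j} i≢j with toℕ i ℕ.≡ᵇ toℕ j in eq
... | false = refl
... | true  = contradiction (ℕₚ.≡ᵇ⇒≡ (toℕ i) (toℕ j) (subst T (sym eq) _)) i≢j

diagonal-≡ : ∀ {m n} d {i : Fin m} {j : Fin n} → toℕ i ≡ toℕ j → diagonal d i j ≡ + d (toℕ j)
diagonal-≡ d {zero}  {zero}  p = refl
diagonal-≡ d {suc i} {suc j} p = diagonal-≡ (d ∘ suc) {i} {j} (ℕₚ.suc-injective p)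

diagonal-· : ∀ {m n} d (y : Vector ℤ n) (i : Fin m) (j : Fin n) → toℕ i ≡ toℕ j → (diagonal d ·ℤ y) i ≡ + d (toℕ j) ℤ.* y j
diagonal-· {n = suc n} d y zero    zero    p = trans (cong (λ s → + d 0 ℤ.* y zero ℤ.+ s) (ℤM.sum-0 {n} _ λ _ → refl)) (ℤₚ.+-identityʳ _)
diagonal-· d y (suc i) (suc j) p = trans (ℤₚ.+-identityˡ _) (diagonal-· (d ∘ suc) (y ∘ suc) i j (ℕₚ.suc-injective p))

diagonal-∣ : ∀ {m n} g d (y : Vector ℤ n) → (∀ j → g ∣ + d (toℕ j) ℤ.* y j) → ∀ i → g ∣ (diagonal {m} d ·ℤ y) i
diagonal-∣ {m} g d y div i = sum-∣ g _ term
  where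
  term : ∀ j → g ∣ diagonal {m} d i j ℤ.* y j
  term j with toℕ i ℕₚ.≟ toℕ j
  ... | yes p = subst (λ z → g ∣ z ℤ.* y j) (sym (diagonal-≡ d p)) (div j)
  ... | no ¬p = subst (λ z → g ∣ z ℤ.* y j) (sym (diagonal-≢ {m} d ¬p)) (divides 0ℤ refl)

diagonal-ᵀ : ∀ {m n} d (i : Fin m) (j : Fin n) → diagonal d i j ≡ diagonal d j i
diagonal-ᵀ d i j with toℕ i ℕₚ.≟ toℕ j
... | yes p = trans (diagonal-≡ d p) (trans (cong (λ k → + d k) (sym p)) (sym (diagonal-≡ d (sym p))))
... | no ¬p = trans (diagonal-≢ d ¬p) (sym (diagonal-≢ d (¬p ∘ sym)))

identity-≡ : ∀ {n} (i : Fin n) → identity i i ≡ 1ℤ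
identity-≡ i = diagonal-≡ (λ _ → 1) {i} {i} refl

module _ {m n} {M : Matrix m n} (F : SmithForm M) where
  open SmithForm F
  open Invertible V-inv renaming (inverse to V⁻¹; inverseˡ to V⁻¹V; inverseʳ to VV⁻¹)

  smith-column : ∀ t i → (U ·ℤ M ·ℤ λ k → V k t) i ≡ diagonal d i t
  smith-column t i = trans (sym (⊗-assoc U M V i t)) (UMV i t)

  smith-rows : ∀ i j → (U ⊗ M) i j ≡ (diagonal d ⊗ V⁻¹) i j
  smith-rows i j = trans (sym (⊗-identityʳ (U ⊗ M) i j))
    (trans (⊗-assoc U M identity i j) (ℤM.Normalised.UM F (λ k → identity k j) i ∙ ⊗-cong {A = diagonal d} (λ _ _ → refl) (⊗-identityʳ V⁻¹) i j))
    where _∙_ = trans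

  d-mono : ∀ {i j} → i ℕ.≤ j → d i ∣ℕ d j
  d-mono i≤j = go (ℕₚ.≤⇒≤′ i≤j)
    where
    go : ∀ {i j} → i ℕ.≤′ j → d i ∣ℕ d j
    go ℕ.≤′-refl     = ℕ∣.∣-refl
    go (ℕ.≤′-step p) = ℕ∣.∣-trans (go p) (d-∣ _)

  d≡0⇒rk≤ : ∀ {k} → d k ≡ 0 → rk ℕ.≤ k
  d≡0⇒rk≤ {k} p = ℕₚ.≮⇒≥ λ k<rk → d≢0 k k<rk p

  column-primitive : ∀ t → Primitive (λ i → V i t)
  column-primitive t = V⁻¹ t ⟂ (trans (ℤM.sum-cong {n} _ _ λ i → ℤₚ.*-comm (V i t) (V⁻¹ t i)) (trans (V⁻¹V t t) (identity-≡ t)))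

  V-kernel : ∀ t → rk ℕ.≤ toℕ t → ∀ i → (M ·ℤ λ k → V k t) i ≡ 0ℤ
  V-kernel t rk≤t = ℤM.·-injective U-inv λ i → trans (smith-column t i) (trans (zero-entry i) (sym (ℤM.·-0 U i)))
    where
    zero-entry : ∀ i → diagonal d i t ≡ 0ℤ
    zero-entry i with toℕ i ℕₚ.≟ toℕ t
    ... | yes p = trans (diagonal-≡ d p) (cong +_ (d≡0 _ rk≤t))
    ... | no ¬p = diagonal-≢ d ¬p

  -- `d` and `rk` are unchanged, so kernels of the transpose give information about the invariant
  -- factors of M itself. This handles matrices that differ by a column.
  smithᵀ : SmithForm (M ᵀ)
  smithᵀ = record
    { U = V ᵀ ; V = U ᵀ ; U-inv = ᵀ-Invertible V-inv ; V-inv = ᵀ-Invertible U-inv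
    ; d = d ; d-∣ = d-∣ ; rk = rk ; rk≤m = rk≤n ; rk≤n = rk≤m ; d≢0 = d≢0 ; d≡0 = d≡0
    ; UMV = λ i j → trans (⊗-cong {B = U ᵀ} (λ i j → sym (⊗-ᵀ M V i j)) (λ _ _ → refl) i j)
        (trans (sym (⊗-ᵀ U (M ⊗ V) i j)) (trans (sym (⊗-assoc U M V j i)) (trans (UMV j i) (diagonal-ᵀ d j i))))
    }

opaque
 -- With k equations the rank is at most k, so the last of the k + 1 columns of V lies in the
 -- kernel; columns of an invertible matrix are primitive.
 kernelVector : ∀ {k} (A : Matrix k (suc k)) → ∃ λ w → Primitive w × (∀ i → (A ·ℤ w) i ≡ 0ℤ)
 kernelVector {k} A = _ , column-primitive (smith A) (fromℕ k) ,
   V-kernel (smith A) (fromℕ k) (subst (SmithForm.rk (smith A) ℕ.≤_) (sym (Finₚ.toℕ-fromℕ k)) (SmithForm.rk≤m (smith A)))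

*-monoˡ-∣ : ∀ {a b} z → a ∣ℕ b → + a ℤ.* z ∣ + b ℤ.* z
*-monoˡ-∣ {a} {b} z (ℕ∣.divides q eq) = divides (+ q) (trans (cong (ℤ._* z) (trans (cong +_ eq) (ℤₚ.pos-* q a))) (ℤₚ.*-assoc (+ q) (+ a) z))

module _ {m n k} {M : Matrix m n} (F : SmithForm M) (k≤m : k ℕ.≤ m) (k≤n : k ℕ.≤ n) where
  open SmithForm F

  -- On the span of the first k columns of V the matrix acts through d 0, ..., d (k - 1). The n × k
  -- matrix `diagonal (λ _ → 1)` is the inclusion of the first k coordinates.
  leading-V : ∀ (w : Vector ℤ k) i → (U ·ℤ M ·ℤ V ·ℤ diagonal (λ _ → 1) ·ℤ w) (inject≤ i k≤m) ≡ + d (toℕ i) ℤ.* w i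
  leading-V w i = begin
    (U ·ℤ M ·ℤ V ·ℤ first ·ℤ w) iₘ    ≡⟨ ℤM.Normalised.MV F (first ·ℤ w) iₘ ⟩
    (diagonal d ·ℤ first ·ℤ w) iₘ      ≡⟨ diagonal-· d (first ·ℤ w) iₘ iₙ (trans toℕₘ (sym toℕₙ)) ⟩
    + d (toℕ iₙ) ℤ.* (first ·ℤ w) iₙ   ≡⟨ cong₂ (λ u v → + d u ℤ.* v) toℕₙ (trans (diagonal-· (λ _ → 1) w iₙ i toℕₙ) (ℤₚ.*-identityˡ (w i))) ⟩
    + d (toℕ i) ℤ.* w i                ∎
    where
    open ≡-Reasoning
    first : Matrix n k
    first = diagonal (λ _ → 1)
    iₘ = inject≤ i k≤m
    iₙ = inject≤ i k≤n
    toℕₘ = Finₚ.toℕ-inject≤ i k≤m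
    toℕₙ = Finₚ.toℕ-inject≤ i k≤n

module _ {e n m k} {M : Matrix m n} (E : Matrix e n) (F : SmithForm M) (g : ℤ) (g∣d : g ∣ + SmithForm.d F k) where
  open SmithForm F
  open Invertible V-inv renaming (inverse to V⁻¹)

  private
    first : Matrix k n
    first = diagonal (λ _ → 1)

    K : Matrix (e ℕ.+ k) n
    K = E ++ (first ⊗ V⁻¹)

    dot-cong : ∀ {α β : Vector ℤ n} (x : Vector ℤ n) → α ≡ β → ℤΣ (λ j → α j ℤ.* x j) ≡ ℤΣ (λ j → β j ℤ.* x j)
    dot-cong x refl = refl

    K-E : ∀ x i → (K ·ℤ x) (i ↑ˡ k) ≡ (E ·ℤ x) i
    K-E x i = dot-cong x (lookup-++ˡ E (first ⊗ V⁻¹) i)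

    K-first : ∀ x i → (K ·ℤ x) (e ↑ʳ i) ≡ (first ·ℤ V⁻¹ ·ℤ x) i
    K-first x i = trans (dot-cong x (lookup-++ʳ E (first ⊗ V⁻¹) i)) (sym (ℤM.·-assoc first V⁻¹ x i))

    divisible : ∀ y → (∀ i → (first ·ℤ y) i ≡ 0ℤ) → ∀ j → g ∣ + d (toℕ j) ℤ.* y j
    divisible y y≡0 j with toℕ j ℕₚ.<? k
    ... | no j≮k  = ∣-trans (∣m⇒∣m*n (y j) g∣d) (*-monoˡ-∣ (y j) (d-mono F (ℕₚ.≮⇒≥ j≮k)))
    ... | yes j<k = subst (g ∣_) (sym (trans (cong (+ d (toℕ j) ℤ.*_) (trans (sym (trans (diagonal-· _ y (fromℕ< j<k) j (Finₚ.toℕ-fromℕ< j<k)) (ℤₚ.*-identityˡ (y j)))) (y≡0 (fromℕ< j<k)))) (ℤₚ.*-zeroʳ (+ d (toℕ j))))) (divides 0ℤ refl)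

    killed-∣ : ∀ x → (∀ i → (K ·ℤ x) i ≡ 0ℤ) → ∀ i → g ∣ (M ·ℤ x) i
    killed-∣ x Kx≡0 = ·-∣⁻¹ g U-inv (M ·ℤ x) λ i → subst (g ∣_) (sym (ℤM.Normalised.UM F x i))
      (diagonal-∣ g d (V⁻¹ ·ℤ x) (divisible (V⁻¹ ·ℤ x) λ i → trans (sym (K-first x i)) (Kx≡0 (e ↑ʳ i))) i)

  -- Modulo g only the first k rows of diagonal d survive, so a vector is
  -- killed by M modulo g as soon as it satisfies k integer equations.
  opaque
    kernelVectorMod : (X : Matrix n (suc (e ℕ.+ k))) →
      ∃ λ w → Primitive w × (∀ i → (E ·ℤ X ·ℤ w) i ≡ 0ℤ) × (∀ i → g ∣ (M ·ℤ X ·ℤ w) i)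
    kernelVectorMod X = conclude (kernelVector (K ⊗ X))
      where
      conclude : (∃ λ w → Primitive w × (∀ i → ((K ⊗ X) ·ℤ w) i ≡ 0ℤ)) →
        ∃ λ w → Primitive w × (∀ i → (E ·ℤ X ·ℤ w) i ≡ 0ℤ) × (∀ i → g ∣ (M ·ℤ X ·ℤ w) i)
      conclude (w , prim , KXw) = w , prim , (λ i → trans (sym (K-E (X ·ℤ w) i)) (killed (i ↑ˡ k))) , killed-∣ (X ·ℤ w) killed
        where
        killed : ∀ i → (K ·ℤ X ·ℤ w) i ≡ 0ℤ
        killed i = trans (ℤM.·-assoc K X w i) (KXw i)

  -- Inside the span of the first e + k + 1 columns of `G.V` there is a vector with primitive
  -- coordinates w that satisfies E and is killed by M modulo g, hence by N modulo g. There N acts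
  -- by d i * w i, so g divides d (e + k) * w i for every i, and primitivity removes w. Each row of
  -- E costs one index.
  invariantFactor-∣ : ∀ {l} {N : Matrix l n} (G : SmithForm N) →
    (∀ x → (∀ i → (E ·ℤ x) i ≡ 0ℤ) → (∀ i → g ∣ (M ·ℤ x) i) → ∀ i → g ∣ (N ·ℤ x) i) →
    g ∣ + SmithForm.d G (e ℕ.+ k)
  invariantFactor-∣ {l} {N} G inclusion with e ℕ.+ k ℕₚ.<? l | e ℕ.+ k ℕₚ.<? n
  ... | no ≮l | _ = subst (λ z → g ∣ + z) (sym (SmithForm.d≡0 G _ (ℕₚ.≤-trans (SmithForm.rk≤m G) (ℕₚ.≮⇒≥ ≮l)))) (divides 0ℤ refl)
  ... | yes _ | no ≮n = subst (λ z → g ∣ + z) (sym (SmithForm.d≡0 G _ (ℕₚ.≤-trans (SmithForm.rk≤n G) (ℕₚ.≮⇒≥ ≮n)))) (divides 0ℤ refl)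
  ... | yes <l | yes <n = conclude (kernelVectorMod X)
    where
    module G = SmithForm G
    leading : Matrix n (suc (e ℕ.+ k))
    leading = diagonal (λ _ → 1)
    X = G.V ⊗ leading
    conclude : (∃ λ w → Primitive w × (∀ i → (E ·ℤ X ·ℤ w) i ≡ 0ℤ) × (∀ i → g ∣ (M ·ℤ X ·ℤ w) i)) → g ∣ + G.d (e ℕ.+ k)
    conclude (w , prim , EXw , MXw) = primitive-∣ prim λ i → ∣-trans
      (subst (g ∣_) (trans (·-X i) (leading-V G <l <n w i)) (·-∣ g G.U (N ·ℤ X ·ℤ w) (inclusion (X ·ℤ w) EXw MXw) (inject≤ i <l)))
      (*-monoˡ-∣ (w i) (d-mono G (ℕₚ.≤-pred (Finₚ.toℕ<n i))))
      where
      ·-X : ∀ i → (G.U ·ℤ N ·ℤ X ·ℤ w) (inject≤ i <l) ≡ (G.U ·ℤ N ·ℤ G.V ·ℤ leading ·ℤ w) (inject≤ i <l)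
      ·-X i = ℤM.·-cong G.U (ℤM.·-cong N (λ j → sym (ℤM.·-assoc G.V leading w j))) (inject≤ i <l)

≡0⇒0∣ : ∀ {z} → z ≡ 0ℤ → 0ℤ ∣ z
≡0⇒0∣ refl = divides 0ℤ refl

-- Divisibility by 0 means vanishing, and `d` vanishes from index `rk` on; so g = 0 turns the
-- statement on invariant factors into one on ranks.
rk-≤ : ∀ {e l m n} (E : Matrix e n) {M : Matrix m n} {N : Matrix l n} (F : SmithForm M) (G : SmithForm N) →
  (∀ x → (∀ i → (E ·ℤ x) i ≡ 0ℤ) → (∀ i → (M ·ℤ x) i ≡ 0ℤ) → ∀ i → (N ·ℤ x) i ≡ 0ℤ) →
  SmithForm.rk G ℕ.≤ e ℕ.+ SmithForm.rk F
rk-≤ E F G inclusion = d≡0⇒rk≤ G (ℤₚ.+-injective (0∣⇒≡0 (invariantFactor-∣ E F 0ℤ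
  (≡0⇒0∣ (cong +_ (SmithForm.d≡0 F (SmithForm.rk F) ℕₚ.≤-refl))) G
  (λ x p q i → ≡0⇒0∣ (inclusion x p (λ i → 0∣⇒≡0 (q i)) i)))))

-- Join x to the first `rk` columns of V. If the rank of N were at most `rk`, some primitive
-- combination of these `rk + 1` vectors would be killed by N, hence by M. Applying M kills the
-- coefficients of the columns, since x contributes nothing; applying N then kills the coefficient
-- of x.
rk-< : ∀ {l m n} {M : Matrix m n} {N : Matrix l n} (F : SmithForm M) (G : SmithForm N) →
  (∀ x → (∀ i → (N ·ℤ x) i ≡ 0ℤ) → ∀ i → (M ·ℤ x) i ≡ 0ℤ) →
  ∀ x → (∀ i → (M ·ℤ x) i ≡ 0ℤ) → ∀ t → (N ·ℤ x) t ≢ 0ℤ → SmithForm.rk F ℕ.< SmithForm.rk G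
rk-< {m = m} {n} {M} {N} F G inclusion x Mx≡0 t Nx≢0 = ℕₚ.≰⇒> λ rkG≤rk →
  let w , prim , _ , 0∣NXw = kernelVectorMod {k = rk} (λ ()) G 0ℤ (≡0⇒0∣ (cong +_ (SmithForm.d≡0 G rk rkG≤rk))) X
  in impossible w prim 0∣NXw
  where
  open SmithForm F
  first : Matrix n rk
  first = diagonal (λ _ → 1)
  X : Matrix n (suc rk)
  X i zero    = x i
  X i (suc j) = (V ⊗ first) i j
  split-· : ∀ {l} (L : Matrix l n) w i → (L ·ℤ X ·ℤ w) i ≡ (L ·ℤ x) i ℤ.* w zero ℤ.+ (L ·ℤ V ·ℤ first ·ℤ (w ∘ suc)) i
  split-· L w i = trans (ℤM.·-assoc L X w i) (cong (λ s → (L ·ℤ x) i ℤ.* w zero ℤ.+ s)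
    (trans (sym (ℤM.·-assoc L (V ⊗ first) (w ∘ suc) i)) (ℤM.·-cong L (λ j → sym (ℤM.·-assoc V first (w ∘ suc) j)) i)))
  *-≢0 : ∀ {u v} → u ≢ 0ℤ → u ℤ.* v ≡ 0ℤ → v ≡ 0ℤ
  *-≢0 {u} u≢0 uv≡0 = [ (λ u≡0 → contradiction u≡0 u≢0) , id ] (ℤₚ.i*j≡0⇒i≡0∨j≡0 u uv≡0)
  impossible : ∀ w → Primitive w → ¬ (∀ i → 0ℤ ∣ (N ·ℤ X ·ℤ w) i)
  impossible w prim 0∣NXw = primitive-≢0 prim λ { zero → w₀≡0 ; (suc i) → w₊≡0 i }
    where
    MVw : ∀ i → (M ·ℤ V ·ℤ first ·ℤ (w ∘ suc)) i ≡ 0ℤ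
    MVw i = trans (sym (trans (cong (λ z → z ℤ.* w zero ℤ.+ (M ·ℤ V ·ℤ first ·ℤ (w ∘ suc)) i) (Mx≡0 i)) (ℤₚ.+-identityˡ _)))
      (trans (sym (split-· M w i)) (inclusion (X ·ℤ w) (λ i → 0∣⇒≡0 (0∣NXw i)) i))
    w₊≡0 : ∀ i → w (suc i) ≡ 0ℤ
    w₊≡0 i = *-≢0 {+ d (toℕ i)} (λ eq → d≢0 _ (Finₚ.toℕ<n i) (ℤₚ.+-injective eq))
      (trans (sym (leading-V F rk≤m rk≤n (w ∘ suc) i)) (trans (ℤM.·-cong U MVw _) (ℤM.·-0 U _)))
    NVw : ∀ i → (N ·ℤ V ·ℤ first ·ℤ (w ∘ suc)) i ≡ 0ℤ
    NVw i = trans (ℤM.·-cong N (λ j → trans (ℤM.·-cong V (λ k → trans (ℤM.·-cong first w₊≡0 k) (ℤM.·-0 first k)) j) (ℤM.·-0 V j)) i) (ℤM.·-0 N i)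
    w₀≡0 : w zero ≡ 0ℤ
    w₀≡0 = *-≢0 Nx≢0 (begin
      (N ·ℤ x) t ℤ.* w zero                                          ≡⟨ sym (ℤₚ.+-identityʳ _) ⟩
      (N ·ℤ x) t ℤ.* w zero ℤ.+ 0ℤ                                   ≡⟨ cong (λ s → (N ·ℤ x) t ℤ.* w zero ℤ.+ s) (sym (NVw t)) ⟩
      (N ·ℤ x) t ℤ.* w zero ℤ.+ (N ·ℤ V ·ℤ first ·ℤ (w ∘ suc)) t     ≡⟨ sym (split-· N w t) ⟩
      (N ·ℤ X ·ℤ w) t                                                ≡⟨ 0∣⇒≡0 (0∣NXw t) ⟩
      0ℤ                                                             ∎)
      where open ≡-Reasoning

-- Membership in the rational row space, with integer certificates on both sides: a kernel vector on
-- which α does not vanish, or a combination of rows with its denominator s cleared.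
data RowSpan {m n} (M : Matrix m n) (α : Vector ℤ n) : Set where
  independent : ∀ (x : Vector ℤ n) → (∀ i → (M ·ℤ x) i ≡ 0ℤ) → ℤΣ (λ j → α j ℤ.* x j) ≢ 0ℤ → RowSpan M α
  dependent   : ∀ s (y : Vector ℤ m) → s ≢ 0 → (∀ j → ℤΣ (λ i → y i ℤ.* M i j) ≡ + s ℤ.* α j) → RowSpan M α

opaque
  rowSpan? : ∀ {m n} {M : Matrix m n} → SmithForm M → ∀ α → RowSpan M α
  rowSpan? {m} {n} {M} F α = decide (Finₚ.all? vanishes?)
    where
    open ≡-Reasoning
    open SmithForm F
    open Invertible V-inv renaming (inverse to V⁻¹; inverseʳ to VV⁻¹)
    -- The coordinates of α with respect to V. The rational row space consists of the α whose
    -- coordinates from index `rk` on are zero.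
    β : Vector ℤ n
    β t = ℤΣ λ k → α k ℤ.* V k t
    vanishes? : ∀ t → Dec (rk ℕ.≤ toℕ t → β t ≡ 0ℤ)
    vanishes? t = (rk ℕₚ.≤? toℕ t) →-dec (β t ℤₚ.≟ 0ℤ)
    -- The last nonzero invariant factor is a multiple of all earlier ones; in rank zero the
    -- denominator is 1.
    commonMultiple : ∀ k → k ℕ.≤ rk → ∃ λ s → s ≢ 0 × ∀ i → i ℕ.< k → d i ∣ℕ s
    commonMultiple zero    _    = 1 , (λ ()) , λ _ ()
    commonMultiple (suc k) k<rk = d k , d≢0 k k<rk , λ { i (ℕ.s≤s i≤k) → d-mono F i≤k }
    multiple : (∀ t → rk ℕ.≤ toℕ t → β t ≡ 0ℤ) → ∀ s → (∀ i → i ℕ.< rk → d i ∣ℕ s) →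
      ∃ λ (y : Vector ℤ m) → ∀ j → ℤΣ (λ i → y i ℤ.* M i j) ≡ + s ℤ.* α j
    multiple p s d∣s = (Z ⊗ U) zero , λ j → begin
      ((Z ⊗ U) ⊗ M) zero j                ≡⟨ ⊗-assoc Z U M zero j ⟩
      (Z ⊗ (U ⊗ M)) zero j                ≡⟨ ⊗-cong {A = Z} (λ _ _ → refl) (smith-rows F) zero j ⟩
      (Z ⊗ (diagonal d ⊗ V⁻¹)) zero j     ≡⟨ sym (⊗-assoc Z (diagonal d) V⁻¹ zero j) ⟩
      (Z ⊗ diagonal d ⊗ V⁻¹) zero j       ≡⟨ ⊗-cong {A = Z ⊗ diagonal d} {A′ = S ⊗ V} {B = V⁻¹} (λ { zero → ZD }) (λ _ _ → refl) zero j ⟩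
      (S ⊗ V ⊗ V⁻¹) zero j                ≡⟨ ⊗-assoc S V V⁻¹ zero j ⟩
      (S ⊗ (V ⊗ V⁻¹)) zero j              ≡⟨ ⊗-cong {A = S} (λ _ _ → refl) VV⁻¹ zero j ⟩
      (S ⊗ identity) zero j               ≡⟨ ⊗-identityʳ S zero j ⟩
      + s ℤ.* α j                         ∎
      where
      S : Matrix 1 n
      S _ j = + s ℤ.* α j
      SV : ∀ t → (S ⊗ V) zero t ≡ + s ℤ.* β t
      SV t = trans (ℤM.sum-cong {n} _ _ λ k → ℤₚ.*-assoc (+ s) (α k) (V k t)) (sym (ℤM.sum-*ˡ {n} (+ s) (λ k → α k ℤ.* V k t)))
      -- Setting z i = (s / d i) * β i solves z * `diagonal d` = s * β. Since U M = `diagonal d`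
      -- V⁻¹, the vector z U then holds the coefficients of the rows of M.
      entry : ∀ i → Dec (toℕ {m} i ℕ.< rk) → ℤ
      entry i (yes i<rk) = + ℕ∣.quotient (d∣s (toℕ i) i<rk) ℤ.* β (fromℕ< (ℕₚ.<-≤-trans i<rk rk≤n))
      entry i (no _)     = 0ℤ
      z : Vector ℤ m
      z i = entry i (toℕ i ℕₚ.<? rk)
      Z : Matrix 1 m
      Z _ = z
      Z-diagonal : ∀ j → (Z ⊗ diagonal d) zero j ≡ (diagonal {n} {m} d ·ℤ z) j
      Z-diagonal j = ℤM.sum-cong {m} _ _ λ i → trans (ℤₚ.*-comm (z i) (diagonal d i j)) (cong (ℤ._* z i) (diagonal-ᵀ d i j))
      ZD : ∀ j → (Z ⊗ diagonal d) zero j ≡ (S ⊗ V) zero j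
      ZD j with toℕ j ℕₚ.<? rk
      ... | no j≮rk = trans (Z-diagonal j) (trans
              (0∣⇒≡0 (sum-∣ 0ℤ _ λ i → ∣m⇒∣m*n (z i) (≡0⇒0∣ (vanish i))))
              (sym (trans (SV j) (trans (cong (+ s ℤ.*_) (p j (ℕₚ.≮⇒≥ j≮rk))) (ℤₚ.*-zeroʳ (+ s))))))
        where
        vanish : ∀ i → diagonal {n} {m} d j i ≡ 0ℤ
        vanish i with toℕ j ℕₚ.≟ toℕ i
        ... | yes q = trans (diagonal-≡ d q) (cong +_ (d≡0 _ (subst (rk ℕ.≤_) q (ℕₚ.≮⇒≥ j≮rk))))
        ... | no ¬q = diagonal-≢ d ¬q
      ... | yes j<rk = begin
        (Z ⊗ diagonal d) zero j            ≡⟨ Z-diagonal j ⟩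
        (diagonal {n} {m} d ·ℤ z) j        ≡⟨ diagonal-· d z j i (sym toℕᵢ) ⟩
        + d (toℕ i) ℤ.* z i                ≡⟨ lemma (toℕ i ℕₚ.<? rk) ⟩
        + s ℤ.* β j                        ≡⟨ sym (SV j) ⟩
        (S ⊗ V) zero j                     ∎
        where
        i : Fin m
        i = fromℕ< (ℕₚ.<-≤-trans j<rk rk≤m)
        toℕᵢ : toℕ i ≡ toℕ j
        toℕᵢ = Finₚ.toℕ-fromℕ< (ℕₚ.<-≤-trans j<rk rk≤m)
        lemma : ∀ i? → + d (toℕ i) ℤ.* entry i i? ≡ + s ℤ.* β j
        lemma (no i≮rk) = contradiction (subst (ℕ._< rk) (sym toℕᵢ) j<rk) i≮rk
        lemma (yes i<rk) = trans (sym (ℤₚ.*-assoc (+ d (toℕ i)) (+ q) (β _))) (cong₂ ℤ._*_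
          (trans (sym (ℤₚ.pos-* (d (toℕ i)) q)) (cong +_ (trans (ℕₚ.*-comm (d (toℕ i)) q) (sym (ℕ∣._∣_.equality (d∣s (toℕ i) i<rk))))))
          (cong β (Finₚ.toℕ-injective (trans (Finₚ.toℕ-fromℕ< (ℕₚ.<-≤-trans i<rk rk≤n)) toℕᵢ))))
          where
          q : ℕ
          q = ℕ∣.quotient (d∣s (toℕ i) i<rk)
    decide : Dec (∀ t → rk ℕ.≤ toℕ t → β t ≡ 0ℤ) → RowSpan M α
    decide (yes p) = let s , s≢0 , d∣s = commonMultiple rk ℕₚ.≤-refl ; y , eq = multiple p s d∣s in dependent s y s≢0 eq
    decide (no ¬p) = let t , ¬pₜ = counterexample vanishes? ¬p in
      independent (λ k → V k t) (V-kernel F t (ℕₚ.≮⇒≥ λ t<rk → ¬pₜ λ rk≤t → contradiction rk≤t (ℕₚ.<⇒≱ t<rk))) (λ eq → ¬pₜ λ _ → eq)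

-- Dimension

module Combination (R : CommutativeRing 0ℓ 0ℓ) (ι : ℤ → CommutativeRing.Carrier R) (E : Embedding R ι) where
  open CommutativeRing R hiding (zero; refl) renaming (sym to ≈-sym; trans to ≈-trans)
  open SemiringSum semiring using (sum; sum-cong-≋; *-distribˡ-sum)
  open Embedding E
  open LinearAlgebra R ι
  open MatrixProperties R ι E
  open SetoidReasoning setoid

  combination-· : ∀ {m n} {M : Matrix m n} {α : Vector ℤ n} {s : ℕ} {y : Vector ℤ m} →
    (∀ j → ℤΣ (λ i → y i ℤ.* M i j) ≡ + s ℤ.* α j) →
    ∀ x → sum (λ i → ι (y i) * (M · x) i) ≈ ι (+ s) * sum (λ j → ι (α j) * x j)
  combination-· {n = n} {M} {α} {s} {y} eq x = begin
    ((λ (_ : Fin 1) → y) · M · x) zero                ≈⟨ ·-assoc (λ (_ : Fin 1) → y) M x zero ⟩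
    (((λ (_ : Fin 1) → y) ⊗ M) · x) zero              ≈⟨ ·-congˡ {1} x (λ _ → eq) zero ⟩
    sum (λ j → ι (+ s ℤ.* α j) * x j)                 ≈⟨ sum-cong-≋ {n} (λ j → ≈-trans (*-congʳ (ι-* (+ s) (α j))) (*-assoc _ _ _)) ⟩
    sum (λ j → ι (+ s) * (ι (α j) * x j))             ≈⟨ ≈-sym (*-distribˡ-sum {n} (ι (+ s)) _) ⟩
    ι (+ s) * sum (λ j → ι (α j) * x j)               ∎

  ·-* : ∀ {m n} (M : Matrix m n) z x i → (M · (λ j → z * x j)) i ≈ z * (M · x) i
  ·-* {n = n} M z x i = ≈-trans (sum-cong-≋ {n} λ j → x∙yz≈y∙xz _ _ _) (≈-sym (*-distribˡ-sum {n} z _))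
    where open CommutativeSemigroupProperties *-commutativeSemigroup using (x∙yz≈y∙xz)

-- Equality of Cauchy reals is undecidable, so elimination cannot look for a nonzero pivot. The
-- substitute is a ring without nilpotents, in which annihilation by products is enough.
module Dimension (R : CommutativeRing 0ℓ 0ℓ) (ι : ℤ → CommutativeRing.Carrier R) (E : FieldEmbedding R ι)
  (reduced : ∀ x → CommutativeRing._≈_ R (CommutativeRing._*_ R x x) (CommutativeRing.0# R) → CommutativeRing._≈_ R x (CommutativeRing.0# R)) where
  open CommutativeRing R hiding (zero; refl) renaming (sym to ≈-sym; trans to ≈-trans)
  open RingProperties ring using (-‿distribˡ-*; -1*x≈-x)
  open SemiringSum semiring using (sum; sum-cong-≋; ∑-comm; *-distribˡ-sum; *-distribʳ-sum)
  open FieldEmbedding E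
  open LinearAlgebra R ι
  open MatrixProperties R ι embedding
  open SetoidReasoning setoid

  private
    combine : ∀ {k} p c (A B q : Vector Carrier k) →
      sum (λ t → (p * A t + c * B t) * q t) ≈ p * sum (λ t → A t * q t) + c * sum (λ t → B t * q t)
    combine {k} p c A B q = begin
      sum (λ t → (p * A t + c * B t) * q t)
        ≈⟨ sum-cong-≋ {k} (λ t → ≈-trans (distribʳ (q t) _ _) (+-cong (*-assoc _ _ _) (*-assoc _ _ _))) ⟩
      sum (λ t → p * (A t * q t) + c * (B t * q t))
        ≈⟨ sum-+ {k} _ _ ⟩
      sum (λ t → p * (A t * q t)) + sum (λ t → c * (B t * q t))
        ≈⟨ +-cong (≈-sym (*-distribˡ-sum {k} p _)) (≈-sym (*-distribˡ-sum {k} c _)) ⟩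
      p * sum (λ t → A t * q t) + c * sum (λ t → B t * q t) ∎

  -- Eliminating with the entries of the first column of P shows that e
  -- annihilates that column; then e P has one column less.
  scalar-factorisation : ∀ k (P : Fin (suc k) → Fin k → Carrier) (Q : Fin k → Fin (suc k) → Carrier) e →
    (∀ i → sum (λ t → P i t * Q t i) ≈ e) → (∀ i j → i ≢ j → sum (λ t → P i t * Q t j) ≈ 0#) → e ≈ 0#
  scalar-factorisation zero    P Q e on off = ≈-sym (on zero)
  -- After scaling by e the first column drops out, but the scalar of the smaller product is e * e;
  -- `reduced` returns to e.
  scalar-factorisation (suc k) P Q e on off = reduced e (scalar-factorisation k
    (λ a t → e * P (suc a) (suc t)) (λ t b → Q (suc t) (suc b)) (e * e)
    (λ a → ≈-trans (drop a a) (*-congˡ (on (suc a))))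
    (λ a b a≢b → ≈-trans (drop a b) (≈-trans (*-congˡ (off (suc a) (suc b) λ eq → a≢b (Finₚ.suc-injective eq))) (zeroʳ e))))
    where
    column : ∀ i → P i zero * e ≈ 0#
    column i = scalar-factorisation k (λ a t → full a (suc t)) (λ t b → Q (suc t) (punchIn i b)) (P i zero * e)
      (λ a → ≈-trans (product a a) (≈-trans (+-cong (*-congˡ (on (punchIn i a))) (zero-term a a)) (+-identityʳ _)))
      (λ a b a≢b → ≈-trans (product a b) (≈-trans (+-cong
        (≈-trans (*-congˡ (off _ _ λ eq → a≢b (Finₚ.punchIn-injective i a b eq))) (zeroʳ _)) (zero-term a b)) (+-identityʳ _)))
      where
      -- Fraction-free elimination: the combination clears column zero without inverting an entry.
      -- The row subtracted from the others contributes nothing to the product, because row i of P Q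
      -- is zero away from column i.
      full : Fin (suc k) → Fin (suc k) → Carrier
      full a t = P i zero * P (punchIn i a) t + - P (punchIn i a) zero * P i t
      zero-term : ∀ a b → - P (punchIn i a) zero * sum (λ t → P i t * Q t (punchIn i b)) ≈ 0#
      zero-term a b = ≈-trans (*-congˡ (off i (punchIn i b) λ eq → Finₚ.punchInᵢ≢i i b (sym eq))) (zeroʳ _)
      head : ∀ a → full a zero ≈ 0#
      head a = ≈-trans (+-cong (*-comm _ _) (≈-sym (-‿distribˡ-* _ _))) (-‿inverseʳ _)
      product : ∀ a b → sum (λ t → full a (suc t) * Q (suc t) (punchIn i b)) ≈
        P i zero * sum (λ t → P (punchIn i a) t * Q t (punchIn i b)) + - P (punchIn i a) zero * sum (λ t → P i t * Q t (punchIn i b))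
      product a b = ≈-trans (≈-sym (≈-trans (+-congʳ (≈-trans (*-congʳ (head a)) (zeroˡ _))) (+-identityˡ _)))
        (combine (P i zero) (- P (punchIn i a) zero) (P (punchIn i a)) (P i) (λ t → Q t (punchIn i b)))
    drop : ∀ a b → sum (λ t → e * P (suc a) (suc t) * Q (suc t) (suc b)) ≈ e * sum (λ t → P (suc a) t * Q t (suc b))
    drop a b = ≈-sym (begin
      e * (P (suc a) zero * Q zero (suc b) + sum (λ t → P (suc a) (suc t) * Q (suc t) (suc b)))
        ≈⟨ distribˡ _ _ _ ⟩
      e * (P (suc a) zero * Q zero (suc b)) + e * sum (λ t → P (suc a) (suc t) * Q (suc t) (suc b))
        ≈⟨ +-cong (≈-trans (≈-sym (*-assoc _ _ _)) (≈-trans (*-congʳ (≈-trans (*-comm _ _) (column (suc a)))) (zeroˡ _)))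
             (≈-trans (*-distribˡ-sum {k} e _) (sum-cong-≋ {k} λ t → ≈-sym (*-assoc _ _ _))) ⟩
      0# + sum (λ t → e * P (suc a) (suc t) * Q (suc t) (suc b))
        ≈⟨ +-identityˡ _ ⟩
      sum (λ t → e * P (suc a) (suc t) * Q (suc t) (suc b)) ∎)

  module _ {n} {W W′ : Vector Carrier n → Set} (W⇒W′ : ∀ x → W x → W′ x) (W′⇒W : ∀ x → W′ x → W x)
    {k k′} {v : Vector (Vector Carrier n) k} {w : Vector (Vector Carrier n) k′} (v-basis : IsBasis W v) (w-basis : IsBasis W′ w) where

    -- Expressing each basis in the other factors the identity of size k through k′ coordinates. A
    -- block of size `suc k′` of it is a scalar factorisation with scalar 1.
    basis-size : k′ ℕ.< k → 1# ≈ 0#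
    basis-size k′<k = scalar-factorisation k′ (λ i → P (inj i)) (λ t j → Q t (inj j)) 1#
      (λ i → ≈-trans (PQ (inj i) (inj i)) (≈-trans (reflexive (cong ι (identity-≡ (inj i)))) ι-1))
      (λ i j i≢j → ≈-trans (PQ (inj i) (inj j)) (≈-trans (reflexive (cong ι (diagonal-≢ (λ _ → 1) {inj i} {inj j} (distinct i≢j)))) ι-0))
      where
      inj : Fin (suc k′) → Fin k
      inj i = inject≤ i k′<k
      distinct : ∀ {i j} → i ≢ j → toℕ (inj i) ≢ toℕ (inj j)
      distinct {i} {j} i≢j eq = i≢j (Finₚ.toℕ-injective (trans (sym (Finₚ.toℕ-inject≤ i k′<k)) (trans eq (Finₚ.toℕ-inject≤ j k′<k))))
      unit : ∀ {k} → Fin k → Vector Carrier k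
      unit i j = ι (identity i j)
      member : ∀ {k} {v : Vector (Vector Carrier n) k} {W} → IsBasis W v → ∀ i → W (v i)
      member {v = v} (_ , span) i = Equivalence.from (span (v i)) (unit i , λ t → ≈-sym (identity-· (λ k → v k t) i))
      P-spec : ∀ i → ∃ λ c → ∀ t → v i t ≈ combination c w t
      P-spec i = Equivalence.to (proj₂ w-basis (v i)) (W⇒W′ (v i) (member v-basis i))
      Q-spec : ∀ i → ∃ λ c → ∀ t → w i t ≈ combination c v t
      Q-spec i = Equivalence.to (proj₂ v-basis (w i)) (W′⇒W (w i) (member w-basis i))
      P : Fin k → Fin k′ → Carrier
      P i = proj₁ (P-spec i)
      Q : Fin k′ → Fin k → Carrier
      Q i = proj₁ (Q-spec i)
      PQ : ∀ i j → sum (λ t → P i t * Q t j) ≈ ι (identity i j)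
      PQ i j = begin
        sum (λ t → P i t * Q t j)                              ≈⟨ ≈-sym (+-identityʳ _) ⟩
        sum (λ t → P i t * Q t j) + 0#                         ≈⟨ +-congˡ (≈-sym (-‿inverseˡ (unit i j))) ⟩
        sum (λ t → P i t * Q t j) + (- unit i j + unit i j)    ≈⟨ ≈-sym (+-assoc _ _ _) ⟩
        sum (λ t → P i t * Q t j) + - unit i j + unit i j      ≈⟨ +-congʳ (≈-trans (+-congˡ (≈-sym (-1*x≈-x _))) (proj₁ v-basis difference vanishes j)) ⟩
        0# + unit i j                                          ≈⟨ +-identityˡ _ ⟩
        unit i j                                               ∎
        where
        difference : Vector Carrier k
        difference j = sum (λ t → P i t * Q t j) + - 1# * unit i j
        vanishes : ∀ t → combination difference v t ≈ 0#
        vanishes t = begin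
          sum (λ j → (sum (λ u → P i u * Q u j) + - 1# * unit i j) * v j t)
            ≈⟨ sum-cong-≋ {k} (λ j → *-congʳ (+-congʳ (≈-sym (*-identityˡ _)))) ⟩
          sum (λ j → (1# * sum (λ u → P i u * Q u j) + - 1# * unit i j) * v j t)
            ≈⟨ combine {k} 1# (- 1#) (λ j → sum (λ u → P i u * Q u j)) (unit i) (λ j → v j t) ⟩
          1# * sum (λ j → sum (λ u → P i u * Q u j) * v j t) + - 1# * sum (λ j → unit i j * v j t)
            ≈⟨ +-cong (≈-trans (*-identityˡ _) expand) (≈-trans (-1*x≈-x _) (-‿cong (identity-· (λ j → v j t) i))) ⟩
          v i t - v i t
            ≈⟨ -‿inverseʳ _ ⟩
          0# ∎
          where
          expand : sum (λ j → sum (λ u → P i u * Q u j) * v j t) ≈ v i t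
          expand = begin
            sum (λ j → sum (λ u → P i u * Q u j) * v j t)
              ≈⟨ sum-cong-≋ {k} (λ j → *-distribʳ-sum {k′} (v j t) _) ⟩
            sum (λ j → sum (λ u → P i u * Q u j * v j t))
              ≈⟨ ∑-comm {k} {k′} _ ⟩
            sum (λ u → sum (λ j → P i u * Q u j * v j t))
              ≈⟨ sum-cong-≋ {k′} (λ u → ≈-trans (sum-cong-≋ {k} λ j → *-assoc _ _ _) (≈-sym (*-distribˡ-sum {k} (P i u) _))) ⟩
            sum (λ u → P i u * sum (λ j → Q u j * v j t))
              ≈⟨ sum-cong-≋ {k′} (λ u → *-congˡ (≈-sym (proj₂ (Q-spec u) t))) ⟩
            sum (λ u → P i u * w u t)
              ≈⟨ ≈-sym (proj₂ (P-spec i) t) ⟩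
            v i t ∎

  Kernel : ∀ {m n} → Matrix m n → Vector Carrier n → Set
  Kernel M x = ∀ i → (M · x) i ≈ 0#

  private
    kernelBasis : ∀ r a b {M : Matrix (r ℕ.+ a) (r ℕ.+ b)} (F : SmithForm M) → SmithForm.rk F ≡ r →
      ∃ λ (v : Vector (Vector Carrier (r ℕ.+ b)) b) → IsBasis (Kernel M) v
    kernelBasis r a b {M} F rk≡r = C.basis , C.isBasis
      where
      open SmithForm F
      open Invertible V-inv using () renaming (inverse to V⁻¹)
      open Normalised F
      open LastCoordinates r b
      open SolutionSpaces R ι E using (D-kernel; D-kernel⁻¹)
      to : ∀ x → Kernel M x → Z (V⁻¹ · x)
      to x w = D-kernel r a b F rk≡r _ λ i → ≈-trans (≈-sym (UM x i)) (≈-trans (·-cong U w i) (·-0 U i))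
      from : ∀ x → Z (V⁻¹ · x) → Kernel M x
      from x z = ·-injective U-inv λ i → ≈-trans (UM x i) (≈-trans (D-kernel⁻¹ r a b F rk≡r _ z i) (≈-sym (·-0 U i)))
      module C = CoordinateSubspace place extend extend-place extend-sum Z Z-extend Z-cong extend-Z V-inv (Kernel M) to from

  -- The Smith form yields one basis of the kernel, of size n - rk. Sizes are natural numbers, so
  -- excluding both strict inequalities gives equality for any other basis.
  dimension-kernel : 1# ≉ 0# → ∀ {m n} {M : Matrix m n} (F : SmithForm M) {k} {v : Vector (Vector Carrier n) k} →
    IsBasis (Kernel M) v → SmithForm.rk F ℕ.+ k ≡ n
  dimension-kernel 1≉0 F = go F refl _ _ (proj₂ (ℕₚ.m≤n⇒∃[o]m+o≡n (SmithForm.rk≤m F))) (proj₂ (ℕₚ.m≤n⇒∃[o]m+o≡n (SmithForm.rk≤n F)))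
    where
    go : ∀ {m n} {M : Matrix m n} (F : SmithForm M) {r} → SmithForm.rk F ≡ r → ∀ a b → r ℕ.+ a ≡ m → r ℕ.+ b ≡ n →
      ∀ {k} {v : Vector (Vector Carrier n) k} → IsBasis (Kernel M) v → SmithForm.rk F ℕ.+ k ≡ n
    go F {r} rk≡r a b refl refl {k} v-basis = cong₂ ℕ._+_ rk≡r (ℕₚ.≤-antisym
      (ℕₚ.≮⇒≥ λ b<k → 1≉0 (basis-size (λ _ → id) (λ _ → id) v-basis w-basis b<k))
      (ℕₚ.≮⇒≥ λ k<b → 1≉0 (basis-size (λ _ → id) (λ _ → id) w-basis v-basis k<b)))
      where w-basis = proj₂ (kernelBasis r a b F rk≡r)

  -- Translation by the given point p turns the solution set into the kernel, whatever point is
  -- chosen.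
  dimension-solution : 1# ≉ 0# → ∀ {m n} {M : Matrix m n} {c} {S : Vector Carrier n → Set} (F : SmithForm M) →
    (∀ x → S x ⇔ Solution M c x) → ∀ {k} → HasDimension S k → SmithForm.rk F ℕ.+ k ≡ n
  dimension-solution 1≉0 {M = M} {c} {S} F S⇔ {k} (p , Sp , v , linind , span) =
    dimension-kernel 1≉0 F {v = v} (linind , λ x → mk⇔
      (λ Mx≈0 → Equivalence.to (span x) (Equivalence.from (S⇔ _) λ i → ≈-trans (·-+ M p x i) (≈-trans (+-cong (Mp i) (Mx≈0 i)) (+-identityʳ _))))
      (λ z i → cancel i (Equivalence.to (S⇔ _) (Equivalence.from (span x) z) i)))
    where
    Mp = Equivalence.to (S⇔ p) Sp
    cancel : ∀ {x} i → (M · (λ j → p j + x j)) i ≈ ι (c i) → (M · x) i ≈ 0#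
    cancel {x} i eq = begin
      (M · x) i                            ≈⟨ ≈-sym (+-identityˡ _) ⟩
      0# + (M · x) i                       ≈⟨ +-congʳ (≈-sym (-‿inverseˡ (ι (c i)))) ⟩
      - ι (c i) + ι (c i) + (M · x) i      ≈⟨ +-assoc _ _ _ ⟩
      - ι (c i) + (ι (c i) + (M · x) i)    ≈⟨ +-congˡ (≈-trans (+-congʳ (≈-sym (Mp i))) (≈-trans (≈-sym (·-+ M p x i)) eq)) ⟩
      - ι (c i) + ι (c i)                  ≈⟨ -‿inverseˡ _ ⟩
      0#                                   ∎

  module _ {s} (s≢0 : s ≢ 0) where
    s⁻¹ : Carrier
    s⁻¹ = proj₁ (ι-inverse s s≢0)

    s⁻¹*s : ∀ z → s⁻¹ * (ι (+ s) * z) ≈ z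
    s⁻¹*s z = ≈-trans (≈-sym (*-assoc _ _ _)) (≈-trans (*-congʳ (≈-trans (*-comm _ _) (proj₂ (ι-inverse s s≢0)))) (*-identityˡ z))

    ι-cancel : ∀ {x y} → ι (+ s) * x ≈ ι (+ s) * y → x ≈ y
    ι-cancel {x} {y} eq = ≈-trans (≈-sym (s⁻¹*s x)) (≈-trans (*-congˡ eq) (s⁻¹*s y))

  ι-injective₂ : ∀ {a b} → ι a ≈ ι b → a ≡ b
  ι-injective₂ {a} {b} eq = ℤₚ.i-j≡0⇒i≡j a b (ι-injective _ (begin
    ι (a ℤ.- b)             ≈⟨ ι-+ a (ℤ.- b) ⟩
    ι a + ι (ℤ.- b)         ≈⟨ +-congʳ eq ⟩
    ι b + ι (ℤ.- b)         ≈⟨ ≈-sym (ι-+ b (ℤ.- b)) ⟩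
    ι (b ℤ.- b)             ≡⟨ cong ι (ℤₚ.+-inverseʳ b) ⟩
    ι 0ℤ                    ≈⟨ ι-0 ⟩
    0#                      ∎))

module ℤ-Combination = Combination ℤₚ.+-*-commutativeRing id ℤ-embedding
module ℝ-Combination = Combination ℝ-ring fromℤℝ (FieldEmbedding.embedding ℝ-fieldEmbedding)
module ℝM = MatrixProperties ℝ-ring fromℤℝ (FieldEmbedding.embedding ℝ-fieldEmbedding)

ℝ-reduced : ∀ x → x *ℝ x ≈ℝ fromℚ 0ℚ → x ≈ℝ fromℚ 0ℚ
ℝ-reduced x xx≈0 = mk≈ λ ε ε>0 →
  let instance _ = ℚ.positive ε>0
      N , h = close xx≈0 (ε ℚ.* ε) (ℚₚ.positive⁻¹ (ε ℚ.* ε) {{ℚₚ.pos*pos⇒pos ε ε}})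
  in N , λ i N≤i → subst (λ z → ℚ.∣ z ∣ ℚ.< ε) (sym (ℚₚ.+-identityʳ (seq x i)))
    (root (seq x i) ε ε>0 (subst (λ z → ℚ.∣ z ∣ ℚ.< ε ℚ.* ε) (ℚₚ.+-identityʳ (seq x i ℚ.* seq x i)) (h i N≤i)))
  where
  root : ∀ z ε → 0ℚ ℚ.< ε → ℚ.∣ z ℚ.* z ∣ ℚ.< ε ℚ.* ε → ℚ.∣ z ∣ ℚ.< ε
  root z ε ε>0 zz<εε = ℚₚ.≰⇒> λ ε≤z → ℚₚ.<-irrefl refl (ℚₚ.<-≤-trans zz<εε (ℚₚ.≤-trans
    (ℚₚ.*-monoˡ-≤-nonNeg ε {{ℚ.nonNegative (ℚₚ.<⇒≤ ε>0)}} ε≤z)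
    (ℚₚ.≤-trans (ℚₚ.*-monoʳ-≤-nonNeg ℚ.∣ z ∣ {{ℚₚ.∣-∣-nonNeg z}} ε≤z) (ℚₚ.≤-reflexive (sym (ℚₚ.∣p*q∣≡∣p∣*∣q∣ z z))))))

module ℝ-Dimension = Dimension ℝ-ring fromℤℝ ℝ-fieldEmbedding ℝ-reduced

1≉0 : ¬ fromℚ 1ℚ ≈ℝ fromℚ 0ℚ
1≉0 eq with fromℚ-injective eq
... | ()

open Equivalence using (to; from)
open SemiringSum (CommutativeRing.semiring ℝ-ring) using () renaming (sum to ℝΣ)
open ℝ-Space using (_·_; Solution; HasDimension)
open FieldEmbedding ℝ-fieldEmbedding using (ι-*; ι-0; ι-1; ι-injective; ι-inverse)

module ℝR = CommutativeRing ℝ-ring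

-- Flats

↑-elim : ∀ m {n} (P : Fin (m ℕ.+ n) → Set) → (∀ k → P (k ↑ˡ n)) → (∀ k → P (m ↑ʳ k)) → ∀ j → P j
↑-elim m P left right j with splitAt m j in eq
... | inj₁ k = subst P (Finₚ.splitAt⁻¹-↑ˡ eq) (left k)
... | inj₂ k = subst P (Finₚ.splitAt⁻¹-↑ʳ eq) (right k)

Kernelℤ : ∀ {m n} → Matrix m n → Vector ℤ n → Set
Kernelℤ M x = ∀ i → (M ·ℤ x) i ≡ 0ℤ

rank-≤ : ∀ {l m n} {M : Matrix m n} {N : Matrix l n} → (∀ x → Kernelℤ M x → Kernelℤ N x) → rank N ℕ.≤ rank M
rank-≤ {M = M} {N} inclusion = rk-≤ {0} (λ ()) (smith M) (smith N) (λ x _ → inclusion x)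

rank-∷ : ∀ {m n} (M : Matrix m n) α x → Kernelℤ M x → ℤΣ (λ j → α j ℤ.* x j) ≢ 0ℤ → rank (α ∷ᶠ M) ≡ suc (rank M)
rank-∷ M α x Mx≡0 αx≢0 = ℕₚ.≤-antisym
  (rk-≤ {1} (λ _ → α) (smith M) (smith (α ∷ᶠ M)) λ { x αx Mx zero → αx zero ; x αx Mx (suc i) → Mx i })
  (rk-< (smith M) (smith (α ∷ᶠ M)) (λ x Nx i → Nx (suc i)) x Mx≡0 zero αx≢0)

dependent-kernel : ∀ {l n} (B : Matrix l n) (α : Vector ℤ n) {s} (y : Vector ℤ l) → s ≢ 0 → (∀ j → ℤΣ (λ i → y i ℤ.* B i j) ≡ + s ℤ.* α j) →
  ∀ x → Kernelℤ B x → ℤΣ (λ j → α j ℤ.* x j) ≡ 0ℤ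
dependent-kernel {l} B α {s} y s≢0 eq x Bx≡0 =
  [ (λ p → contradiction (ℤₚ.+-injective p) s≢0) , id ] (ℤₚ.i*j≡0⇒i≡0∨j≡0 (+ s)
    (trans (sym (ℤ-Combination.combination-· {M = B} {α = α} {s = s} {y = y} eq x))
      (ℤM.sum-0 {l} _ λ i → trans (cong (y i ℤ.*_) (Bx≡0 i)) (ℤₚ.*-zeroʳ (y i)))))

-- Solvability over the reals

augment : ∀ {m n} → Matrix m n → Vector ℤ m → Matrix m (n ℕ.+ 1)
augment M c i = M i ++ λ (_ : Fin 1) → c i

augmentᵀ-head : ∀ {m n} (M : Matrix m n) c x j → (((augment M c) ᵀ) ·ℤ x) (j ↑ˡ 1) ≡ ((M ᵀ) ·ℤ x) j
augmentᵀ-head {m} M c x j = ℤM.sum-cong {m} _ _ λ i → cong (ℤ._* x i) (lookup-++ˡ (M i) (λ _ → c i) j)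

augmentᵀ-last : ∀ {m n} (M : Matrix m n) c x j → (((augment M c) ᵀ) ·ℤ x) (n ↑ʳ j) ≡ ℤΣ (λ i → c i ℤ.* x i)
augmentᵀ-last {m} M c x j = ℤM.sum-cong {m} _ _ λ i → cong (ℤ._* x i) (lookup-++ʳ (M i) (λ _ → c i) j)

data Solvability {m n} (M : Matrix m n) (c : Vector ℤ m) : Set where
  solvable   : rank (augment M c) ≡ rank M → ∃ (Solution M c) → Solvability M c
  unsolvable : rank (augment M c) ≢ rank M → (∀ x → ¬ Solution M c x) → Solvability M c

-- The Rouché-Capelli criterion, read off from the rows of the transpose. A left kernel vector that
-- does not annihilate c raises the rank and refutes every real solution; otherwise M y = s * c, and
-- y divided by s is a solution.
solvability : ∀ {m n} (M : Matrix m n) c → Solvability M c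
solvability {m} {n} M c = decide (rowSpan? (smithᵀ (smith M)) c)
  where
  M̄ = augment M c
  narrow : ∀ x → Kernelℤ (M̄ ᵀ) x → Kernelℤ (M ᵀ) x
  narrow x M̄x≡0 j = trans (sym (augmentᵀ-head M c x j)) (M̄x≡0 (j ↑ˡ 1))
  decide : RowSpan (M ᵀ) c → Solvability M c
  decide (independent x Mᵀx≡0 cx≢0) = unsolvable
    (λ eq → ℕₚ.<⇒≢ (rk-< (smithᵀ (smith M)) (smithᵀ (smith M̄)) narrow x Mᵀx≡0 (n ↑ʳ zero) (λ eq → cx≢0 (trans (sym (augmentᵀ-last M c x zero)) eq))) (sym eq))
    (λ p Mp≈c → cx≢0 (ι-injective _ (begin
      fromℤℝ (ℤΣ λ i → c i ℤ.* x i)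
        ≈⟨ ℝM.ι-sum (λ i → c i ℤ.* x i) ⟩
      ℝΣ (λ i → fromℤℝ (c i ℤ.* x i))
        ≈⟨ ℝM.sum-cong {m} _ _ (λ i → ℝR.trans (ι-* (c i) (x i)) (ℝR.trans (ℝR.*-comm _ _) (ℝR.*-congˡ (ℝR.sym (Mp≈c i))))) ⟩
      -- The relation that x annihilates M is used as a row combination with α = 0 and s = 1.
      ℝΣ (λ i → fromℤℝ (x i) *ℝ (M · p) i)
        ≈⟨ ℝ-Combination.combination-· {M = M} {α = λ _ → 0ℤ} {s = 1} {y = x}
             (λ j → trans (ℤM.sum-cong {m} _ _ (λ i → ℤₚ.*-comm (x i) (M i j))) (Mᵀx≡0 j)) p ⟩
      fromℤℝ 1ℤ *ℝ ℝΣ (λ j → fromℤℝ 0ℤ *ℝ p j)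
        ≈⟨ ℝR.trans (ℝR.*-congˡ (ℝM.sum-0 {n} _ λ j → ℝM.ι0*≈0 (p j))) (ℝR.zeroʳ _) ⟩
      fromℚ _ ∎)))
    where open SetoidReasoning ℝR.setoid
  decide (dependent s y s≢0 eq) = solvable
    (ℕₚ.≤-antisym (rk-≤ {0} (λ ()) (smithᵀ (smith M)) (smithᵀ (smith M̄)) (λ x _ → widen x))
                  (rk-≤ {0} (λ ()) (smithᵀ (smith M̄)) (smithᵀ (smith M)) (λ x _ → narrow x)))
    ((λ i → s⁻¹ *ℝ fromℤℝ (y i)) , λ j → ℝR.trans (ℝ-Combination.·-* M s⁻¹ (fromℤℝ ∘ y) j)
      (ℝR.trans (ℝR.*-congˡ {s⁻¹} (ℝR.trans (ℝR.sym (ℝM.ι-· M y j)) (ℝR.trans (ℝR.reflexive (cong fromℤℝ (My j))) (ι-* (+ s) (c j)))))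
        (ℝ-Dimension.s⁻¹*s s≢0 (fromℤℝ (c j)))))
    where
    s⁻¹ = ℝ-Dimension.s⁻¹ s≢0
    My : ∀ j → (M ·ℤ y) j ≡ + s ℤ.* c j
    My j = trans (ℤM.sum-cong {n} _ _ (λ i → ℤₚ.*-comm (M j i) (y i))) (eq j)
    widen : ∀ x → Kernelℤ (M ᵀ) x → Kernelℤ (M̄ ᵀ) x
    widen x Mᵀx≡0 = ↑-elim n _ (λ k → trans (augmentᵀ-head M c x k) (Mᵀx≡0 k)) (λ k → trans (augmentᵀ-last M c x k) (dependent-kernel (M ᵀ) c y s≢0 eq x Mᵀx≡0))

module _ {m n l} (A : Matrix m n) (B : Matrix l n) where

  KernelOn : Subset m → Vector ℤ n → Set
  KernelOn J x = Kernelℤ B x × (∀ i → i ∈ J → (A ·ℤ x) i ≡ 0ℤ)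

  kernel-select : ∀ J x → Kernelℤ (B ++ (A ∘ select J)) x ⇔ KernelOn J x
  kernel-select J x = mk⇔
    (λ z → (λ i → subst Vanish (lookup-++ˡ B (A ∘ select J) i) (z (i ↑ˡ ∣ J ∣))) ,
      λ i i∈J → let k , eq = ∈-select J i∈J in
        subst (λ i → Vanish (A i)) eq (subst Vanish (lookup-++ʳ B (A ∘ select J) k) (z (l ↑ʳ k))))
    (λ { (z , h) → ↑-elim l _
      (λ i → subst Vanish (sym (lookup-++ˡ B (A ∘ select J) i)) (z i))
      (λ k → subst Vanish (sym (lookup-++ʳ B (A ∘ select J) k)) (h (select J k) (select-∈ J k))) })
    where
    Vanish : Vector ℤ n → Set
    Vanish α = ℤΣ (λ j → α j ℤ.* x j) ≡ 0ℤ

  kernel-++ : ∀ x → Kernelℤ (B ++ A) x ⇔ (Kernelℤ B x × Kernelℤ A x)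
  kernel-++ x = mk⇔
    (λ z → (λ i → subst Vanish (lookup-++ˡ B A i) (z (i ↑ˡ m))) , (λ i → subst Vanish (lookup-++ʳ B A i) (z (l ↑ʳ i))))
    (λ { (z , h) → ↑-elim l _ (λ i → subst Vanish (sym (lookup-++ˡ B A i)) (z i)) (λ i → subst Vanish (sym (lookup-++ʳ B A i)) (h i)) })
    where
    Vanish : Vector ℤ n → Set
    Vanish α = ℤΣ (λ j → α j ℤ.* x j) ≡ 0ℤ

-- The rank is tied to the integer kernel K and not to one matrix. Hence the order in which deletion
-- and contraction list the rows is immaterial, and `flatRank-unique` compares the results.
data FlatRank {n} (K : Vector ℤ n → Set) (L : Vector ℝ n → Set) : Maybe ℕ → Set where
  nonempty : ∀ {l} (M : Matrix l n) → (∀ x → Kernelℤ M x ⇔ K x) → ∃ L → FlatRank K L (just (rank M))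
  void     : (∀ p → ¬ L p) → FlatRank K L nothing

flatRank-cong : ∀ {n} {K K′ : Vector ℤ n → Set} {L L′ : Vector ℝ n → Set} → (∀ x → K x ⇔ K′ x) → (∀ p → L p ⇔ L′ p) →
  ∀ {z} → FlatRank K L z → FlatRank K′ L′ z
flatRank-cong K⇔ L⇔ (nonempty M M⇔ (p , h)) = nonempty M
  (λ x → mk⇔ (λ z → to (K⇔ x) (to (M⇔ x) z)) (λ z → from (M⇔ x) (from (K⇔ x) z))) (p , to (L⇔ p) h)
flatRank-cong K⇔ L⇔ (void e) = void λ p h → e p (from (L⇔ p) h)

flatRank-unique : ∀ {n} {K : Vector ℤ n → Set} {L : Vector ℝ n → Set} {z z′} → FlatRank K L z → FlatRank K L z′ → z ≡ z′
flatRank-unique (nonempty M M⇔ _) (nonempty N N⇔ _) = cong just (ℕₚ.≤-antisym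
  (rank-≤ λ x z → from (M⇔ x) (to (N⇔ x) z)) (rank-≤ λ x z → from (N⇔ x) (to (M⇔ x) z)))
flatRank-unique (nonempty _ _ (p , h)) (void e) = contradiction h (e p)
flatRank-unique (void e) (nonempty _ _ (p , h)) = contradiction h (e p)
flatRank-unique (void _) (void _) = refl

-- Deletion and contraction of arrangements

RankFunction : ∀ {m n l} (A : Matrix m n) (B : Matrix l n) (a : Vector ℤ m) (b : Vector ℤ l) → (Subset m → Maybe ℕ) → Set
RankFunction A B a b ρ = ∀ J → FlatRank (KernelOn A B J) (Arrangement.⋂H A B a b J) (ρ J)

rankFunction-[] : ∀ {n l} {A : Matrix 0 n} {B : Matrix l n} {a b ρ} → RankFunction A B a b ρ → ∃ (Solution B b) → ρ []ᵥ ≡ just (rank B)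
rankFunction-[] {B = B} ρ-rank (p , h) = flatRank-unique (ρ-rank []ᵥ)
  (nonempty B (λ x → mk⇔ (λ z → z , λ _ ()) proj₁) (p , h , λ _ ()))

module _ {m n l} {A : Matrix (suc m) n} {B : Matrix l n} {a : Vector ℤ (suc m)} {b : Vector ℤ l} where
  private
    module S = Arrangement A B a b
    module D = Arrangement (A ∘ suc) B (a ∘ suc) b
    module R = Arrangement (A ∘ suc) (A zero ∷ᶠ B) (a ∘ suc) (a zero ∷ᶠ b)

    outside-⇔ : ∀ {J} (P : Fin (suc m) → Set) → (∀ i → i ∈ (outside ∷ᵥ J) → P i) ⇔ (∀ i → i ∈ J → P (suc i))
    outside-⇔ P = mk⇔ (λ h i i∈J → h (suc i) (there i∈J)) (λ { h (suc i) (there i∈J) → h i i∈J })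

    kernel-outside : ∀ J x → KernelOn A B (outside ∷ᵥ J) x ⇔ KernelOn (A ∘ suc) B J x
    kernel-outside J x = mk⇔ (λ { (z , h) → z , to (outside-⇔ _) h }) (λ { (z , h) → z , from (outside-⇔ _) h })

    kernel-inside : ∀ J x → KernelOn A B (inside ∷ᵥ J) x ⇔ KernelOn (A ∘ suc) (A zero ∷ᶠ B) J x
    kernel-inside J x = mk⇔
      (λ { (z , h) → (λ { zero → h zero here ; (suc i) → z i }) , λ i i∈J → h (suc i) (there i∈J) })
      (λ { (z , h) → z ∘ suc , λ { zero here → z zero ; (suc i) (there i∈J) → h i i∈J } })

    ⋂H-outside : ∀ J p → S.⋂H (outside ∷ᵥ J) p ⇔ D.⋂H J p
    ⋂H-outside J p = mk⇔ (λ { (v , h) → v , to (outside-⇔ (λ i → S.H i p)) h }) (λ { (v , h) → v , from (outside-⇔ (λ i → S.H i p)) h })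

    ⋂H-inside : ∀ J p → S.⋂H (inside ∷ᵥ J) p ⇔ R.⋂H J p
    ⋂H-inside J p = mk⇔
      (λ { (v , h) → let v′ = λ { zero → proj₂ (h zero here) ; (suc i) → v i } in
         v′ , λ i i∈J → v′ , proj₂ (h (suc i) (there i∈J)) })
      (λ { (v , h) → v ∘ suc , λ { zero here → v ∘ suc , v zero ; (suc i) (there i∈J) → v ∘ suc , proj₂ (h i i∈J) } })

  deletion-rank : ∀ {ρ} → RankFunction A B a b ρ → RankFunction (A ∘ suc) B (a ∘ suc) b (ρ ∘ (outside ∷ᵥ_))
  deletion-rank ρ-rank J = flatRank-cong (kernel-outside J) (⋂H-outside J) (ρ-rank (outside ∷ᵥ J))

  -- Contraction moves the first equation into the system that defines the ambient space.
  contraction-rank : ∀ {ρ} → RankFunction A B a b ρ → RankFunction (A ∘ suc) (A zero ∷ᶠ B) (a ∘ suc) (a zero ∷ᶠ b) (ρ ∘ (inside ∷ᵥ_))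
  contraction-rank ρ-rank J = flatRank-cong (kernel-inside J) (⋂H-inside J) (ρ-rank (inside ∷ᵥ J))

  module _ {s : ℕ} (y : Vector ℤ l) (s≢0 : s ≢ 0) (eq : ∀ j → ℤΣ (λ i → y i ℤ.* B i j) ≡ + s ℤ.* A zero j) where

    private
      yb : ℤ
      yb = ℤΣ λ i → y i ℤ.* b i

      -- On V the form s * `A zero` is constantly `yb`. Hence the first hyperplane is all of V or
      -- empty, according to whether `yb` equals s * `a zero`.
      s-multiple : ∀ p → S.V p → fromℤℝ (+ s) *ℝ (A · p) zero ≈ℝ fromℤℝ yb
      s-multiple p Bp≈b = ℝR.trans (ℝR.sym (ℝ-Combination.combination-· {M = B} {α = A zero} {s = s} {y = y} eq p))
        (ℝR.trans (ℝM.sum-cong {l} _ _ (λ i → ℝR.trans (ℝR.*-congˡ (Bp≈b i)) (ℝR.sym (ι-* (y i) (b i)))))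
          (ℝR.sym (ℝM.ι-sum (λ i → y i ℤ.* b i))))

    dependent-loop : yb ≡ + s ℤ.* a zero → ∀ {ρ} → RankFunction A B a b ρ → ∀ J → ρ (inside ∷ᵥ J) ≡ ρ (outside ∷ᵥ J)
    dependent-loop yb≡ ρ-rank J = flatRank-unique (ρ-rank (inside ∷ᵥ J)) (flatRank-cong
      (λ x → mk⇔ (λ { (z , h) → z , λ { zero _ → dependent-kernel B (A zero) y s≢0 eq x z ; (suc i) (there i∈J) → h (suc i) (there i∈J) } })
                 (λ { (z , h) → z , λ { (suc i) (there i∈J) → h (suc i) (there i∈J) } }))
      (λ p → mk⇔ (λ { (v , h) → v , λ { zero _ → v , Ap≈a p v ; (suc i) (there i∈J) → h (suc i) (there i∈J) } })
                 (λ { (v , h) → v , λ { (suc i) (there i∈J) → h (suc i) (there i∈J) } }))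
      (ρ-rank (outside ∷ᵥ J)))
      where
      Ap≈a : ∀ p → S.V p → (A · p) zero ≈ℝ fromℤℝ (a zero)
      Ap≈a p v = ℝ-Dimension.ι-cancel s≢0 (ℝR.trans (s-multiple p v)
        (ℝR.trans (ℝR.reflexive (cong fromℤℝ yb≡)) (ι-* (+ s) (a zero))))

    dependent-parallel : yb ≢ + s ℤ.* a zero → ∀ {ρ} → RankFunction A B a b ρ → ∀ J → ρ (inside ∷ᵥ J) ≡ nothing
    dependent-parallel yb≢ ρ-rank J = flatRank-unique (ρ-rank (inside ∷ᵥ J)) (void λ { p (v , h) → yb≢
      (ℝ-Dimension.ι-injective₂ (ℝR.trans (ℝR.sym (s-multiple p v))
        (ℝR.trans (ℝR.*-congˡ {fromℤℝ (+ s)} (proj₂ (h zero here))) (ℝR.sym (ι-* (+ s) (a zero)))))) })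

  -- Moving a point of V along x stays in V and changes the first form at the nonzero rate e, so the
  -- step (a zero - A p) / e reaches the hyperplane.
  contraction-point : ∀ x → Kernelℤ B x → (A ·ℤ x) zero ≢ 0ℤ → ∃ S.V → ∃ R.V
  contraction-point x Bx≡0 αx≢0 (p , Bp≈b) = p + tx , λ { zero → αp′ ; (suc i) → Bp′ i }
    where
    infixl 6 _+_
    _+_ : ∀ {n} → Vector ℝ n → Vector ℝ n → Vector ℝ n
    (x + y) j = x j +ℝ y j
    e = (A ·ℤ x) zero
    e⁻¹ : ∃ λ y → fromℤℝ e *ℝ y ≈ℝ fromℤℝ 1ℤ
    -- `ι-inverse` treats natural numbers, so e is inverted through its sign and absolute value.
    e⁻¹ = let σ , _ , σe = SmithAlgorithm.sign e ; y , ky≈1 = ι-inverse ℤ.∣ e ∣ (λ k≡0 → αx≢0 (ℤₚ.∣i∣≡0⇒i≡0 k≡0)) in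
      fromℤℝ σ *ℝ y , ℝR.trans (ℝR.sym (ℝR.*-assoc _ _ y))
        (ℝR.trans (ℝR.*-congʳ {y} (ℝR.trans (ℝR.sym (ι-* e σ)) (ℝR.reflexive (cong fromℤℝ (trans (ℤₚ.*-comm e σ) σe))))) (ℝR.trans ky≈1 (ℝR.sym ι-1)))
    t : ℝ
    t = proj₁ e⁻¹ *ℝ (fromℤℝ (a zero) +ℝ -ℝ (A · p) zero)
    tx : Vector ℝ n
    tx j = t *ℝ fromℤℝ (x j)
    move : ∀ {k} (M : Matrix k n) i → (M · (p + tx)) i ≈ℝ (M · p) i +ℝ t *ℝ fromℤℝ ((M ·ℤ x) i)
    move M i = ℝR.trans (ℝM.·-+ M p tx i) (ℝR.+-congˡ {(M · p) i} (ℝR.trans (ℝ-Combination.·-* M t (fromℤℝ ∘ x) i)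
      (ℝR.*-congˡ {t} (ℝR.sym (ℝM.ι-· M x i)))))
    Bp′ : ∀ i → (B · (p + tx)) i ≈ℝ fromℤℝ (b i)
    Bp′ i = ℝR.trans (move B i) (ℝR.trans (ℝR.+-cong (Bp≈b i)
      (ℝR.trans (ℝR.*-congˡ {t} (ℝR.trans (ℝR.reflexive (cong fromℤℝ (Bx≡0 i))) ι-0)) (ℝR.zeroʳ t))) (ℝR.+-identityʳ _))
    te : t *ℝ fromℤℝ e ≈ℝ fromℤℝ (a zero) +ℝ -ℝ (A · p) zero
    te = ℝR.trans (ℝR.*-comm t (fromℤℝ e)) (ℝR.trans (ℝR.sym (ℝR.*-assoc (fromℤℝ e) _ _))
      (ℝR.trans (ℝR.*-congʳ (ℝR.trans (proj₂ e⁻¹) ι-1)) (ℝR.*-identityˡ _)))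
    αp′ : (A · (p + tx)) zero ≈ℝ fromℤℝ (a zero)
    αp′ = ℝR.trans (move A zero) (ℝR.trans (ℝR.+-congˡ {(A · p) zero} te)
      (ℝR.trans (ℝR.+-comm ((A · p) zero) _) (ℝR.trans (ℝR.+-assoc _ _ _)
        (ℝR.trans (ℝR.+-congˡ (ℝR.-‿inverseˡ ((A · p) zero))) (ℝR.+-identityʳ _)))))

-- A first row outside the rational row space of B raises the rank by one under contraction. A row
-- inside it is constant on V, and the right-hand sides decide between a loop and an empty
-- intersection.
semimatroid : ∀ {m n l} {A : Matrix m n} {B : Matrix l n} {a : Vector ℤ m} {b : Vector ℤ l} {ρ} →
  RankFunction A B a b ρ → ∃ (Solution B b) → Semimatroid (rank B) ρ
semimatroid {zero} {A = A} {B} {ρ = ρ} ρ-rank p = empty {ρ = ρ} (rankFunction-[] {A = A} {B} ρ-rank p)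
semimatroid {suc m} {A = A} {B} {a} {b} {ρ} ρ-rank p = decide (rowSpan? (smith B) (A zero))
  where
  deleted : Semimatroid (rank B) (ρ ∘ (outside ∷ᵥ_))
  deleted = semimatroid (deletion-rank ρ-rank) p
  decide : RowSpan B (A zero) → Semimatroid (rank B) ρ
  decide (independent x Bx≡0 αx≢0) = nonloop deleted
    (subst (λ r → Semimatroid r (ρ ∘ (inside ∷ᵥ_))) (rank-∷ B (A zero) x Bx≡0 αx≢0)
      (semimatroid (contraction-rank ρ-rank) (contraction-point {A = A} {B} {a} {b} x Bx≡0 αx≢0 p)))
  decide (dependent s y s≢0 eq) with ℤΣ (λ i → y i ℤ.* b i) ℤₚ.≟ + s ℤ.* a zero
  ... | yes yb≡ = loop (dependent-loop {b = b} y s≢0 eq yb≡ ρ-rank) deleted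
  ... | no yb≢  = parallel (dependent-parallel y s≢0 eq yb≢ ρ-rank) deleted

-- Contraction can create loops, for instance when two rows agree modulo B, so deletion is preferred
-- while the other rows still reach rank j. When they do not, the first row is a coloop, and
-- contracting it keeps all other rows independent of the base.
reaches : ∀ j {m n l} {A : Matrix m n} {B : Matrix l n} {a : Vector ℤ m} {b : Vector ℤ l} {ρ} →
  RankFunction A B a b ρ → ∃ (Solution B b) → (∀ i → ∃ λ x → Kernelℤ B x × (A ·ℤ x) i ≢ 0ℤ) →
  rank B ℕ.≤ j → j ℕ.≤ rank (B ++ A) → Reaches j (rank B) ρ
reaches j {zero} {A = A} {B} {ρ = ρ} ρ-rank p _ r≤j j≤s = subst (λ r → Reaches j r ρ) (sym r≡j)
  (here (trans (rankFunction-[] {A = A} {B} ρ-rank p) (cong just r≡j)))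
  where
  r≡j : rank B ≡ j
  r≡j = ℕₚ.≤-antisym r≤j (ℕₚ.≤-trans j≤s (rank-≤ λ x Bx≡0 → from (kernel-++ A B x) (Bx≡0 , λ ())))
reaches j {suc m} {n} {A = A} {B} {a} {b} {ρ} ρ-rank p nonzero r≤j j≤s = decide (j ℕₚ.≤? rank (B ++ (A ∘ suc)))
  where
  B′ = A zero ∷ᶠ B
  deleted = deletion-rank ρ-rank
  contracted = contraction-rank ρ-rank
  rank-B′ : rank B′ ≡ suc (rank B)
  rank-B′ = let x , Bx≡0 , αx≢0 = nonzero zero in rank-∷ B (A zero) x Bx≡0 αx≢0
  point : ∃ (Solution B′ (a zero ∷ᶠ b))
  point = let x , Bx≡0 , αx≢0 = nonzero zero in contraction-point {A = A} {B} {a} {b} x Bx≡0 αx≢0 p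
  -- x separates A zero from all other rows, so A zero remains outside the
  -- span of B and any A (suc i); hence no row becomes a loop after contraction.
  contract : ∀ x → Kernelℤ (B ++ (A ∘ suc)) x → (A ·ℤ x) zero ≢ 0ℤ → rank (B ++ (A ∘ suc)) ℕ.< j → Reaches j (rank B) ρ
  contract x x-kernel αx≢0 s′<j = contraction (semimatroid deleted p)
    (subst (λ r → Reaches j r (ρ ∘ (inside ∷ᵥ_))) rank-B′ (reaches j contracted point nonzero′
      -- The strict inequality rank B ≤ rank (B ++ (A ∘ suc)) < j leaves room for the extra rank of
      -- `B′`.
      (subst (ℕ._≤ j) (sym rank-B′) (ℕₚ.≤-<-trans (rank-≤ λ x z → proj₁ (to (kernel-++ (A ∘ suc) B x) z)) s′<j))
      (ℕₚ.≤-trans j≤s (rank-≤ λ x z → let z₁ , z₂ = to (kernel-++ (A ∘ suc) B′ x) z in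
        from (kernel-++ A B x) (z₁ ∘ suc , λ { zero → z₁ zero ; (suc i) → z₂ i })))))
    where
    Bx≡0 = proj₁ (to (kernel-++ (A ∘ suc) B x) x-kernel)
    Ax≡0 = proj₂ (to (kernel-++ (A ∘ suc) B x) x-kernel)
    nonzero′ : ∀ i → ∃ λ z → Kernelℤ B′ z × (A ·ℤ z) (suc i) ≢ 0ℤ
    nonzero′ i = z , (λ { zero → αz≡0 ; (suc k) → Bz≡0 k }) , αᵢz≢0
      where
      y = proj₁ (nonzero (suc i))
      By≡0 = proj₁ (proj₂ (nonzero (suc i)))
      αᵢy≢0 = proj₂ (proj₂ (nonzero (suc i)))
      e f : ℤ
      e = (A ·ℤ x) zero
      f = (A ·ℤ y) zero
      z : Vector ℤ n
      -- A multiple of x cancels `A zero` on e * y. The other rows vanish on x, so `A (suc i)` takes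
      -- the nonzero value e times its value on y.
      z k = e ℤ.* y k ℤ.+ (ℤ.- f) ℤ.* x k
      ·-z : ∀ {k} (M : Matrix k n) i → (M ·ℤ z) i ≡ e ℤ.* (M ·ℤ y) i ℤ.+ (ℤ.- f) ℤ.* (M ·ℤ x) i
      ·-z M i = trans (ℤM.·-+ M (λ k → e ℤ.* y k) (λ k → (ℤ.- f) ℤ.* x k) i)
        (cong₂ ℤ._+_ (ℤ-Combination.·-* M e y i) (ℤ-Combination.·-* M (ℤ.- f) x i))
      αz≡0 : (A ·ℤ z) zero ≡ 0ℤ
      αz≡0 = trans (·-z A zero) (cancel e f)
        where
        cancel : ∀ e f → e ℤ.* f ℤ.+ (ℤ.- f) ℤ.* e ≡ 0ℤ
        cancel = solve-∀
      Bz≡0 : Kernelℤ B z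
      Bz≡0 k = trans (·-z B k) (trans (cong₂ (λ u v → e ℤ.* u ℤ.+ (ℤ.- f) ℤ.* v) (By≡0 k) (Bx≡0 k)) (vanish e f))
        where
        vanish : ∀ e f → e ℤ.* 0ℤ ℤ.+ (ℤ.- f) ℤ.* 0ℤ ≡ 0ℤ
        vanish = solve-∀
      αᵢz≢0 : (A ·ℤ z) (suc i) ≢ 0ℤ
      αᵢz≢0 eq = [ αx≢0 , αᵢy≢0 ] (ℤₚ.i*j≡0⇒i≡0∨j≡0 e (trans (sym (trans (·-z A (suc i))
        (trans (cong (λ v → e ℤ.* (A ·ℤ y) (suc i) ℤ.+ (ℤ.- f) ℤ.* v) (Ax≡0 i)) (drop (e ℤ.* (A ·ℤ y) (suc i)) f)))) eq))
        where
        drop : ∀ u f → u ℤ.+ (ℤ.- f) ℤ.* 0ℤ ≡ u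
        drop = solve-∀
  coloop : rank (B ++ (A ∘ suc)) ℕ.< j → RowSpan (B ++ (A ∘ suc)) (A zero) → Reaches j (rank B) ρ
  coloop s′<j (independent x x-kernel αx≢0) = contract x x-kernel αx≢0 s′<j
  -- A dependent first row would leave the rank below j, against j ≤ rank (B ++ A).
  coloop s′<j (dependent s y s≢0 eq) = contradiction (ℕₚ.<-≤-trans s′<j (ℕₚ.≤-trans j≤s (rank-≤ inclusion))) (ℕₚ.<-irrefl refl)
    where
    inclusion : ∀ x → Kernelℤ (B ++ (A ∘ suc)) x → Kernelℤ (B ++ A) x
    inclusion x x-kernel = let z , h = to (kernel-++ (A ∘ suc) B x) x-kernel in from (kernel-++ A B x) (z , λ { zero → dependent-kernel (B ++ (A ∘ suc)) (A zero) y s≢0 eq x x-kernel ; (suc i) → h i })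
  decide : Dec (j ℕ.≤ rank (B ++ (A ∘ suc))) → Reaches j (rank B) ρ
  decide (yes j≤s′) = deletion (reaches j deleted p (nonzero ∘ suc) r≤j j≤s′)
    (subst (λ r → Semimatroid r (ρ ∘ (inside ∷ᵥ_))) rank-B′ (semimatroid contracted point))
  decide (no j≰s′) = coloop (ℕₚ.≰⇒> j≰s′) (rowSpan? (smith (B ++ (A ∘ suc))) (A zero))

-- Counting solutions modulo q

augmentᵀ-∣ : ∀ {m n} g (M : Matrix m n) c x → (∀ j → g ∣ (((augment M c) ᵀ) ·ℤ x) j) ⇔ ((∀ j → g ∣ ((M ᵀ) ·ℤ x) j) × g ∣ ℤΣ (λ i → c i ℤ.* x i))
augmentᵀ-∣ {n = n} g M c x = mk⇔
  (λ h → (λ j → subst (g ∣_) (augmentᵀ-head M c x j) (h (j ↑ˡ 1))) , subst (g ∣_) (augmentᵀ-last M c x zero) (h (n ↑ʳ zero)))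
  (λ { (h , h′) → ↑-elim n _ (λ k → subst (g ∣_) (sym (augmentᵀ-head M c x k)) (h k)) (λ k → subst (g ∣_) (sym (augmentᵀ-last M c x k)) h′) })

-- Adjoining a column to M adds a row to its transpose and so shrinks the kernel modulo g, here with
-- g the augmented factor itself.
augment-d-∣ : ∀ {m n} (M : Matrix m n) c k → SmithForm.d (smith (augment M c)) k ∣ℕ SmithForm.d (smith M) k
augment-d-∣ M c k = ∣⇒∣ᵤ (invariantFactor-∣ {0} (λ ()) (smithᵀ (smith (augment M c))) (+ SmithForm.d (smith (augment M c)) k) ∣-refl
  (smithᵀ (smith M)) (λ x _ h → proj₁ (to (augmentᵀ-∣ _ M c x) h)))

-- For g dividing q, the congruence M u ≡ c makes the new row of the transpose a combination of the
-- old ones modulo g. The kernels modulo g then agree, and g = gcd q (d k) also divides the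
-- augmented factor.
columnSpan-gcd : ∀ {m n} q (M : Matrix m n) c → InColumnSpan q M c → ∀ k →
  gcd q (SmithForm.d (smith M) k) ≡ gcd q (SmithForm.d (smith (augment M c)) k)
columnSpan-gcd {m} {n} q M c (u , Mu≡c) k = ℕ∣.∣-antisym
  (gcd-greatest (gcd[m,n]∣m q e) (∣⇒∣ᵤ (invariantFactor-∣ {0} (λ ()) (smithᵀ (smith M)) (+ g) (∣ᵤ⇒∣ {+ g} {+ e} (gcd[m,n]∣n q e))
    (smithᵀ (smith (augment M c))) (λ x _ h → from (augmentᵀ-∣ (+ g) M c x) (h , last x h)))))
  (gcd-greatest (gcd[m,n]∣m q ē) (ℕ∣.∣-trans (gcd[m,n]∣n q ē) (augment-d-∣ M c k)))
  where
  e ē g : ℕ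
  e = SmithForm.d (smith M) k
  ē = SmithForm.d (smith (augment M c)) k
  g = gcd q e
  last : ∀ x → (∀ j → + g ∣ ((M ᵀ) ·ℤ x) j) → + g ∣ ℤΣ (λ i → c i ℤ.* x i)
  last x h = subst (+ g ∣_) (sym cx≡) (∣m∣n⇒∣m-n
    (sum-∣ (+ g) _ λ j → ∣n⇒∣m*n (u j) (h j))
    (sum-∣ (+ g) _ λ i → ∣m⇒∣m*n (x i) (∣-trans (∣ᵤ⇒∣ {+ g} {+ q} (gcd[m,n]∣m q e)) (Mu≡c i))))
    where
    open ≡-Reasoning
    split′ : ∀ p c x → c ℤ.* x ≡ p ℤ.* x ℤ.+ (-1ℤ ℤ.* ((p ℤ.- c) ℤ.* x))
    split′ = solve-∀
    uMᵀx : ℤΣ (λ j → u j ℤ.* ((M ᵀ) ·ℤ x) j) ≡ ℤΣ (λ i → (M ·ℤ u) i ℤ.* x i)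
    uMᵀx = trans (ℤ-Combination.combination-· {M = M ᵀ} {α = M ·ℤ u} {s = 1} {y = u}
      (λ i → trans (ℤM.sum-cong {n} _ _ λ j → ℤₚ.*-comm (u j) (M i j)) (sym (ℤₚ.*-identityˡ _))) x) (ℤₚ.*-identityˡ _)
    cx≡ : ℤΣ (λ i → c i ℤ.* x i) ≡ ℤΣ (λ j → u j ℤ.* ((M ᵀ) ·ℤ x) j) ℤ.- ℤΣ (λ i → ((M ·ℤ u) i ℤ.- c i) ℤ.* x i)
    cx≡ = begin
      ℤΣ (λ i → c i ℤ.* x i)
        ≡⟨ ℤM.sum-cong {m} _ _ (λ i → split′ ((M ·ℤ u) i) (c i) (x i)) ⟩
      ℤΣ (λ i → (M ·ℤ u) i ℤ.* x i ℤ.+ (-1ℤ ℤ.* (((M ·ℤ u) i ℤ.- c i) ℤ.* x i)))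
        ≡⟨ ℤM.sum-+ {m} (λ i → (M ·ℤ u) i ℤ.* x i) (λ i → -1ℤ ℤ.* (((M ·ℤ u) i ℤ.- c i) ℤ.* x i)) ⟩
      ℤΣ (λ i → (M ·ℤ u) i ℤ.* x i) ℤ.+ ℤΣ (λ i → -1ℤ ℤ.* (((M ·ℤ u) i ℤ.- c i) ℤ.* x i))
        ≡⟨ cong₂ ℤ._+_ (sym uMᵀx) (trans (sym (ℤM.sum-*ˡ {m} -1ℤ (λ i → ((M ·ℤ u) i ℤ.- c i) ℤ.* x i))) (ℤₚ.-1*i≡-i _)) ⟩
      ℤΣ (λ j → u j ℤ.* ((M ᵀ) ·ℤ x) j) ℤ.- ℤΣ (λ i → ((M ·ℤ u) i ℤ.- c i) ℤ.* x i) ∎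

-- Sums over residue classes

truth : ∀ {P : Set} → Dec P → ℤ
truth P? = if does P? then 1ℤ else 0ℤ

truth-cong : ∀ {P Q : Set} (P? : Dec P) (Q? : Dec Q) → P ⇔ Q → truth P? ≡ truth Q?
truth-cong (yes p) (yes q) e = refl
truth-cong (no ¬p) (no ¬q) e = refl
truth-cong (yes p) (no ¬q) e = contradiction (to e p) ¬q
truth-cong (no ¬p) (yes q) e = contradiction (from e q) ¬p

∏ : ∀ {k} → Vector ℤ k → ℤ
∏ {zero}  f = 1ℤ
∏ {suc k} f = f zero ℤ.* ∏ (f ∘ suc)

∏-cong : ∀ {k} {f g : Vector ℤ k} → (∀ i → f i ≡ g i) → ∏ f ≡ ∏ g
∏-cong {zero}  p = refl
∏-cong {suc k} p = cong₂ ℤ._*_ (p zero) (∏-cong (p ∘ suc))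

∏-++ : ∀ a {b} (f : Vector ℤ (a ℕ.+ b)) → ∏ f ≡ ∏ (λ i → f (i ↑ˡ b)) ℤ.* ∏ (λ i → f (a ↑ʳ i))
∏-++ zero    f = sym (ℤₚ.*-identityˡ _)
∏-++ (suc a) f = trans (cong (f zero ℤ.*_) (∏-++ a (f ∘ suc))) (sym (ℤₚ.*-assoc (f zero) _ _))

∏-truth-all : ∀ {k} {P : Fin k → Set} (P? : ∀ i → Dec (P i)) (all? : Dec (∀ i → P i)) → ∏ (truth ∘ P?) ≡ truth all?
∏-truth-all P? (yes p) = go P? p
  where
  go : ∀ {k} {P : Fin k → Set} (P? : ∀ i → Dec (P i)) → (∀ i → P i) → ∏ (truth ∘ P?) ≡ 1ℤ
  go {zero}  P? p = refl
  go {suc k} P? p = cong₂ ℤ._*_ (truth-cong (P? zero) (yes (p zero)) (mk⇔ id id)) (go (P? ∘ suc) (p ∘ suc))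
∏-truth-all P? (no ¬p) = let i , ¬pᵢ = counterexample P? ¬p in go P? i ¬pᵢ
  where
  go : ∀ {k} {P : Fin k → Set} (P? : ∀ i → Dec (P i)) → ∀ i → ¬ P i → ∏ (truth ∘ P?) ≡ 0ℤ
  go P? zero    ¬p = cong (ℤ._* ∏ (truth ∘ P? ∘ suc)) (truth-cong (P? zero) (no ¬p) (mk⇔ id id))
  go P? (suc i) ¬p = trans (cong (truth (P? zero) ℤ.*_) (go (P? ∘ suc) i ¬p)) (ℤₚ.*-zeroʳ (truth (P? zero)))

-- The two families may differ in length: a system of m equations is exchanged for n conditions on
-- single coordinates.
∏-truth-cong : ∀ {k l} {P : Fin k → Set} {Q : Fin l → Set} (P? : ∀ i → Dec (P i)) (Q? : ∀ i → Dec (Q i)) →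
  (∀ i → P i) ⇔ (∀ i → Q i) → ∏ (truth ∘ P?) ≡ ∏ (truth ∘ Q?)
∏-truth-cong P? Q? e = trans (∏-truth-all P? (Finₚ.all? P?)) (trans (truth-cong (Finₚ.all? P?) (Finₚ.all? Q?) e) (sym (∏-truth-all Q? (Finₚ.all? Q?))))

sum-single : ∀ {k} (f : Vector ℤ k) i → (∀ j → j ≢ i → f j ≡ 0ℤ) → ℤΣ f ≡ f i
sum-single {suc k} f zero    p = trans (cong (λ s → f zero ℤ.+ s) (ℤM.sum-0 {k} _ λ j → p (suc j) λ ())) (ℤₚ.+-identityʳ _)
sum-single {suc k} f (suc i) p = trans (cong₂ ℤ._+_ (p zero λ ()) (sum-single (f ∘ suc) i λ j j≢i → p (suc j) (j≢i ∘ Finₚ.suc-injective))) (ℤₚ.+-identityˡ _)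

multiples : ∀ p {{_ : ℕ.NonZero p}} g → ℤΣ {g ℕ.* p} (λ i → truth (p ℕ∣.∣? toℕ i)) ≡ + g
multiples p             zero    = refl
multiples p@(suc p-1) (suc g) = trans (ℤM.sum-++ p {g ℕ.* p} (λ i → truth (p ℕ∣.∣? toℕ i))) (cong₂ ℤ._+_
  (trans (sum-single (λ i → truth (p ℕ∣.∣? toℕ (i ↑ˡ (g ℕ.* p)))) zero first-block) (truth-cong (p ℕ∣.∣? 0) (yes (p ℕ∣.∣0)) (mk⇔ id id)))
  (trans (ℤM.sum-cong {g ℕ.* p} _ _ λ i → trans (cong (λ k → truth (p ℕ∣.∣? k)) (Finₚ.toℕ-↑ʳ p i))
    (truth-cong (p ℕ∣.∣? (p ℕ.+ toℕ i)) (p ℕ∣.∣? toℕ i) (mk⇔ (λ h → ℕ∣.∣m+n∣m⇒∣n h ℕ∣.∣-refl) (ℕ∣.∣m∣n⇒∣m+n ℕ∣.∣-refl)))) (multiples p g)))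
  where
  first-block : ∀ (i : Fin p) → i ≢ zero → truth (p ℕ∣.∣? toℕ (i ↑ˡ (g ℕ.* p))) ≡ 0ℤ
  first-block zero    i≢0 = contradiction refl i≢0
  first-block (suc i) _   = trans (cong (λ k → truth (p ℕ∣.∣? k)) (Finₚ.toℕ-↑ˡ (suc i) (g ℕ.* p)))
    (truth-cong (p ℕ∣.∣? suc (toℕ i)) (no λ h → ℕₚ.<⇒≱ (Finₚ.toℕ<n (suc i)) (ℕ∣.∣⇒≤ h)) (mk⇔ id id))

module Residues (q : ℕ) {{q-nonZero : ℕ.NonZero q}} where

  infix 4 _≋_
  _≋_ : ∀ {n} → Vector ℤ n → Vector ℤ n → Set
  x ≋ y = ∀ i → + q ∣ x i ℤ.- y i

  Periodic : ∀ {n} → (Vector ℤ n → ℤ) → Set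
  Periodic f = ∀ {x y} → x ≋ y → f x ≡ f y

  ∣-≡ : ∀ {x y} → x ≡ y → + q ∣ x ℤ.- y
  ∣-≡ {x} refl = divides 0ℤ (ℤₚ.+-inverseʳ x)

  ∣-swap : ∀ {x y} → + q ∣ x ℤ.- y → + q ∣ y ℤ.- x
  ∣-swap {x} {y} p = subst (+ q ∣_) (flip x y) (∣n⇒∣m*n -1ℤ p)
    where
    flip : ∀ x y → -1ℤ ℤ.* (x ℤ.- y) ≡ y ℤ.- x
    flip = solve-∀

  box : ∀ {n} → (Vector ℤ n → ℤ) → ℤ
  box {zero}  f = f []ᶠ
  box {suc n} f = ℤΣ {q} λ i → box (λ v → f ((+ toℕ i) ∷ᶠ v))

  box-cong : ∀ {n} {f g : Vector ℤ n → ℤ} → (∀ x → f x ≡ g x) → box f ≡ box g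
  box-cong {zero}  p = p []ᶠ
  box-cong {suc n} p = ℤM.sum-cong {q} _ _ λ i → box-cong {n} λ v → p ((+ toℕ i) ∷ᶠ v)

  box-*ˡ : ∀ {n} z (f : Vector ℤ n → ℤ) → box (λ x → z ℤ.* f x) ≡ z ℤ.* box f
  box-*ˡ {zero}  z f = refl
  box-*ˡ {suc n} z f = trans (ℤM.sum-cong {q} _ _ λ i → box-*ˡ z (λ v → f ((+ toℕ i) ∷ᶠ v))) (sym (ℤM.sum-*ˡ {q} z _))

  box-sum : ∀ {n k} (F : Fin k → Vector ℤ n → ℤ) → box (λ x → ℤΣ λ i → F i x) ≡ ℤΣ λ i → box (F i)
  box-sum {zero}      F = refl
  box-sum {suc n} {k} F = trans (ℤM.sum-cong {q} _ _ λ i → box-sum (λ j v → F j ((+ toℕ i) ∷ᶠ v))) (SemiringSum.∑-comm (CommutativeRing.semiring ℤₚ.+-*-commutativeRing) {q} {k} _)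

  box-swap : ∀ {m n} (F : Vector ℤ m → Vector ℤ n → ℤ) → box (λ x → box (F x)) ≡ box (λ y → box (λ x → F x y))
  box-swap {zero}  F = refl
  box-swap {suc m} F = trans (ℤM.sum-cong {q} _ _ λ i → box-swap (λ v → F ((+ toℕ i) ∷ᶠ v))) (sym (box-sum {k = q} (λ i y → box (λ v → F ((+ toℕ i) ∷ᶠ v) y))))

  box-∏ : ∀ {n} (g : Fin n → ℤ → ℤ) → box (λ x → ∏ (λ k → g k (x k))) ≡ ∏ (λ k → ℤΣ {q} (λ i → g k (+ toℕ i)))
  box-∏ {zero}  g = refl
  box-∏ {suc n} g = begin
    ℤΣ {q} (λ i → box (λ v → g zero (+ toℕ i) ℤ.* ∏ (λ k → g (suc k) (v k))))
      ≡⟨ ℤM.sum-cong {q} _ _ (λ i → trans (box-*ˡ {n} (g zero (+ toℕ i)) (λ v → ∏ (λ k → g (suc k) (v k)))) (trans (cong (g zero (+ toℕ i) ℤ.*_) (box-∏ (g ∘ suc))) (ℤₚ.*-comm (g zero (+ toℕ i)) _))) ⟩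
    ℤΣ {q} (λ i → rest ℤ.* g zero (+ toℕ i))
      ≡⟨ sym (ℤM.sum-*ˡ {q} rest _) ⟩
    rest ℤ.* ℤΣ {q} (λ i → g zero (+ toℕ i))
      ≡⟨ ℤₚ.*-comm rest _ ⟩
    ℤΣ {q} (λ i → g zero (+ toℕ i)) ℤ.* rest ∎
    where
    open ≡-Reasoning
    rest : ℤ
    rest = ∏ (λ k → ℤΣ {q} (λ i → g (suc k) (+ toℕ i)))

  residue : ℤ → Fin q
  residue z = fromℕ< (ℤ/.n%ℕd<d z q)

  residue-∣ : ∀ z → + q ∣ z ℤ.- + toℕ (residue z)
  residue-∣ z = divides (z ℤ./ℕ q) (trans (cong₂ ℤ._-_ (ℤ/.a≡a%ℕn+[a/ℕn]*n z q) (cong +_ (Finₚ.toℕ-fromℕ< (ℤ/.n%ℕd<d z q))))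
    (cancel (+ (z ℤ.%ℕ q)) ((z ℤ./ℕ q) ℤ.* + q)))
    where
    cancel : ∀ r s → (r ℤ.+ s) ℤ.- r ≡ s
    cancel = solve-∀

  residue-unique : ∀ (i j : Fin q) → + q ∣ + toℕ i ℤ.- + toℕ j → i ≡ j
  residue-unique i j div = Finₚ.toℕ-injective ([ (λ i≤j → go i j i≤j (∣⇒∣ᵤ (∣-swap {+ toℕ i} {+ toℕ j} div))) , (λ j≤i → sym (go j i j≤i (∣⇒∣ᵤ div))) ]′ (ℕₚ.≤-total (toℕ i) (toℕ j)))
    where
    go : ∀ (i j : Fin q) → toℕ i ℕ.≤ toℕ j → q ∣ℕ ℤ.∣ + toℕ j ℤ.- + toℕ i ∣ → toℕ i ≡ toℕ j
    go i j i≤j div = ℕₚ.≤-antisym i≤j (ℕₚ.m∸n≡0⇒m≤n (zero? _ (subst (q ∣ℕ_) ∣∣≡ div) (ℕₚ.≤-<-trans (ℕₚ.m∸n≤m (toℕ j) (toℕ i)) (Finₚ.toℕ<n j))))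
      where
      ∣∣≡ : ℤ.∣ + toℕ j ℤ.- + toℕ i ∣ ≡ toℕ j ℕ.∸ toℕ i
      ∣∣≡ = cong ℤ.∣_∣ (trans (ℤₚ.m-n≡m⊖n (toℕ j) (toℕ i)) (ℤₚ.⊖-≥ i≤j))
      zero? : ∀ k → q ∣ℕ k → k ℕ.< q → k ≡ 0
      zero? zero    _   _   = refl
      zero? (suc k) q∣k k<q = contradiction (ℕ∣.∣⇒≤ q∣k) (ℕₚ.<⇒≱ k<q)

  δ : ∀ {n} → Vector ℤ n → Vector ℤ n → ℤ
  δ x y = ∏ λ i → truth (+ q ∣? x i ℤ.- y i)

  box-δ : ∀ {n} {f : Vector ℤ n → ℤ} → Periodic f → ∀ z → box (λ y → δ z y ℤ.* f y) ≡ f z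
  box-δ {zero}  {f} per z = trans (ℤₚ.*-identityˡ _) (per {[]ᶠ} {z} λ ())
  box-δ {suc n} {f} per z = begin
    ℤΣ {q} (λ i → box (λ v → δ₀ i ℤ.* δ (z ∘ suc) v ℤ.* f ((+ toℕ i) ∷ᶠ v)))
      ≡⟨ ℤM.sum-cong {q} _ _ (λ i → trans (box-cong λ v → ℤₚ.*-assoc (δ₀ i) (δ (z ∘ suc) v) _)
           (trans (box-*ˡ (δ₀ i) (λ v → δ (z ∘ suc) v ℤ.* f ((+ toℕ i) ∷ᶠ v)))
             (cong (δ₀ i ℤ.*_) (box-δ (λ p → per λ { zero → ∣-≡ {+ toℕ i} refl ; (suc k) → p k }) (z ∘ suc))))) ⟩
    ℤΣ {q} (λ i → δ₀ i ℤ.* f ((+ toℕ i) ∷ᶠ (z ∘ suc)))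
      ≡⟨ sum-single (λ i → δ₀ i ℤ.* f ((+ toℕ i) ∷ᶠ (z ∘ suc))) i₀ (λ j j≢i₀ → cong (ℤ._* f ((+ toℕ j) ∷ᶠ (z ∘ suc)))
           (truth-cong (+ q ∣? z zero ℤ.- + toℕ j) (no λ div → j≢i₀ (residue-unique j i₀ (between div))) (mk⇔ id id))) ⟩
    δ₀ i₀ ℤ.* f ((+ toℕ i₀) ∷ᶠ (z ∘ suc))
      ≡⟨ cong₂ ℤ._*_ (truth-cong (+ q ∣? z zero ℤ.- + toℕ i₀) (yes (residue-∣ (z zero))) (mk⇔ id id))
           (per λ { zero → ∣-swap {z zero} (residue-∣ (z zero)) ; (suc k) → ∣-≡ {z (suc k)} refl }) ⟩
    1ℤ ℤ.* f z
      ≡⟨ ℤₚ.*-identityˡ _ ⟩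
    f z ∎
    where
    open ≡-Reasoning
    i₀ = residue (z zero)
    δ₀ : Fin q → ℤ
    δ₀ i = truth (+ q ∣? z zero ℤ.- + toℕ i)
    between : ∀ {j} → + q ∣ z zero ℤ.- + toℕ j → + q ∣ + toℕ j ℤ.- + toℕ i₀
    between {j} div = subst (+ q ∣_) (tele (z zero) (+ toℕ i₀) (+ toℕ j)) (∣m∣n⇒∣m-n (residue-∣ (z zero)) div)
      where
      tele : ∀ z i j → (z ℤ.- i) ℤ.- (z ℤ.- j) ≡ j ℤ.- i
      tele = solve-∀

  -- A change of variables for maps that do not preserve the representatives 0, ..., q - 1. Each f
  -- (φ x) is expanded as a sum over y of δ (φ x) y * f y; after exchanging the sums, the inner one
  -- counts the single x congruent to ψ y.
  box-transport : ∀ {n} {f : Vector ℤ n → ℤ} → Periodic f → (φ ψ : Vector ℤ n → Vector ℤ n) →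
    (∀ x y → φ x ≋ y ⇔ ψ y ≋ x) → box (f ∘ φ) ≡ box f
  box-transport {f = f} per φ ψ adjoint = begin
    box (λ x → f (φ x))                           ≡⟨ box-cong (λ x → sym (box-δ per (φ x))) ⟩
    box (λ x → box (λ y → δ (φ x) y ℤ.* f y))     ≡⟨ box-swap (λ x y → δ (φ x) y ℤ.* f y) ⟩
    box (λ y → box (λ x → δ (φ x) y ℤ.* f y))     ≡⟨ box-cong inner ⟩
    box f                                         ∎
    where
    open ≡-Reasoning
    inner : ∀ y → box (λ x → δ (φ x) y ℤ.* f y) ≡ f y
    inner y = begin
      box (λ x → δ (φ x) y ℤ.* f y)
        ≡⟨ box-cong (λ x → trans (ℤₚ.*-comm (δ (φ x) y) (f y)) (cong (f y ℤ.*_) (trans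
             (∏-truth-cong (λ i → + q ∣? φ x i ℤ.- y i) (λ i → + q ∣? ψ y i ℤ.- x i) (adjoint x y)) (sym (ℤₚ.*-identityʳ _))))) ⟩
      box (λ x → f y ℤ.* (δ (ψ y) x ℤ.* 1ℤ))
        ≡⟨ box-*ˡ (f y) (λ x → δ (ψ y) x ℤ.* 1ℤ) ⟩
      f y ℤ.* box (λ x → δ (ψ y) x ℤ.* 1ℤ)
        ≡⟨ cong (f y ℤ.*_) (box-δ {f = λ _ → 1ℤ} (λ _ → refl) (ψ y)) ⟩
      f y ℤ.* 1ℤ
        ≡⟨ ℤₚ.*-identityʳ _ ⟩
      f y ∎

  -- With g = gcd d q and q = p * g, the condition becomes p ∣ i, which holds for g of the q
  -- residues.
  gcd-count : ∀ d → ℤΣ {q} (λ i → truth (+ q ∣? + d ℤ.* + toℕ i)) ≡ + gcd d q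
  gcd-count d with gcd[m,n]∣n d q
  ... | ℕ∣.divides p q≡pg = trans
    (ℤM.sum-cong {q} _ _ λ i → truth-cong (+ q ∣? + d ℤ.* + toℕ i) (p ℕ∣.∣? toℕ i) (mk⇔ (reduce (toℕ i)) (expand (toℕ i))))
    (blocks q (trans q≡pg (ℕₚ.*-comm p g)))
    where
    g : ℕ
    g = gcd d q
    instance
      p≢0 : ℕ.NonZero p
      p≢0 = ℕ.≢-nonZero λ p≡0 → ℕ.≢-nonZero⁻¹ q (trans q≡pg (cong (ℕ._* g) p≡0))
      g≢0 : ℕ.NonZero g
      g≢0 = ℕ.≢-nonZero (gcd[m,n]≢0 d q (inj₂ (ℕ.≢-nonZero⁻¹ q)))
    blocks : ∀ q → q ≡ g ℕ.* p → ℤΣ {q} (λ i → truth (p ℕ∣.∣? toℕ i)) ≡ + g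
    blocks _ refl = multiples p g
    reduce : ∀ i → + q ∣ + d ℤ.* + i → p ∣ℕ i
    -- q = p * g divides i * d and i * q, hence their gcd i * g; then g is cancelled.
    reduce i div = ℕ∣.*-cancelʳ-∣ g (subst₂ _∣ℕ_ q≡pg (sym (c*gcd[m,n]≡gcd[cm,cn] i d q))
      (gcd-greatest (subst (q ∣ℕ_) (trans (cong ℤ.∣_∣ (sym (ℤₚ.pos-* d i))) (ℕₚ.*-comm d i)) (∣⇒∣ᵤ div)) (ℕ∣.n∣m*n i)))
    expand : ∀ i → p ∣ℕ i → + q ∣ + d ℤ.* + i
    expand i p∣i = subst (+ q ∣_) (ℤₚ.pos-* d i) (∣ᵤ⇒∣ {+ q} {+ (d ℕ.* i)}
      (subst₂ _∣ℕ_ (trans (ℕₚ.*-comm g p) (sym q≡pg)) refl (ℕ∣.*-pres-∣ (gcd[m,n]∣m d q) p∣i)))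

  ·-≋ : ∀ {m n} (M : Matrix m n) x y → x ≋ y → M ·ℤ x ≋ M ·ℤ y
  ·-≋ M x y p i = subst (+ q ∣_) difference (·-∣ (+ q) M (λ j → x j ℤ.- y j) p i)
    where
    restore : ∀ a b → a ≡ a ℤ.- b ℤ.+ b
    restore = solve-∀
    cancel : ∀ a b → a ≡ a ℤ.+ b ℤ.- b
    cancel = solve-∀
    difference : (M ·ℤ λ j → x j ℤ.- y j) i ≡ (M ·ℤ x) i ℤ.- (M ·ℤ y) i
    difference = trans (cancel _ ((M ·ℤ y) i)) (cong (ℤ._- (M ·ℤ y) i)
      (trans (sym (ℤM.·-+ M (λ j → x j ℤ.- y j) y i)) (ℤM.·-cong M (λ j → sym (restore (x j) (y j))) i)))

  ≋-trans : ∀ {n} (x y z : Vector ℤ n) → x ≋ y → y ≋ z → x ≋ z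
  ≋-trans x y z p r i = subst (+ q ∣_) (tele (x i) (y i) (z i)) (∣m∣n⇒∣m+n (p i) (r i))
    where
    tele : ∀ x y z → (x ℤ.- y) ℤ.+ (y ℤ.- z) ≡ x ℤ.- z
    tele = solve-∀

  ≋-sym : ∀ {n} (x y : Vector ℤ n) → x ≋ y → y ≋ x
  ≋-sym x y p i = ∣-swap {x i} {y i} (p i)

  solves : ∀ {m n} → Matrix m n → Vector ℤ m → Vector ℤ n → ℤ
  solves M c x = ∏ λ i → truth (+ q ∣? (M ·ℤ x) i ℤ.- c i)

  module _ {m n} {M : Matrix m n} (F : SmithForm M) {c : Vector ℤ m} (u : Vector ℤ n) (Mu≋c : M ·ℤ u ≋ c) where
    open SmithForm F
    open Invertible V-inv renaming (inverse to V⁻¹)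

    private
      φ ψ : Vector ℤ n → Vector ℤ n
      φ y k = u k ℤ.+ (V ·ℤ y) k
      ψ x = V⁻¹ ·ℤ λ k → x k ℤ.- u k

      adjoint : ∀ x y → φ x ≋ y ⇔ ψ y ≋ x
      adjoint x y = mk⇔
        (λ p → ≋-trans (ψ y) (V⁻¹ ·ℤ V ·ℤ x) x (·-≋ V⁻¹ (λ k → y k ℤ.- u k) (V ·ℤ x) (λ k → subst (+ q ∣_) (swap (u k) ((V ·ℤ x) k) (y k)) (∣-swap {φ x k} {y k} (p k))))
          (λ k → ∣-≡ (ℤM.cancelˡ V-inv x k)))
        (λ p k → subst (+ q ∣_) (swap′ (u k) ((V ·ℤ x) k) (y k)) (≋-trans (V ·ℤ x) (V ·ℤ ψ y) (λ k → y k ℤ.- u k) (·-≋ V x (ψ y) (≋-sym (ψ y) x p)) (λ k → ∣-≡ (ℤM.cancelʳ V-inv (λ k → y k ℤ.- u k) k)) k))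
        where
        swap : ∀ u v y → y ℤ.- (u ℤ.+ v) ≡ (y ℤ.- u) ℤ.- v
        swap = solve-∀
        swap′ : ∀ u v y → v ℤ.- (y ℤ.- u) ≡ (u ℤ.+ v) ℤ.- y
        swap′ = solve-∀

      solves-periodic : Periodic (solves M c)
      solves-periodic {x} {y} x≋y = ∏-truth-cong (λ i → + q ∣? (M ·ℤ x) i ℤ.- c i) (λ i → + q ∣? (M ·ℤ y) i ℤ.- c i)
        (mk⇔ (≋-trans (M ·ℤ y) (M ·ℤ x) c (·-≋ M y x (≋-sym x y x≋y))) (≋-trans (M ·ℤ x) (M ·ℤ y) c (·-≋ M x y x≋y)))

      solves-φ : ∀ y → solves M c (φ y) ≡ ∏ (λ k → truth (+ q ∣? + d (toℕ k) ℤ.* y k))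
      solves-φ y = ∏-truth-cong (λ i → + q ∣? (M ·ℤ φ y) i ℤ.- c i) (λ k → + q ∣? + d (toℕ k) ℤ.* y k) (mk⇔ split′ join)
        where
        MVy : ∀ i → (M ·ℤ φ y) i ≡ (M ·ℤ u) i ℤ.+ (M ·ℤ V ·ℤ y) i
        MVy = ℤM.·-+ M u (V ·ℤ y)
        split′ : M ·ℤ φ y ≋ c → ∀ k → + q ∣ + d (toℕ k) ℤ.* y k
        split′ p k with toℕ k ℕₚ.<? m
        ... | no k≮m = subst (λ z → + q ∣ + z ℤ.* y k) (sym (d≡0 _ (ℕₚ.≤-trans rk≤m (ℕₚ.≮⇒≥ k≮m)))) (divides 0ℤ refl)
        ... | yes k<m = subst (+ q ∣_) (trans (ℤM.Normalised.MV F y i) (diagonal-· d y i k (Finₚ.toℕ-fromℕ< k<m))) (·-∣ (+ q) U _ divisible i)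
          where
          i = fromℕ< k<m
          divisible : ∀ i → + q ∣ (M ·ℤ V ·ℤ y) i
          divisible i = subst (+ q ∣_) (trans (cong (ℤ._- (M ·ℤ u) i) (MVy i)) (cancel ((M ·ℤ u) i) _)) (≋-trans (M ·ℤ φ y) c (M ·ℤ u) p (≋-sym (M ·ℤ u) c Mu≋c) i)
            where
            cancel : ∀ a b → a ℤ.+ b ℤ.- a ≡ b
            cancel = solve-∀
        join : (∀ k → + q ∣ + d (toℕ k) ℤ.* y k) → M ·ℤ φ y ≋ c
        join h = ≋-trans (M ·ℤ φ y) (M ·ℤ u) c (λ i → subst (+ q ∣_) (sym (trans (cong (ℤ._- (M ·ℤ u) i) (MVy i)) (cancel ((M ·ℤ u) i) _)))
          (·-∣⁻¹ (+ q) U-inv (M ·ℤ V ·ℤ y) (λ i → subst (+ q ∣_) (sym (ℤM.Normalised.MV F y i)) (diagonal-∣ (+ q) d y h i)) i)) Mu≋c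
          where
          cancel : ∀ a b → a ℤ.+ b ℤ.- a ≡ b
          cancel = solve-∀

    -- Measured from the particular solution u in the columns of V, the system decouples into d k *
    -- y k ≡ 0 modulo q, one congruence for each coordinate.
    solution-count : box (solves M c) ≡ ∏ {n} (λ k → + gcd (d (toℕ k)) q)
    solution-count = begin
      box (solves M c)                                               ≡⟨ sym (box-transport solves-periodic φ ψ adjoint) ⟩
      box (solves M c ∘ φ)                                           ≡⟨ box-cong {n} solves-φ ⟩
      box {n} (λ y → ∏ (λ k → truth (+ q ∣? + d (toℕ k) ℤ.* y k)))       ≡⟨ box-∏ {n} (λ k z → truth (+ q ∣? + d (toℕ k) ℤ.* z)) ⟩
      ∏ {n} (λ k → ℤΣ {q} (λ i → truth (+ q ∣? + d (toℕ k) ℤ.* + toℕ i))) ≡⟨ ∏-cong {n} (λ k → gcd-count (d (toℕ k))) ⟩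
      ∏ {n} (λ k → + gcd (d (toℕ k)) q)                              ∎
      where open ≡-Reasoning

product-∏ : ∀ (g : ℕ → ℕ) e r → + ℕList.product (map g (map suc (applyUpTo e r))) ≡ ∏ {r} (λ i → + g (suc (e (toℕ i))))
product-∏ g e zero    = refl
product-∏ g e (suc r) = trans (ℤₚ.pos-* (g (suc (e 0))) _) (cong (+ g (suc (e 0)) ℤ.*_) (product-∏ g (e ∘ suc) r))

∏-constant : ∀ b z (f : Vector ℤ b) → (∀ i → f i ≡ z) → ∏ f ≡ z ℤ.^ b
∏-constant zero    z f p = refl
∏-constant (suc b) z f p = cong₂ ℤ._*_ (p zero) (∏-constant b z (f ∘ suc) (p ∘ suc))

∏-tail : ∀ {r n} (h : ℕ → ℤ) z → r ℕ.≤ n → (∀ k → r ℕ.≤ k → h k ≡ z) → ∏ {n} (h ∘ toℕ) ≡ ∏ {r} (h ∘ toℕ) ℤ.* z ℤ.^ (n ℕ.∸ r)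
∏-tail {zero}  {n}     h z _           p = trans (∏-constant n z _ (λ i → p (toℕ i) ℕ.z≤n)) (sym (ℤₚ.*-identityˡ _))
∏-tail {suc r} {suc n} h z (ℕ.s≤s r≤n) p = trans (cong (h 0 ℤ.*_) (∏-tail (h ∘ suc) z r≤n (λ k r≤k → p (suc k) (ℕ.s≤s r≤k))))
  (sym (ℤₚ.*-assoc (h 0) (∏ {r} (h ∘ suc ∘ toℕ)) (z ℤ.^ (n ℕ.∸ r))))

-- Complete monotonicity of the counts

restrict : ∀ {m} → Vector ℤ m → Subset m → ℤ
restrict g []ᵥ            = 1ℤ
restrict g (outside ∷ᵥ J) = restrict (g ∘ suc) J
restrict g (inside ∷ᵥ J)  = g zero ℤ.* restrict (g ∘ suc) J

∏-select : ∀ {m} (g : Vector ℤ m) J → ∏ (g ∘ select J) ≡ restrict g J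
∏-select g []ᵥ            = refl
∏-select g (outside ∷ᵥ J) = ∏-select (g ∘ suc) J
∏-select g (inside ∷ᵥ J)  = cong (g zero ℤ.*_) (∏-select (g ∘ suc) J)

cm-* : ∀ {m} {N : Subset m → ℤ} z → 0ℤ ℤ.≤ z → CompletelyMonotone N → CompletelyMonotone (λ J → z ℤ.* N J)
cm-* {N = N} z 0≤z (nonneg c)  = nonneg (subst (ℤ._≤ z ℤ.* N []ᵥ) (ℤₚ.*-zeroʳ z) (ℤₚ.*-monoˡ-≤-nonNeg z {{ℤ.nonNegative 0≤z}} c))
cm-* {N = N} z 0≤z (split c d) = split (cm-cong (λ J → distrib z (N (outside ∷ᵥ J)) (N (inside ∷ᵥ J))) (cm-* z 0≤z c)) (cm-* z 0≤z d)
  where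
  distrib : ∀ z a b → z ℤ.* (a ℤ.- b) ≡ z ℤ.* a ℤ.- z ℤ.* b
  distrib = solve-∀

-- Passing to the difference contributes the factor 1 - g zero and passing to sets with the first
-- element the factor g zero; both are nonnegative. For 0/1 values `restrict g` is the weight
-- [J ⊆ F] with F the support of g.
cm-restrict : ∀ {m} (g : Vector ℤ m) → (∀ i → 0ℤ ℤ.≤ g i × 0ℤ ℤ.≤ 1ℤ ℤ.- g i) → CompletelyMonotone (restrict g)
cm-restrict {zero}  g p = nonneg (ℤ.+≤+ ℕ.z≤n)
cm-restrict {suc m} g p = split
  (cm-cong (λ J → factor (g zero) (restrict (g ∘ suc) J)) (cm-* (1ℤ ℤ.- g zero) (proj₂ (p zero)) (cm-restrict (g ∘ suc) (p ∘ suc))))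
  (cm-* (g zero) (proj₁ (p zero)) (cm-restrict (g ∘ suc) (p ∘ suc)))
  where
  factor : ∀ z s → (1ℤ ℤ.- z) ℤ.* s ≡ s ℤ.- z ℤ.* s
  factor = solve-∀

truth-bounds : ∀ {P : Set} (P? : Dec P) → 0ℤ ℤ.≤ truth P? × 0ℤ ℤ.≤ 1ℤ ℤ.- truth P?
truth-bounds (yes _) = ℤ.+≤+ ℕ.z≤n , ℤ.+≤+ ℕ.z≤n
truth-bounds (no _)  = ℤ.+≤+ ℕ.z≤n , ℤ.+≤+ ℕ.z≤n

∏-truth-≥0 : ∀ {k} {P : Fin k → Set} (P? : ∀ i → Dec (P i)) → 0ℤ ℤ.≤ ∏ (truth ∘ P?)
∏-truth-≥0 P? = subst (0ℤ ℤ.≤_) (sym (∏-truth-all P? (Finₚ.all? P?))) (proj₁ (truth-bounds (Finₚ.all? P?)))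

cm-sum : ∀ {m k} (N : Fin k → Subset m → ℤ) → (∀ i → CompletelyMonotone (N i)) → CompletelyMonotone (λ J → ℤΣ λ i → N i J)
cm-sum {k = zero}  N c = cm-0
cm-sum {k = suc k} N c = cm-+ (c zero) (cm-sum (N ∘ suc) (c ∘ suc))

module _ (q : ℕ) {{_ : ℕ.NonZero q}} where
  open Residues q

  cm-box : ∀ {m n} (N : Vector ℤ n → Subset m → ℤ) → (∀ x → CompletelyMonotone (N x)) → CompletelyMonotone (λ J → box (λ x → N x J))
  cm-box {n = zero}  N c = c []ᶠ
  cm-box {n = suc n} N c = cm-sum {k = q} _ λ i → cm-box (λ v → N ((+ toℕ i) ∷ᶠ v)) λ v → c ((+ toℕ i) ∷ᶠ v)

  module _ {m n l} (A : Matrix m n) (B : Matrix l n) (a : Vector ℤ m) (b : Vector ℤ l) where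

    count : Subset m → ℤ
    count J = box (solves (Arrangement.C A B a b J) (Arrangement.c A B a b J))

    cm-count : CompletelyMonotone count
    cm-count = cm-box (λ x J → solves (Arrangement.C A B a b J) (Arrangement.c A B a b J) x) λ x →
      cm-cong (λ J → sym (split′ x J)) (cm-* (solves B b x) (∏-truth-≥0 (λ i → + q ∣? (B ·ℤ x) i ℤ.- b i))
        (cm-restrict _ λ i → truth-bounds (+ q ∣? (A ·ℤ x) i ℤ.- a i)))
      where
      split′ : ∀ x J → solves (Arrangement.C A B a b J) (Arrangement.c A B a b J) x ≡
        solves B b x ℤ.* restrict (λ i → truth (+ q ∣? (A ·ℤ x) i ℤ.- a i)) J
      split′ x J = trans (∏-++ l _) (cong₂ ℤ._*_
        (∏-cong λ i → cong₂ term (lookup-++ˡ B (A ∘ select J) i) (lookup-++ˡ b (a ∘ select J) i))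
        (trans (∏-cong λ k → cong₂ term (lookup-++ʳ B (A ∘ select J) k) (lookup-++ʳ b (a ∘ select J) k))
          (∏-select (λ i → truth (+ q ∣? (A ·ℤ x) i ℤ.- a i)) J)))
        where
        term : Vector ℤ n → ℤ → ℤ
        term α e = truth (+ q ∣? ℤΣ (λ j → α j ℤ.* x j) ℤ.- e)

-- The coefficients w, β and γ

sumOver-filter : ∀ {X : Set} {P : X → Set} (P? : Decidable P) (xs : List X) f →
  sumOver (filter P? xs) f ≡ sumOver xs (λ x → truth (P? x) ℤ.* f x)
sumOver-filter P? []       f = refl
sumOver-filter P? (x ∷ xs) f with P? x
... | yes _ = cong₂ ℤ._+_ (sym (ℤₚ.*-identityˡ (f x))) (sumOver-filter P? xs f)
... | no _  = trans (sumOver-filter P? xs f) (sym (ℤₚ.+-identityˡ _))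

∈-subsets : ∀ {m} (J : Subset m) → J ∈ᴸ subsets m
∈-subsets []ᵥ            = Any.here refl
∈-subsets (outside ∷ᵥ J) = ∈-++⁺ˡ (∈-map⁺ (outside ∷ᵥ_) (∈-subsets J))
∈-subsets {suc m} (inside ∷ᵥ J) = ∈-++⁺ʳ (map (outside ∷ᵥ_) (subsets m)) (∈-map⁺ (inside ∷ᵥ_) (∈-subsets J))

∣-foldr-lcm : ∀ {x xs} → x ∈ᴸ xs → x ∣ℕ foldr lcm 1 xs
∣-foldr-lcm {xs = y ∷ xs} (Any.here refl) = m∣lcm[m,n] y _
∣-foldr-lcm {xs = y ∷ xs} (Any.there p)   = ℕ∣.∣-trans (∣-foldr-lcm p) (n∣lcm[m,n] y _)

product-≥1 : ∀ {xs} → All (1 ℕ.≤_) xs → 1 ℕ.≤ ℕList.product xs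
product-≥1 []       = ℕ.s≤s ℕ.z≤n
product-≥1 (p ∷ ps) = ℕₚ.*-mono-≤ p (product-≥1 ps)

product-1 : ∀ {xs} → All (_≡ 1) xs → ℕList.product xs ≡ 1
product-1 []       = refl
product-1 (p ∷ ps) = cong₂ ℕ._*_ p (product-1 ps)

-- When e divides ρ, any common divisor of q and e divides gcd q ρ, so gcd q e sees q only through
-- gcd q ρ.
gcd-transfer : ∀ q α {ρ e} → gcd q ρ ≡ gcd α ρ → e ∣ℕ ρ → gcd q e ≡ gcd α e
gcd-transfer q α {ρ} {e} eq e∣ρ = ℕ∣.∣-antisym (half q α eq) (half α q (sym eq))
  where
  half : ∀ q α → gcd q ρ ≡ gcd α ρ → gcd q e ∣ℕ gcd α e
  half q α eq = gcd-greatest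
    (ℕ∣.∣-trans (subst (gcd q e ∣ℕ_) eq (gcd-greatest (gcd[m,n]∣m q e) (ℕ∣.∣-trans (gcd[m,n]∣n q e) e∣ρ))) (gcd[m,n]∣m α ρ))
    (gcd[m,n]∣n q e)

module Coefficients {m n l : ℕ} (A : Matrix m n) (B : Matrix l n) (a : Vector ℤ m) (b : Vector ℤ l) where
  open Arrangement A B a b

  Consistent : Subset m → Set
  Consistent J = r̄⟨ J ⟩ ≡ r⟨ J ⟩

  consistent? : ∀ J → Dec (Consistent J)
  consistent? J = r̄⟨ J ⟩ ℕₚ.≟ r⟨ J ⟩

  flatRank : Subset m → Maybe ℕ
  flatRank J = if does (consistent? J) then just r⟨ J ⟩ else nothing

  flatRank-just : ∀ {J} → Consistent J → flatRank J ≡ just r⟨ J ⟩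
  flatRank-just {J} p = cong (λ t → if t then just r⟨ J ⟩ else nothing) (dec-true (consistent? J) p)

  flatRank-nothing : ∀ {J} → ¬ Consistent J → flatRank J ≡ nothing
  flatRank-nothing {J} p = cong (λ t → if t then just r⟨ J ⟩ else nothing) (dec-false (consistent? J) p)

  just⇒consistent : ∀ {J k} → flatRank J ≡ just k → Consistent J × r⟨ J ⟩ ≡ k
  just⇒consistent {J} eq = go (consistent? J)
    where
    go : Dec (Consistent J) → Consistent J × r⟨ J ⟩ ≡ _
    go (yes p) = p , just-injective (trans (sym (flatRank-just {J} p)) eq)
      where
      just-injective : ∀ {x y : ℕ} → just x ≡ just y → x ≡ y
      just-injective refl = refl
    go (no ¬p) = contradiction (trans (sym (flatRank-nothing {J} ¬p)) eq) λ ()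

  rankFunction : RankFunction A B a b flatRank
  rankFunction J = go (solvability (C J) (c J))
    where
    go : Solvability (C J) (c J) → FlatRank (KernelOn A B J) (⋂H J) (flatRank J)
    go (solvable eq (p , h)) = subst (FlatRank _ _) (sym (flatRank-just {J} eq))
      (nonempty (C J) (kernel-select A B J) (p , to (Solution⇔⋂H J p) h))
    go (unsolvable neq none) = subst (FlatRank _ _) (sym (flatRank-nothing {J} neq))
      (void λ p h → none p (from (Solution⇔⋂H J p) h))

  indicator-cong : ∀ {j} (f g : Subset m → ℤ) → (∀ J → Consistent J → r⟨ J ⟩ ≡ j → f J ≡ g J) →
    ∀ J → indicator j (flatRank J) ℤ.* f J ≡ indicator j (flatRank J) ℤ.* g J
  indicator-cong {j} f g h J = go (consistent? J) (r⟨ J ⟩ ℕₚ.≟ j)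
    where
    vanish : indicator j (flatRank J) ≡ 0ℤ → indicator j (flatRank J) ℤ.* f J ≡ indicator j (flatRank J) ℤ.* g J
    vanish p = trans (cong (ℤ._* f J) p) (sym (cong (ℤ._* g J) p))
    go : Dec (Consistent J) → Dec (r⟨ J ⟩ ≡ j) → indicator j (flatRank J) ℤ.* f J ≡ indicator j (flatRank J) ℤ.* g J
    go (yes p) (yes q) = cong (indicator j (flatRank J) ℤ.*_) (h J p q)
    go (yes p) (no ¬q) = vanish (trans (cong (indicator j) (flatRank-just {J} p)) (monomial-≢ ¬q))
    go (no ¬p) _       = vanish (cong (indicator j) (flatRank-nothing {J} ¬p))

  -- χ sorts flats by dimension and `whitney` by rank. They match because rank and dimension add up
  -- to n, and j ≤ n keeps the truncated `n ∸ j` faithful.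
  w≡whitney : ∀ {j} → r ℕ.≤ j → j ℕ.≤ n → w j ≡ whitney j r flatRank
  w≡whitney {j} r≤j j≤n = cong₂ ℤ._*_ (-1^[j∸r]≡-1^[j+r] r≤j)
    (trans (sumOver-cong (subsets m) term) (sumOver-alternating (λ J → indicator j (flatRank J) ℤ.* 1ℤ)))
    where
    term : ∀ J → [ (λ f → -1ℤ ℤ.^ ∣ J ∣ ℤ.* monomial (proj₁ f) (n ℕ.∸ j)) , (λ _ → 0ℤ) ] (flat J) ≡
      -1ℤ ℤ.^ ∣ J ∣ ℤ.* (indicator j (flatRank J) ℤ.* 1ℤ)
    term J = go (flat J)
      where
      go : (z : ∃ (HasDimension (⋂H J)) ⊎ (∀ x → ¬ ⋂H J x)) → [ (λ f → -1ℤ ℤ.^ ∣ J ∣ ℤ.* monomial (proj₁ f) (n ℕ.∸ j)) , (λ _ → 0ℤ) ] z ≡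
        -1ℤ ℤ.^ ∣ J ∣ ℤ.* (indicator j (flatRank J) ℤ.* 1ℤ)
      go (inj₁ (k , hd@(p , h , _))) = cong (-1ℤ ℤ.^ ∣ J ∣ ℤ.*_) (trans (same (r⟨ J ⟩ ℕₚ.≟ j))
        (sym (trans (ℤₚ.*-identityʳ _) (cong (indicator j) (flatRank-unique (rankFunction J) (nonempty (C J) (kernel-select A B J) (p , h)))))))
        where
        r+k≡n : r⟨ J ⟩ ℕ.+ k ≡ n
        r+k≡n = ℝ-Dimension.dimension-solution 1≉0 (smith (C J)) (λ x → mk⇔ (from (Solution⇔⋂H J x)) (to (Solution⇔⋂H J x))) hd
        same : Dec (r⟨ J ⟩ ≡ j) → monomial k (n ℕ.∸ j) ≡ monomial r⟨ J ⟩ j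
        same (yes eq) = trans (monomial-≡ (sym (trans (cong₂ ℕ._∸_ (sym r+k≡n) (sym eq)) (ℕₚ.m+n∸m≡n r⟨ J ⟩ k)))) (sym (monomial-≡ eq))
        same (no neq) = trans (monomial-≢ λ eq → neq (ℕₚ.+-cancelʳ-≡ k r⟨ J ⟩ j (trans r+k≡n (trans (sym (ℕₚ.m+[n∸m]≡n j≤n)) (cong (j ℕ.+_) (sym eq))))))
          (sym (monomial-≢ neq))
      go (inj₂ none) = sym (trans (cong (λ z → -1ℤ ℤ.^ ∣ J ∣ ℤ.* (indicator j z ℤ.* 1ℤ)) (flatRank-unique (rankFunction J) (void none)))
        (ℤₚ.*-zeroʳ (-1ℤ ℤ.^ ∣ J ∣)))

  β≡weighted : ∀ {j} q → r ℕ.≤ j → β j q ≡ weighted j r flatRank (λ J → + d̃ J q)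
  β≡weighted {j} q r≤j = cong₂ ℤ._*_ (-1^[j∸r]≡-1^[j+r] r≤j)
    (trans (sumOver-filter selected? (subsets m) (λ J → -1ℤ ℤ.^ ∣ J ∣ ℤ.* + d̃ J q))
      (trans (sumOver-cong (subsets m) term) (sumOver-alternating (λ J → indicator j (flatRank J) ℤ.* + d̃ J q))))
    where
    selected? : ∀ J → Dec (Consistent J × r⟨ J ⟩ ≡ j)
    selected? J = consistent? J ×-dec (r⟨ J ⟩ ℕₚ.≟ j)
    truth≡ : ∀ J → truth (selected? J) ≡ indicator j (flatRank J)
    truth≡ J = go (consistent? J) (r⟨ J ⟩ ℕₚ.≟ j)
      where
      go : Dec (Consistent J) → Dec (r⟨ J ⟩ ≡ j) → truth (selected? J) ≡ indicator j (flatRank J)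
      go (yes p) (yes q) = trans (truth-cong (selected? J) (yes (p , q)) (mk⇔ id id)) (sym (trans (cong (indicator j) (flatRank-just {J} p)) (monomial-≡ q)))
      go (yes p) (no ¬q) = trans (truth-cong (selected? J) (no (¬q ∘ proj₂)) (mk⇔ id id)) (sym (trans (cong (indicator j) (flatRank-just {J} p)) (monomial-≢ ¬q)))
      go (no ¬p) _       = trans (truth-cong (selected? J) (no (¬p ∘ proj₁)) (mk⇔ id id)) (sym (cong (indicator j) (flatRank-nothing {J} ¬p)))
    term : ∀ J → truth (selected? J) ℤ.* (-1ℤ ℤ.^ ∣ J ∣ ℤ.* + d̃ J q) ≡ -1ℤ ℤ.^ ∣ J ∣ ℤ.* (indicator j (flatRank J) ℤ.* + d̃ J q)
    term J = trans (cong (ℤ._* (-1ℤ ℤ.^ ∣ J ∣ ℤ.* + d̃ J q)) (truth≡ J)) (exchange (indicator j (flatRank J)) (-1ℤ ℤ.^ ∣ J ∣) (+ d̃ J q))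

  indices : Subset m → List ℕ
  indices J = map suc (upTo r⟨ J ⟩)

  indices-≤ : ∀ J → All (ℕ._≤ r⟨ J ⟩) (indices J)
  indices-≤ J = Allₚ.map⁺ (Allₚ.all-upTo r⟨ J ⟩)

  d̃-product : ∀ J q → (∀ j → j ℕ.≤ r⟨ J ⟩ → gcd q (d J j) ≡ gcd q (d̄ J j)) →
    d̃ J q ≡ ℕList.product (map (λ j → gcd (d J j) q) (indices J))
  d̃-product J q h = cong (λ t → if t then ℕList.product (map (λ j → gcd (d J j) q) (indices J)) else 0)
    (dec-true (All.all? (λ j → gcd q (d J j) ℕₚ.≟ gcd q (d̄ J j)) (indices J)) (All.map (λ {j} → h j) (indices-≤ J)))

  d̃-1 : ∀ J → d̃ J 1 ≡ 1
  d̃-1 J = trans (d̃-product J 1 λ j _ → trans (gcd-zeroˡ (d J j)) (sym (gcd-zeroˡ (d̄ J j))))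
    (product-1 (Allₚ.map⁺ (All.universal (λ j → gcd-zeroʳ (d J j)) (indices J))))

  γ-1 : ∀ {j} → r ℕ.≤ j → γ j 1 ≡ whitney j r flatRank
  γ-1 {j} r≤j = trans (β≡weighted 1 r≤j) (cong (-1ℤ ℤ.^ (j ℕ.+ r) ℤ.*_)
    (alternating-cong λ J → cong (λ k → indicator j (flatRank J) ℤ.* + k) (d̃-1 J)))

  d̄∣d : ∀ J j → d̄ J j ∣ℕ d J j
  d̄∣d J zero    = ℕ∣.∣-refl
  d̄∣d J (suc k) = augment-d-∣ (C J) (c J) k

  d∣ρ : ∀ J → Consistent J → ∀ j → j ℕ.≤ r⟨ J ⟩ → d J j ∣ℕ ρ
  d∣ρ J p j j≤r = ℕ∣.∣-trans (chain j r⟨ J ⟩ j≤r) (∣-foldr-lcm (∈-map⁺ (λ J → d J r⟨ J ⟩) (∈-filter⁺ consistent? (∈-subsets J) p)))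
    where
    chain : ∀ i j → i ℕ.≤ j → d J i ∣ℕ d J j
    chain zero    j       _           = ℕ∣.1∣ d J j
    chain (suc i) (suc j) (ℕ.s≤s i≤j) = d-mono (smith (C J)) i≤j

  module _ (q α : ℕ) (1≤q : 1 ℕ.≤ q) (gcd≡ : gcd q ρ ≡ gcd α ρ)
    (solvable-q : ∀ J → Consistent J → InColumnSpan q (C J) (c J)) where

    private
      instance
        q≢0 : ℕ.NonZero q
        q≢0 = ℕ.>-nonZero 1≤q

    open Residues q

    gcd-d-q : ∀ J → Consistent J → ∀ j → gcd q (d J j) ≡ gcd q (d̄ J j)
    gcd-d-q J p zero    = refl
    gcd-d-q J p (suc k) = columnSpan-gcd q (C J) (c J) (solvable-q J p) k

    d̃-q : ∀ J → Consistent J → d̃ J q ≡ ℕList.product (map (λ j → gcd (d J j) q) (indices J))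
    d̃-q J p = d̃-product J q λ j _ → gcd-d-q J p j

    -- Both d J j and its divisor d̄ J j divide ρ. The gcd test therefore passes from q to α, and
    -- the factors of the two products agree.
    d̃-α≡d̃-q : ∀ J → Consistent J → d̃ J α ≡ d̃ J q
    d̃-α≡d̃-q J p = trans (d̃-product J α λ j j≤r → trans (sym (gcd-transfer q α gcd≡ (d∣ρ J p j j≤r)))
        (trans (gcd-d-q J p j) (gcd-transfer q α gcd≡ (ℕ∣.∣-trans (d̄∣d J j) (d∣ρ J p j j≤r)))))
      (trans (cong ℕList.product (map-cong-local (All.map (λ {j} j≤r → trans (gcd-comm (d J j) α)
        (trans (sym (gcd-transfer q α gcd≡ (d∣ρ J p j j≤r))) (gcd-comm q (d J j)))) (indices-≤ J)))) (sym (d̃-q J p)))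

    γ-α≡β-q : ∀ {j} → r ℕ.≤ j → γ j α ≡ β j q
    γ-α≡β-q {j} r≤j = trans (β≡weighted α r≤j) (trans
      (cong (-1ℤ ℤ.^ (j ℕ.+ r) ℤ.*_) (alternating-cong (indicator-cong _ _ λ J p _ → cong +_ (d̃-α≡d̃-q J p))))
      (sym (β≡weighted q r≤j)))

    pos-^ : ∀ k → (+ q) ℤ.^ k ≡ + (q ℕ.^ k)
    pos-^ zero    = refl
    pos-^ (suc k) = trans (cong (+ q ℤ.*_) (pos-^ k)) (sym (ℤₚ.pos-* q (q ℕ.^ k)))

    count≡ : ∀ J → Consistent J → count q A B a b J ≡ + (q ℕ.^ (n ℕ.∸ r⟨ J ⟩)) ℤ.* + d̃ J q
    count≡ J p = trans (solution-count (smith (C J)) (proj₁ (solvable-q J p)) (proj₂ (solvable-q J p)))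
      -- Coordinates beyond the rank have invariant factor 0, and each contributes gcd 0 q = q.
      (trans (∏-tail (λ k → + gcd (SmithForm.d (smith (C J)) k) q) (+ q) (SmithForm.rk≤n (smith (C J)))
        (λ k r≤k → cong +_ (trans (cong (λ z → gcd z q) (SmithForm.d≡0 (smith (C J)) k r≤k)) (gcd-identityˡ q))))
      (trans (ℤₚ.*-comm _ ((+ q) ℤ.^ (n ℕ.∸ r⟨ J ⟩))) (cong₂ ℤ._*_ (pos-^ (n ℕ.∸ r⟨ J ⟩))
        (trans (sym (product-∏ (λ j → gcd (d J j) q) id r⟨ J ⟩)) (cong +_ (sym (d̃-q J p)))))))

    d̃-q≥1 : ∀ J → Consistent J → 1 ℕ.≤ d̃ J q
    d̃-q≥1 J p = subst (1 ℕ.≤_) (sym (d̃-q J p)) (product-≥1 (Allₚ.map⁺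
      (All.universal (λ j → ℕₚ.n≢0⇒n>0 (gcd[m,n]≢0 (d J j) q (inj₂ (ℕ.≢-nonZero⁻¹ q)))) (indices J))))

    -- The induction is run on the counts, which are completely monotone. On consistent sets of rank
    -- j they equal κ * d̃ J q with one common κ > 0, so κ can be cancelled from the resulting
    -- inequality.
    γ-1≤β-q : ∀ {j} → ∃ V → r ℕ.≤ j → γ j 1 ℤ.≤ β j q
    γ-1≤β-q {j} p r≤j = subst₂ ℤ._≤_ (sym (γ-1 r≤j)) (sym (β≡weighted q r≤j))
      (ℤₚ.*-cancelˡ-≤-pos _ _ κ {{ℤ.positive κ>0}} (subst (κ ℤ.* whitney j r flatRank ℤ.≤_) weighted-count
        (weighted-≥ j κ (semimatroid rankFunction p) (cm-count q A B a b) (ℤₚ.<⇒≤ κ>0) bound)))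
      where
      κ : ℤ
      κ = + (q ℕ.^ (n ℕ.∸ j))
      κ>0 : 0ℤ ℤ.< κ
      κ>0 = ℤ.+<+ (ℕₚ.m^n>0 q (n ℕ.∸ j))
      bound : ∀ J → flatRank J ≡ just j → κ ℤ.≤ count q A B a b J
      bound J eq = let p , r≡j = just⇒consistent {J} eq in subst₂ ℤ._≤_ (ℤₚ.*-identityʳ κ)
        (sym (trans (count≡ J p) (cong (λ k → + (q ℕ.^ (n ℕ.∸ k)) ℤ.* + d̃ J q) r≡j)))
        -- The bound κ is attained when d̃ J q = 1; in general d̃ J q is a product of gcds with the
        -- positive number q.
        (ℤₚ.*-monoˡ-≤-nonNeg κ (ℤ.+≤+ (d̃-q≥1 J p)))
      weighted-count : weighted j r flatRank (count q A B a b) ≡ κ ℤ.* weighted j r flatRank (λ J → + d̃ J q)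
      weighted-count = begin
        -1ℤ ℤ.^ (j ℕ.+ r) ℤ.* alternating (λ J → indicator j (flatRank J) ℤ.* count q A B a b J)
          ≡⟨ cong (-1ℤ ℤ.^ (j ℕ.+ r) ℤ.*_) (trans (alternating-cong λ J → trans
               (indicator-cong (count q A B a b) (λ J → κ ℤ.* + d̃ J q)
                 (λ J p r≡j → trans (count≡ J p) (cong (λ k → + (q ℕ.^ (n ℕ.∸ k)) ℤ.* + d̃ J q) r≡j)) J)
               (exchange (indicator j (flatRank J)) κ (+ d̃ J q)))
             (sym (alternating-*ˡ κ (λ J → indicator j (flatRank J) ℤ.* + d̃ J q)))) ⟩
        -1ℤ ℤ.^ (j ℕ.+ r) ℤ.* (κ ℤ.* alternating (λ J → indicator j (flatRank J) ℤ.* + d̃ J q))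
          ≡⟨ exchange (-1ℤ ℤ.^ (j ℕ.+ r)) κ _ ⟩
        κ ℤ.* weighted j r flatRank (λ J → + d̃ J q) ∎
        where open ≡-Reasoning

  -- If A i were a combination of rows of B, adjoining it could not raise the
  -- rank, so H i could not have smaller dimension than V.
  nonzero-on-kernel : (∀ i → ∃ λ k → HasDimension V (suc k) × HasDimension (H i) k) →
    ∀ i → ∃ λ x → Kernelℤ B x × (A ·ℤ x) i ≢ 0ℤ
  nonzero-on-kernel codim i = go (rowSpan? (smith B) (A i))
    where
    go : RowSpan B (A i) → ∃ λ x → Kernelℤ B x × (A ·ℤ x) i ≢ 0ℤ
    go (independent x Bx≡0 αx≢0) = x , Bx≡0 , αx≢0
    go (dependent t y t≢0 eq) = contradiction
      (subst₂ ℕ._≤_ (trans Hi-dim (sym V-dim)) refl (ℕₚ.+-monoˡ-≤ k (rank-≤ {M = B} {A i ∷ᶠ B} λ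
        { x Bx≡0 zero → dependent-kernel B (A i) y t≢0 eq x Bx≡0 ; x Bx≡0 (suc j) → Bx≡0 j })))
      (ℕₚ.<⇒≱ (ℕₚ.+-monoʳ-< (rank B) (ℕₚ.n<1+n k)))
      where
      k = proj₁ (codim i)
      V-dim : rank B ℕ.+ suc k ≡ n
      V-dim = ℝ-Dimension.dimension-solution 1≉0 (smith B) (λ x → mk⇔ id id) (proj₁ (proj₂ (codim i)))
      Hi-dim : rank (A i ∷ᶠ B) ℕ.+ k ≡ n
      Hi-dim = ℝ-Dimension.dimension-solution 1≉0 {c = a i ∷ᶠ b} (smith (A i ∷ᶠ B))
        (λ x → mk⇔ (λ { (v , h) → λ { zero → h ; (suc j) → v j } }) (λ h → h ∘ suc , h zero)) (proj₂ (proj₂ (codim i)))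

  inequalities : ∃ V → (∀ i → ∃ λ k → HasDimension V (suc k) × HasDimension (H i) k) →
    ∀ q α → 1 ℕ.≤ q → gcd q ρ ≡ gcd α ρ → (∀ J → r̄⟨ J ⟩ ≡ r⟨ J ⟩ → InColumnSpan q (C J) (c J)) →
    ∀ j → r ℕ.≤ j → j ℕ.≤ s → 0ℤ ℤ.< w j × w j ≡ γ j 1 × γ j 1 ℤ.≤ γ j α × γ j α ≡ β j q
  inequalities p codim q α 1≤q gcd≡ sol j r≤j j≤s =
    subst (0ℤ ℤ.<_) (sym w≡) (whitney->0 j (reaches j rankFunction p (nonzero-on-kernel codim) r≤j j≤s)) ,
    trans w≡ (sym (γ-1 r≤j)) ,
    subst (γ j 1 ℤ.≤_) (sym γ≡β) (γ-1≤β-q q α 1≤q gcd≡ sol p r≤j) ,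
    γ≡β
    where
    w≡ : w j ≡ whitney j r flatRank
    w≡ = w≡whitney r≤j (ℕₚ.≤-trans j≤s (SmithForm.rk≤n (smith (B ++ A))))
    γ≡β : γ j α ≡ β j q
    γ≡β = γ-α≡β-q q α 1≤q gcd≡ sol r≤j

  homogeneous-span : (∀ i → a i ≡ 0ℤ) → (∀ i → b i ≡ 0ℤ) → ∀ q J → InColumnSpan q (C J) (c J)
  homogeneous-span a≡0 b≡0 q J = (λ _ → 0ℤ) , λ i → divides 0ℤ (cong₂ ℤ._-_ (ℤM.·-0 (C J) i) (c≡0 i))
    where
    c≡0 : ∀ i → c J i ≡ 0ℤ
    c≡0 = ↑-elim l _ (λ i → trans (lookup-++ˡ b (a ∘ select J) i) (b≡0 i)) (λ k → trans (lookup-++ʳ b (a ∘ select J) k) (a≡0 (select J k)))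

corollary3p8 : ∀ {m n l : ℕ} (A : Matrix m n) (B : Matrix l n) (a : Vector ℤ m) (b : Vector ℤ l) →
    let open Arrangement A B a b in
    ∃ V →
    (∀ i → ∃ λ k → ℝ-Space.HasDimension V (suc k) × ℝ-Space.HasDimension (H i) k) →
    (∀ (q α : ℕ) → q₀ < q → 1 ≤ α → α ≤ ρ → gcd q ρ ≡ gcd α ρ →
    (∀ J → r̄⟨ J ⟩ ≡ r⟨ J ⟩ → InColumnSpan q (C J) (c J)) →
    ∀ j → r ≤ j → j ≤ s →
    0ℤ <ℤ w j × w j ≡ γ j 1 × γ j 1 ≤ℤ γ j α × γ j α ≡ β j q)
    ×
    ((∀ i → a i ≡ 0ℤ) → (∀ i → b i ≡ 0ℤ) →
    ∀ (q α : ℕ) → 1 ≤ q → 1 ≤ α → α ≤ ρ → gcd q ρ ≡ gcd α ρ →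
    ∀ j → r ≤ j → j ≤ s →
    0ℤ <ℤ w j × w j ≡ γ j 1 × γ j 1 ≤ℤ γ j α × γ j α ≡ β j q)
corollary3p8 A B a b p codim =
  (λ q α q₀<q _ _ gcd≡ sol → inequalities p codim q α (ℕₚ.≤-trans (ℕ.s≤s ℕ.z≤n) q₀<q) gcd≡ sol) ,
  -- A homogeneous system has the zero vector as a solution modulo every q, which supplies the
  -- column condition.
  (λ a≡0 b≡0 q α 1≤q _ _ gcd≡ → inequalities p codim q α 1≤q gcd≡ (λ J _ → homogeneous-span a≡0 b≡0 q J))
  where open Coefficients A B a b
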